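{- Let $p$ be an odd prime, $k$ and $\ell$ positive integers, $q=p^k$ and $Q=p^{\ell}$. For $\mathbf{c}=(c_0,c_1,c_2,c_3)\in\mathbb{F}_{q^2}^4$ let $$f_{\mathbf{c}}(X)=c_0X^{qQ+q}+c_1X^{qQ+1}+c_2X^{Q+q}+c_3X^{Q+1}\in\mathbb{F}_{q^2}[X].$$ Then $f_{\mathbf{c}}$ is planar over $\mathbb{F}_{q^2}$ if and only if it is linear equivalent to one of the following functions: \begin{enumerate} \item $X^{Q+1}$ on $\mathbb{F}_{q^2}$, where $\frac{\ell}{\gcd(k,\ell)}$ is even; \item $X^{Q+q}$ on $\mathbb{F}_{q^2}$, where $\frac{k\ell}{\gcd(k,\ell)^2}$ is odd; \item $P_2:\mathbb{F}_q^2\to\mathbb{F}_q^2$, $P_2(x,y)=(x^Qy,\;x^{Q+1}+\varepsilon y^{Q+1})$, where $\frac{k}{\gcd(k,\ell)}$ is odd and $\varepsilon\in\mathbb{F}_q^*$ is a non-square. \end{enumerate} Moreover, if $k\mid \ell$, then $f_{\mathbf{c}}$ is planar if and only if it is linear equivalent to $X^2$ on $\mathbb{F}_{q^2}$.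
   Context: A function $F:V\to V$ on a finite-dimensional $\mathbb{F}_p$-vector space $V$ (here $V=\mathbb{F}_{q^2}$ or $\mathbb{F}_q^2$) is planar if for every nonzero $a\in V$ the map $x\mapsto F(x+a)-F(x)$ is a bijection of $V$. Two functions $F:V\to V$ and $F':V'\to V'$, where $V,V'$ are each $\mathbb{F}_{q^2}$ or $\mathbb{F}_q^2$ (all viewed as $\mathbb{F}_p$-vector spaces of the same dimension $2k$), are linear equivalent if $F'=L_1\circ F\circ L_2$ for some $\mathbb{F}_p$-linear bijections $L_2:V'\to V$ and $L_1:V\to V'$. -}

module Defs where

open import Level using (0ℓ)
open import Data.Nat as ℕ using (ℕ; zero; suc; NonZero; ≢-nonZero)
open import Data.Nat.GCD using (gcd; gcd[m,n]≢0)
open import Data.Nat.DivMod using (_/_)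
open import Data.Nat.Divisibility using (_∣_)
open import Data.Fin using (Fin)
open import Data.Product using (Σ; ∃; ∃-syntax; _×_; _,_; proj₁; proj₂)
open import Data.Sum using (_⊎_; inj₁)
open import Relation.Nullary using (¬_)
open import Relation.Binary.PropositionalEquality using (_≡_; _≢_)
open import Algebra.Structures using (IsCommutativeRing)
open import Function.Bundles using (_↔_)
open import Function.Definitions using (Bijective)

record FiniteField : Set₁ where
  infixl 7 _*_
  infixl 6 _+_ _-_
  infixr 8 _^_
  field
    Carrier : Set
    _+_ _*_ : Carrier → Carrier → Carrier
    -_      : Carrier → Carrier
    0# 1#   : Carrier
    isCommutativeRing : IsCommutativeRing _≡_ _+_ _*_ -_ 0# 1#
    0≢1     : 0# ≢ 1#
    inverse : ∀ x → x ≢ 0# → ∃[ y ] (x * y ≡ 1#)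
    size    : ℕ
    enum    : Carrier ↔ Fin size

  _-_ : Carrier → Carrier → Carrier
  x - y = x + (- y)

  _^_ : Carrier → ℕ → Carrier
  x ^ zero  = 1#
  x ^ suc n = x * (x ^ n)

module _ (K : FiniteField) where
  open FiniteField K

  Planar : (Carrier → Carrier) → Set
  Planar F = ∀ a → a ≢ 0# → Bijective _≡_ _≡_ (λ x → F (x + a) - F x)

  -- F_p-linear maps between F_p-vector spaces are exactly the additive maps
  -- (scalars of F_p act by repeated addition).
  Additive : (Carrier → Carrier) → Set
  Additive L = ∀ x y → L (x + y) ≡ L x + L y

  LinEquivKK : (F G : Carrier → Carrier) → Set
  LinEquivKK F G = Σ (Carrier → Carrier) λ L1 → Σ (Carrier → Carrier) λ L2 →
    Additive L1 × Bijective _≡_ _≡_ L1 ×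
    Additive L2 × Bijective _≡_ _≡_ L2 ×
    (∀ x → G x ≡ L1 (F (L2 x)))

  Sub : ℕ → Set
  Sub q = Σ Carrier (λ x → x ^ q ≡ x)

  -- F_q^2 as pairs of elements of the subfield; its addition is computed
  -- in K × K (underlying elements)
  Pair : ℕ → Set
  Pair q = Sub q × Sub q

  emb : ∀ q → Pair q → Carrier × Carrier
  emb _ ((x , _) , (y , _)) = (x , y)

  _+²_ : Carrier × Carrier → Carrier × Carrier → Carrier × Carrier
  (x , y) +² (x' , y') = (x + x' , y + y')

  AdditiveFrom : ∀ {q} → (Pair q → Carrier) → Set
  AdditiveFrom {q} L = ∀ (u v w : Pair q) → emb q w ≡ emb q u +² emb q v → L w ≡ L u + L v

  AdditiveTo : ∀ {q} → (Carrier → Pair q) → Set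
  AdditiveTo {q} L = ∀ x y → emb q (L (x + y)) ≡ emb q (L x) +² emb q (L y)

  -- G = L1 ∘ F ∘ L2 with F_p-linear bijections L2 : F_q^2 → K, L1 : K → F_q^2,
  -- where G : F_q^2 → F_q^2 is given through its values in K × K.
  LinEquivKPair : (q : ℕ) (F : Carrier → Carrier) (G : Pair q → Carrier × Carrier) → Set
  LinEquivKPair q F G = Σ (Carrier → Pair q) λ L1 → Σ (Pair q → Carrier) λ L2 →
    AdditiveTo {q} L1 × Bijective _≡_ _≡_ L1 ×
    AdditiveFrom {q} L2 × Bijective _≡_ _≡_ L2 ×
    (∀ v → G v ≡ emb q (L1 (F (L2 v))))

  fc : (q Q : ℕ) → Carrier × Carrier × Carrier × Carrier → Carrier → Carrier
  fc q Q (c0 , c1 , c2 , c3) x =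
    c0 * x ^ (q ℕ.* Q ℕ.+ q) + c1 * x ^ (q ℕ.* Q ℕ.+ 1)
      + c2 * x ^ (Q ℕ.+ q) + c3 * x ^ (Q ℕ.+ 1)

  P2 : ∀ {q} (Q : ℕ) → Carrier → Pair q → Carrier × Carrier
  P2 Q ε ((x , _) , (y , _)) = (x ^ Q * y , x ^ (Q ℕ.+ 1) + ε * y ^ (Q ℕ.+ 1))

  NonSquare : (q : ℕ) → Sub q → Set
  NonSquare q (e , _) = e ≢ 0# × ¬ (Σ (Sub q) λ z → proj₁ z * proj₁ z ≡ e)

gcd-nonZero : ∀ k ℓ → .{{NonZero k}} → NonZero (gcd k ℓ)
gcd-nonZero (suc k) ℓ = ≢-nonZero (gcd[m,n]≢0 (suc k) ℓ (inj₁ λ ()))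

_/gcd[_,_] : (n k ℓ : ℕ) → .{{NonZero k}} → ℕ
n /gcd[ k , ℓ ] = _/_ n (gcd k ℓ) {{gcd-nonZero k ℓ}}

Even Odd : ℕ → Set
Even n = 2 ∣ n
Odd n = ¬ (2 ∣ n)

{-# OPTIONS --safe #-}

-- Write x̄ = x^q, φ x = x^Q, f = f_c and f (a + x) - f a - f x = D a x. Then f x = B (φ x) x with B bilinear over ℱ_q, and f is planar
-- if and only if D a x = 0 only for a = 0 or x = 0. With d = gcd k ℓ, planarity forces k / d to be odd. Let q₁ s and q₂ x be
-- the determinants of the ℱ_q-linear maps B s · and B · x; they are binary quadratic forms over ℱ_q with the same discriminant Δ.
-- If f is planar then q₁ (φ a) y + q₂ a (φ y) ≠ 0 for all a ≠ 0 and all y ≠ 0 with ȳ = - y, and this decides everything.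
--
-- If Δ = 0, the kernels of q₁ and q₂ give coordinates in which f is P₂, and ε is a non-square by the above inequality.
--
-- If Δ ≠ 0 and e = k / d ≥ 3, write q₁ ∘ φ = φ ∘ q₁′. The inequality says that q₁′ ± z q₂ is anisotropic, i.e. its discriminant,
-- a quadratic polynomial in z, is a non-zero square of ℱ_q, for all z in the group T of elements of norm 1 over ℱ_{p^d}.
-- If this polynomial had distinct roots u and v, then (z - u)^m = κ (z - v)^m on T, where m is (q - 1) / 2 or (q + 1) / 2 according
-- to whether u and v lie in ℱ_q or are conjugate. Put D = p^d, r = (D - 1) / 2, S = 1 + D + … + D^(e-2) and W = D^(e-1). Since
-- |T| = S + W, and r (S + W) = (q - 1) / 2, the Frobenius map z ↦ z^W turns this into the equality on T of the polynomials
-- (X - u)^(m - r W) (1 - u^W X^S)^r and κ (X - v)^(m - r W) (1 - v^W X^S)^r, whose degrees are less than |T|; so they are equal,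
-- and comparing the coefficients of 1 and X gives u = v. Hence the discriminant has a double root, which makes q₁′ and q₂ proportional
-- and anisotropic. After an ℱ_q-linear substitution both are multiples of x x̄, which leaves only f = A z + C z̄ with z = φ x x or φ x x̄.
--
-- If e = 1, then φ is trivial on ℱ_q, f is a quadratic form, and choosing B symmetric makes q₁ = q₂; the last step applies again.

module Submission where

open import Defs
open import Level using (0ℓ)
open import Data.Nat as ℕ using (ℕ; zero; suc; s≤s; z≤n; NonZero)
import Data.Nat.Properties as ℕ
open import Data.Nat.DivMod using (_/_; m/n*n≡m; m*n/n≡m; m≡m%n+[m/n]*n; m%n<n)
open import Data.Nat.Divisibility using (_∣_; divides; ∣⇒≤; m∣m*n; m%n≡0⇒n∣m)
open import Data.Nat.GCD using (gcd; gcd[m,n]∣m; gcd[m,n]∣n; gcd-greatest; gcd[m,n]≢0; gcd-GCD; module Bézout)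
open import Data.Nat.Primality using (Prime; euclidsLemma; prime⇒nonZero; prime⇒nonTrivial; prime⇒irreducible)
open import Data.Nat.Tactic.RingSolver using (solve-∀)
open import Data.Integer as ℤ using (ℤ; -[1+_]; _⊖_)
import Data.Integer.Properties as ℤ
open import Data.Fin as Fin using (Fin; toℕ; fromℕ)
import Data.Fin.Properties as Fin
open import Data.Fin.Permutation using (Permutation; permutation; _⟨$⟩ʳ_)
open import Data.List as List using (List; []; _∷_; length; _++_; replicate)
import Data.List.Properties as List
open import Data.List.Relation.Unary.All as All using (All; []; _∷_)
import Data.List.Relation.Unary.All.Properties as All
open import Data.Maybe using (Maybe; just; nothing)
open import Data.Product using (Σ; ∃; ∃-syntax; _×_; _,_; proj₁; proj₂)
open import Data.Sum using (_⊎_; inj₁; inj₂)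
open import Data.Empty using (⊥; ⊥-elim)
open import Data.Unit using (⊤; tt)
open import Relation.Nullary using (¬_; Dec; yes; no; contradiction)
open import Relation.Nullary.Decidable using (map′; ¬?; _×-dec_; decidable-stable)
open import Relation.Binary.PropositionalEquality
open import Axiom.UniquenessOfIdentityProofs using (module Decidable⇒UIP)
open import Algebra.Bundles using (CommutativeRing)
open import Algebra.Solver.Ring.AlmostCommutativeRing
  using (AlmostCommutativeRing; fromCommutativeRing; _-Raw-AlmostCommutative⟶_)
import Algebra.Solver.Ring
import Algebra.Properties.CommutativeMonoid.Sum
import Algebra.Properties.CommutativeSemiring.Binomial
import Algebra.Properties.Ring
import Algebra.Properties.Semiring.Exp
import Algebra.Properties.Semiring.Mult
import Algebra.Properties.Semiring.Mult.TCOptimised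
open import Function.Base using (_∘_; case_of_)
open import Function.Bundles using (_⇔_; mk⇔; Inverse)
open import Function.Definitions using (Bijective; Injective)

-- The inequality sees a skew `y` only through `φ y / y`. Writing `y = ι b φ y₀` with `b = q₂ a` and
-- `y₀` in ℱ_q, and then undoing `φ`, turns it into `q₁′ a ± z q₂ a ≠ 0` with `z = φ y₀ / y₀`. The
-- sign is that of `φ ι = ± ι`; to have one, `ι` is chosen with `ι^(p^d) = - ι`, which for odd
-- `k / d` is stronger than `ι^q = - ι`. The obstacle is that the exponents `m` are too large: (q -
-- 1) / 2 = r |T| is at least |T|, so equality of the two powers on `T` says nothing yet about
-- polynomials. On `T` one has `z^(S + W) = 1`, and raising to the power `W` is additive; together
-- they replace `(z - u)^W` by `1 - u^W z^S` up to the factor `z^S`. Only this brings the degrees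
-- below |T|. For `e = 1` the group `T` is trivial and its inequality carries too little
-- information, so proportionality of the two forms has to come from symmetry of `B` instead.

-- Arithmetic of finite fields

module FieldProperties (K : FiniteField) where
  open FiniteField K public

  ring : CommutativeRing 0ℓ 0ℓ
  ring = record { isCommutativeRing = isCommutativeRing }

  open CommutativeRing ring public
    using ( +-comm; +-assoc; *-comm; *-assoc; +-identityˡ; +-identityʳ
          ; *-identityˡ; *-identityʳ; distribˡ; distribʳ; zeroˡ; zeroʳ
          ; -‿inverseˡ; -‿inverseʳ)
  open Algebra.Properties.Ring (CommutativeRing.ring ring) public
    using (-‿involutive; -‿distribˡ-*; -‿distribʳ-*; -0#≈0#; +-cancelˡ; x+x≈x⇒x≈0)
  private
    module M = Algebra.Properties.Semiring.Mult.TCOptimised (CommutativeRing.semiring ring)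

  -- This version of the multiple reduces `fromℕ′ 1` to `1#` and `fromℕ′ 2` to `1# + 1#`, so that
  -- the constants of the solver agree with those of the goals by computation.
  fromℕ′ : ℕ → Carrier
  fromℕ′ n = n M.× 1#

  ⟦_⟧ℤ : ℤ → Carrier
  ⟦ ℤ.+ n ⟧ℤ = fromℕ′ n
  ⟦ -[1+ n ] ⟧ℤ = - fromℕ′ (suc n)

  private
    A = fromCommutativeRing ring
    open AlmostCommutativeRing A using (-‿+-comm)

    cancel₁ : ∀ x y → (1# + x) + - (1# + y) ≡ x + - y
    cancel₁ x y = begin
      (1# + x) + - (1# + y)  ≡⟨ cong ((1# + x) +_) (-‿+-comm 1# y) ⟨
      (1# + x) + (- 1# + - y)  ≡⟨ cong (_+ (- 1# + - y)) (+-comm 1# x) ⟩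
      (x + 1#) + (- 1# + - y)  ≡⟨ +-assoc x 1# _ ⟩
      x + (1# + (- 1# + - y))  ≡⟨ cong (x +_) (+-assoc 1# _ _) ⟨
      x + ((1# + - 1#) + - y)  ≡⟨ cong (λ z → x + (z + - y)) (-‿inverseʳ 1#) ⟩
      x + (0# + - y)  ≡⟨ cong (x +_) (+-identityˡ _) ⟩
      x + - y  ∎
      where open ≡-Reasoning

    ⊖-homo : ∀ m n → ⟦ m ⊖ n ⟧ℤ ≡ fromℕ′ m + - fromℕ′ n
    ⊖-homo m zero = trans (cong ⟦_⟧ℤ (ℤ.⊖-≥ {m} {0} z≤n)) (sym (trans (cong (fromℕ′ m +_) -0#≈0#) (+-identityʳ _)))
    ⊖-homo zero (suc n) = sym (+-identityˡ _)
    ⊖-homo (suc m) (suc n) = begin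
      ⟦ suc m ⊖ suc n ⟧ℤ  ≡⟨ cong ⟦_⟧ℤ (ℤ.[1+m]⊖[1+n]≡m⊖n m n) ⟩
      ⟦ m ⊖ n ⟧ℤ  ≡⟨ ⊖-homo m n ⟩
      fromℕ′ m + - fromℕ′ n  ≡⟨ cancel₁ _ _ ⟨
      (1# + fromℕ′ m) + - (1# + fromℕ′ n)  ≡⟨ cong₂ (λ a b → a + - b) (M.1+× m 1#) (M.1+× n 1#) ⟨
      fromℕ′ (suc m) + - fromℕ′ (suc n)  ∎
      where open ≡-Reasoning

    +-homo : ∀ i j → ⟦ i ℤ.+ j ⟧ℤ ≡ ⟦ i ⟧ℤ + ⟦ j ⟧ℤ
    +-homo (ℤ.+ m) (ℤ.+ n) = M.×-homo-+ 1# m n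
    +-homo (ℤ.+ m) -[1+ n ] = ⊖-homo m (suc n)
    +-homo -[1+ m ] (ℤ.+ n) = trans (⊖-homo n (suc m)) (+-comm _ _)
    +-homo -[1+ m ] -[1+ n ] = begin
      - fromℕ′ (suc (suc (m ℕ.+ n)))  ≡⟨ cong (λ z → - fromℕ′ (suc z)) (ℕ.+-suc m n) ⟨
      - fromℕ′ (suc m ℕ.+ suc n)  ≡⟨ cong -_ (M.×-homo-+ 1# (suc m) (suc n)) ⟩
      - (fromℕ′ (suc m) + fromℕ′ (suc n))  ≡⟨ -‿+-comm _ _ ⟨
      - fromℕ′ (suc m) + - fromℕ′ (suc n)  ∎
      where open ≡-Reasoning

    -homo : ∀ i → ⟦ ℤ.- i ⟧ℤ ≡ - ⟦ i ⟧ℤ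
    -homo (ℤ.+ zero) = sym -0#≈0#
    -homo (ℤ.+ suc n) = refl
    -homo -[1+ n ] = sym (-‿involutive _)

    *-homo-+ : ∀ m j → ⟦ ℤ.+ m ℤ.* j ⟧ℤ ≡ fromℕ′ m * ⟦ j ⟧ℤ
    *-homo-+ m (ℤ.+ n) = trans (cong ⟦_⟧ℤ (sym (ℤ.pos-* m n))) (M.×1-homo-* m n)
    *-homo-+ m j@(-[1+ n ]) = begin
      ⟦ ℤ.+ m ℤ.* j ⟧ℤ  ≡⟨ cong ⟦_⟧ℤ (ℤ.neg-distribʳ-* (ℤ.+ m) (ℤ.+ suc n)) ⟨
      ⟦ ℤ.- (ℤ.+ m ℤ.* ℤ.+ suc n) ⟧ℤ  ≡⟨ -homo (ℤ.+ m ℤ.* ℤ.+ suc n) ⟩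
      - ⟦ ℤ.+ m ℤ.* ℤ.+ suc n ⟧ℤ  ≡⟨ cong -_ (*-homo-+ m (ℤ.+ suc n)) ⟩
      - (fromℕ′ m * fromℕ′ (suc n))  ≡⟨ -‿distribʳ-* _ _ ⟩
      fromℕ′ m * - fromℕ′ (suc n)  ∎
      where open ≡-Reasoning

    *-homo : ∀ i j → ⟦ i ℤ.* j ⟧ℤ ≡ ⟦ i ⟧ℤ * ⟦ j ⟧ℤ
    *-homo (ℤ.+ m) j = *-homo-+ m j
    *-homo i@(-[1+ m ]) j = begin
      ⟦ i ℤ.* j ⟧ℤ  ≡⟨ cong ⟦_⟧ℤ (ℤ.neg-distribˡ-* (ℤ.+ suc m) j) ⟨
      ⟦ ℤ.- (ℤ.+ suc m ℤ.* j) ⟧ℤ  ≡⟨ -homo (ℤ.+ suc m ℤ.* j) ⟩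
      - ⟦ ℤ.+ suc m ℤ.* j ⟧ℤ  ≡⟨ cong -_ (*-homo-+ (suc m) j) ⟩
      - (fromℕ′ (suc m) * ⟦ j ⟧ℤ)  ≡⟨ -‿distribˡ-* _ _ ⟩
      - fromℕ′ (suc m) * ⟦ j ⟧ℤ  ∎
      where open ≡-Reasoning

    morphism : CommutativeRing.rawRing ℤ.+-*-commutativeRing -Raw-AlmostCommutative⟶ A
    morphism = record
      { ⟦_⟧ = ⟦_⟧ℤ ; +-homo = +-homo ; *-homo = *-homo ; -‿homo = -homo
      ; 0-homo = refl ; 1-homo = refl }

    weak : ∀ i j → Maybe (⟦ i ⟧ℤ ≡ ⟦ j ⟧ℤ)
    weak i j with i ℤ.≟ j
    ... | yes i≡j = just (cong ⟦_⟧ℤ i≡j)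
    ... | no _    = nothing

  module Solver = Algebra.Solver.Ring _ A morphism
    weak

  open Solver using (Polynomial; solve; _:=_; _:+_; _:*_; _:-_; :-_; con) public

  :0 :1 :2 :4 : ∀ {n} → Polynomial n
  :0 = con (ℤ.+ 0)
  :1 = con (ℤ.+ 1)
  :2 = con (ℤ.+ 2)
  -- Not `con (ℤ.+ 4)`, whose value is a sum bracketed differently from `4#`.
  :4 = :2 :+ :2

  to : Carrier → Fin size
  to = Inverse.to enum
  from : Fin size → Carrier
  from = Inverse.from enum
  from-to : ∀ x → from (to x) ≡ x
  from-to x = Inverse.inverseʳ enum refl
  to-from : ∀ i → to (from i) ≡ i
  to-from i = Inverse.inverseˡ enum refl
  from-injective : ∀ {i j} → from i ≡ from j → i ≡ j
  from-injective eq = trans (sym (to-from _)) (trans (cong to eq) (to-from _))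

  infix 4 _≟_
  _≟_ : (x y : Carrier) → Dec (x ≡ y)
  x ≟ y with to x Fin.≟ to y
  ... | yes eq = yes (trans (sym (from-to _)) (trans (cong from eq) (from-to _)))
  ... | no neq = no (neq ∘ cong to)

  ∃? : {P : Carrier → Set} → (∀ x → Dec (P x)) → Dec (∃ P)
  ∃? {P} P? = map′ (λ (i , pi) → from i , pi)
    (λ (x , px) → to x , subst P (sym (from-to _)) px)
    (Fin.any? (P? ∘ from))

  -- Junk value: 0# ⁻¹ ≡ 0#.
  infix 9 _⁻¹
  _⁻¹ : Carrier → Carrier
  x ⁻¹ with x ≟ 0#
  ... | yes _ = 0#
  ... | no x≢0 = proj₁ (inverse x x≢0)

  *-inverseʳ : ∀ {x} → x ≢ 0# → x * x ⁻¹ ≡ 1#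
  *-inverseʳ {x} x≢0 with x ≟ 0#
  ... | yes x≡0 = contradiction x≡0 x≢0
  ... | no x≢0′ = proj₂ (inverse x x≢0′)

  *-inverseˡ : ∀ {x} → x ≢ 0# → x ⁻¹ * x ≡ 1#
  *-inverseˡ x≢0 = trans (*-comm _ _) (*-inverseʳ x≢0)

  1≢0 : 1# ≢ 0#
  1≢0 = 0≢1 ∘ sym

  *-cancelˡ : ∀ {x y z} → x ≢ 0# → x * y ≡ x * z → y ≡ z
  *-cancelˡ {x} {y} {z} x≢0 eq = begin
    y  ≡⟨ *-identityˡ y ⟨
    1# * y  ≡⟨ cong (_* y) (*-inverseˡ x≢0) ⟨
    x ⁻¹ * x * y  ≡⟨ *-assoc _ x y ⟩
    x ⁻¹ * (x * y) ≡⟨ cong (x ⁻¹ *_) eq ⟩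
    x ⁻¹ * (x * z) ≡⟨ *-assoc _ x z ⟨
    x ⁻¹ * x * z  ≡⟨ cong (_* z) (*-inverseˡ x≢0) ⟩
    1# * z  ≡⟨ *-identityˡ z ⟩
    z  ∎
    where open ≡-Reasoning

  *-cancelʳ : ∀ {x y z} → x ≢ 0# → y * x ≡ z * x → y ≡ z
  *-cancelʳ {x} {y} {z} x≢0 eq = *-cancelˡ x≢0 (trans (*-comm x y) (trans eq (*-comm z x)))

  no-zero-divisors : ∀ {x y} → x * y ≡ 0# → x ≢ 0# → y ≡ 0#
  no-zero-divisors {x} xy≡0 x≢0 = *-cancelˡ x≢0 (trans xy≡0 (sym (zeroʳ x)))

  *-nonzero : ∀ {x y} → x ≢ 0# → y ≢ 0# → x * y ≢ 0#
  *-nonzero x≢0 y≢0 xy≡0 = y≢0 (no-zero-divisors xy≡0 x≢0)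

  -‿nonzero : ∀ {x} → x ≢ 0# → - x ≢ 0#
  -‿nonzero {x} x≢0 -x≡0 = x≢0 (trans (sym (-‿involutive x)) (trans (cong -_ -x≡0) -0#≈0#))

  x-y≡0⇒x≡y : ∀ {x y} → x - y ≡ 0# → x ≡ y
  x-y≡0⇒x≡y {x} {y} eq = begin
    x  ≡⟨ solve 2 (λ x y → x := (x :- y) :+ y) refl x y ⟩
    (x - y) + y ≡⟨ cong (_+ y) eq ⟩
    0# + y  ≡⟨ +-identityˡ y ⟩
    y  ∎
    where open ≡-Reasoning

  x+y≡0⇒x≡-y : ∀ {x y} → x + y ≡ 0# → x ≡ - y
  x+y≡0⇒x≡-y {x} {y} eq = x-y≡0⇒x≡y (trans (cong (x +_) (-‿involutive y)) eq)

  x≡y⇒x-y≡0 : ∀ {x y} → x ≡ y → x - y ≡ 0#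
  x≡y⇒x-y≡0 {x} refl = -‿inverseʳ x

  ^-+ : ∀ x m n → x ^ (m ℕ.+ n) ≡ x ^ m * x ^ n
  ^-+ x zero n = sym (*-identityˡ _)
  ^-+ x (suc m) n = trans (cong (x *_) (^-+ x m n)) (sym (*-assoc _ _ _))

  ^-* : ∀ x m n → x ^ (m ℕ.* n) ≡ (x ^ n) ^ m
  ^-* x zero n = refl
  ^-* x (suc m) n = trans (^-+ x n (m ℕ.* n)) (cong (x ^ n *_) (^-* x m n))

  ^-distrib-* : ∀ x y n → (x * y) ^ n ≡ x ^ n * y ^ n
  ^-distrib-* x y zero = sym (*-identityˡ _)
  ^-distrib-* x y (suc n) = trans (cong (x * y *_) (^-distrib-* x y n))
    (solve 4 (λ x y a b → x :* y :* (a :* b) := x :* a :* (y :* b)) refl x y (x ^ n) (y ^ n))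

  1^ : ∀ n → 1# ^ n ≡ 1#
  1^ zero = refl
  1^ (suc n) = trans (*-identityˡ _) (1^ n)

  ^-nonzero : ∀ {x} n → x ≢ 0# → x ^ n ≢ 0#
  ^-nonzero zero x≢0 = 1≢0
  ^-nonzero (suc n) x≢0 = *-nonzero x≢0 (^-nonzero n x≢0)

  0^ : ∀ n → .{{ℕ.NonZero n}} → 0# ^ n ≡ 0#
  0^ (suc n) = zeroˡ _

  ^-zero : ∀ {x} n → x ^ n ≡ 0# → x ≡ 0#
  ^-zero {x} n eq with x ≟ 0#
  ... | yes x≡0 = x≡0
  ... | no x≢0 = contradiction eq (^-nonzero n x≢0)

  x^1 : ∀ x → x ^ 1 ≡ x
  x^1 = *-identityʳ

  ^-comm : ∀ x m n → (x ^ m) ^ n ≡ (x ^ n) ^ m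
  ^-comm x m n = trans (sym (^-* x n m)) (trans (cong (x ^_) (ℕ.*-comm n m)) (^-* x m n))

  square-equal : ∀ {x y} → x * x ≡ y * y → (x ≡ y) ⊎ (x ≡ - y)
  square-equal {x} {y} eq with x ≟ y
  ... | yes x≡y = inj₁ x≡y
  ... | no x≢y = inj₂ (x+y≡0⇒x≡-y (no-zero-divisors
    (trans (solve 2 (λ x y → (x :- y) :* (x :+ y) := x :* x :- y :* y) refl x y) (x≡y⇒x-y≡0 eq))
    (x≢y ∘ x-y≡0⇒x≡y)))

  -- If `y` were missed, then `y` together with the values of `f` would inject `size + 1` indices
  -- into `Fin size`.
  injective⇒surjective : (f : Carrier → Carrier) → Injective _≡_ _≡_ f → ∀ y → ∃[ x ] f x ≡ y
  injective⇒surjective f inj y with ∃? (λ x → f x ≟ y)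
  ... | yes found = found
  ... | no none = ⊥-elim (clash (Fin.pigeonhole (ℕ.n<1+n size) g))
    where
    to-injective : ∀ {x y} → to x ≡ to y → x ≡ y
    to-injective eq = trans (sym (from-to _)) (trans (cong from eq) (from-to _))
    g : Fin (suc size) → Fin size
    g Fin.zero = to y
    g (Fin.suc i) = to (f (from i))
    g-injective : ∀ i j → g i ≡ g j → i ≡ j
    g-injective Fin.zero Fin.zero eq = refl
    g-injective Fin.zero (Fin.suc j) eq = ⊥-elim (none (from j , sym (to-injective eq)))
    g-injective (Fin.suc i) Fin.zero eq = ⊥-elim (none (from i , to-injective eq))
    g-injective (Fin.suc i) (Fin.suc j) eq = cong Fin.suc (from-injective (inj (to-injective eq)))
    clash : ¬ (∃ λ i → ∃ λ j → i Fin.< j × g i ≡ g j)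
    clash (i , j , i<j , eq) = ℕ.<⇒≢ i<j (cong toℕ (g-injective i j eq))

  private
    module Sum = Algebra.Properties.CommutativeMonoid.Sum (CommutativeRing.+-commutativeMonoid ring)
    module Prod = Algebra.Properties.CommutativeMonoid.Sum (CommutativeRing.*-commutativeMonoid ring)

    conjugate : (f g : Carrier → Carrier) → (∀ x → f (g x) ≡ x) → (∀ x → g (f x) ≡ x) → Permutation size size
    conjugate f g fg gf = permutation (to ∘ f ∘ from) (to ∘ g ∘ from)
      (λ i → trans (cong (to ∘ f) (from-to _)) (trans (cong to (fg _)) (to-from _)))
      (λ i → trans (cong (to ∘ g) (from-to _)) (trans (cong to (gf _)) (to-from _)))

    ∏ : (Carrier → Carrier) → Carrier
    ∏ f = Prod.sum (f ∘ from)

    ∏-cong : ∀ {f g} → (∀ x → f x ≡ g x) → ∏ f ≡ ∏ g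
    ∏-cong eq = Prod.sum-cong-≗ (eq ∘ from)

    ∏-* : ∀ f g → ∏ (λ x → f x * g x) ≡ ∏ f * ∏ g
    ∏-* f g = Prod.∑-distrib-+ (f ∘ from) (g ∘ from)

    prod-nonzero : ∀ {n} (f : Fin n → Carrier) → (∀ i → f i ≢ 0#) → Prod.sum f ≢ 0#
    prod-nonzero {zero} f nz = 1≢0
    prod-nonzero {suc n} f nz = *-nonzero (nz Fin.zero) (prod-nonzero (f ∘ Fin.suc) (nz ∘ Fin.suc))

    prod-const : ∀ n a → Prod.sum {n} (λ _ → a) ≡ a ^ n
    prod-const zero a = refl
    prod-const (suc n) a = cong (a *_) (prod-const n a)

    prod-one : ∀ n (f : Fin n → Carrier) i → (∀ j → j ≢ i → f j ≡ 1#) → Prod.sum f ≡ f i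
    prod-one (suc n) f Fin.zero eq = trans (cong (f Fin.zero *_)
      (trans (Prod.sum-cong-≗ (λ j → eq (Fin.suc j) λ ())) (trans (prod-const n 1#) (1^ n)))) (*-identityʳ _)
    prod-one (suc n) f (Fin.suc i) eq = trans (cong₂ _*_ (eq Fin.zero λ ())
      (prod-one n (f ∘ Fin.suc) i (λ j j≢i → eq (Fin.suc j) (j≢i ∘ Fin.suc-injective)))) (*-identityˡ _)

    -- A product over the nonzero elements is taken over all of `K`, with the factor `1#` at zero.
    if0 : Carrier → Carrier → Carrier → Carrier
    if0 x a b with x ≟ 0#
    ... | yes _ = a
    ... | no _ = b

  -- Multiplication by a permutes K; comparing ∏ (x ≠ 0) x with ∏ (x ≠ 0) a x gives a ^ (size - 1) = 1.
  ^-size : ∀ a → a ^ size ≡ a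
  ^-size a with a ≟ 0#
  ... | yes refl = 0^ size {{ℕ.≢-nonZero λ eq → case subst Fin eq (to 0#) of λ ()}}
  ... | no a≢0 = begin
    a ^ size  ≡⟨ prod-const size a ⟨
    ∏ (λ _ → a)  ≡⟨ ∏-cong split ⟨
    ∏ (λ x → if0 x 1# a * if0 x a 1#)  ≡⟨ ∏-* (λ x → if0 x 1# a) (λ x → if0 x a 1#) ⟩
    ∏ (λ x → if0 x 1# a) * ∏ (λ x → if0 x a 1#)  ≡⟨ cong₂ _*_ units at-zero ⟩
    1# * a  ≡⟨ *-identityˡ a ⟩
    a  ∎
    where
    open ≡-Reasoning
    split : ∀ x → if0 x 1# a * if0 x a 1# ≡ a
    split x with x ≟ 0#
    ... | yes _ = *-identityˡ a
    ... | no _ = *-identityʳ a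
    at-zero : ∏ (λ x → if0 x a 1#) ≡ a
    at-zero = trans (prod-one size _ (to 0#) other) here
      where
      other : ∀ j → j ≢ to 0# → if0 (from j) a 1# ≡ 1#
      other j j≢ with from j ≟ 0#
      ... | yes eq = contradiction (trans (sym (to-from _)) (cong to eq)) j≢
      ... | no _ = refl
      here : if0 (from (to 0#)) a 1# ≡ a
      here with from (to 0#) ≟ 0#
      ... | yes _ = refl
      ... | no neq = contradiction (from-to _) neq
    π : Permutation size size
    π = conjugate (a *_) (a ⁻¹ *_)
      (λ x → trans (sym (*-assoc _ _ _)) (trans (cong (_* x) (*-inverseʳ a≢0)) (*-identityˡ x)))
      (λ x → trans (sym (*-assoc _ _ _)) (trans (cong (_* x) (*-inverseˡ a≢0)) (*-identityˡ x)))
    scaled : ∀ x → if0 (a * x) 1# (a * x) ≡ if0 x 1# a * if0 x 1# x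
    scaled x with x ≟ 0# | a * x ≟ 0#
    ... | yes _ | yes _ = sym (*-identityˡ _)
    ... | yes refl | no neq = contradiction (zeroʳ a) neq
    ... | no x≢0 | yes eq = contradiction eq (*-nonzero a≢0 x≢0)
    ... | no _ | no _ = refl
    P = ∏ (λ x → if0 x 1# x)
    P≢0 : P ≢ 0#
    P≢0 = prod-nonzero _ (λ i → nz (from i))
      where
      nz : ∀ x → if0 x 1# x ≢ 0#
      nz x with x ≟ 0#
      ... | yes _ = 1≢0
      ... | no x≢0 = x≢0
    units : ∏ (λ x → if0 x 1# a) ≡ 1#
    units = *-cancelʳ P≢0 (begin
      ∏ (λ x → if0 x 1# a) * P  ≡⟨ ∏-* (λ x → if0 x 1# a) (λ x → if0 x 1# x) ⟨
      ∏ (λ x → if0 x 1# a * if0 x 1# x)  ≡⟨ ∏-cong scaled ⟨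
      ∏ (λ x → if0 (a * x) 1# (a * x))  ≡⟨ Prod.sum-cong-≗ {size} (λ i → cong (λ x → if0 x 1# x) (from-to (a * from i))) ⟨
      Prod.sum (λ i → (λ x → if0 x 1# x) (from (π ⟨$⟩ʳ i)))  ≡⟨ Prod.sum-permute ((λ x → if0 x 1# x) ∘ from) π ⟨
      P  ≡⟨ *-identityˡ P ⟨
      1# * P  ∎)

  -- Characteristic and Frobenius maps

  module × = Algebra.Properties.Semiring.Mult (CommutativeRing.semiring ring)

  -- Translation by 1# permutes K, so ∑ x = ∑ (x + 1#) = ∑ x + size × 1#.
  size×1≡0 : size ×.× 1# ≡ 0#
  size×1≡0 = +-cancelˡ (Sum.sum from) _ _ (begin
    Sum.sum from + size ×.× 1#  ≡⟨ cong (Sum.sum from +_) (Sum.sum-replicate size) ⟨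
    Sum.sum from + Sum.sum {size} (λ _ → 1#)  ≡⟨ Sum.∑-distrib-+ from (λ _ → 1#) ⟨
    Sum.sum (λ i → from i + 1#)  ≡⟨ Sum.sum-cong-≗ {size} (λ i → from-to (from i + 1#)) ⟨
    Sum.sum (λ i → from (π ⟨$⟩ʳ i))  ≡⟨ Sum.sum-permute from π ⟨
    Sum.sum from  ≡⟨ +-identityʳ _ ⟨
    Sum.sum from + 0#  ∎)
    where
    open ≡-Reasoning
    π : Permutation size size
    π = conjugate (_+ 1#) (_- 1#)
      (solve 1 (λ x → (x :- :1) :+ :1 := x) refl)
      (solve 1 (λ x → (x :+ :1) :- :1 := x) refl)

  -- The `n`-th power of `p × 1#` is `size × 1# = 0#`, and a field has no nonzero nilpotent
  -- elements.
  char : ∀ p n → size ≡ p ℕ.^ n → p ×.× 1# ≡ 0#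
  char p n size≡ = ^-zero n (trans (sym (power n)) (trans (cong (×._× 1#) (sym size≡)) size×1≡0))
    where
    power : ∀ n → (p ℕ.^ n) ×.× 1# ≡ (p ×.× 1#) ^ n
    power zero = +-identityʳ 1#
    power (suc n) = trans (×.×1-homo-* p (p ℕ.^ n)) (cong (p ×.× 1# *_) (power n))

  module _ (p : ℕ) (p-prime : Prime p) (p×1≡0 : p ×.× 1# ≡ 0#) where
    private
      open import Data.Nat.Base using (_!)
      open import Data.Nat.Combinatorics using (_C_; nCn≡1; nCk≡nC[n∸k]; k![n∸k]!∣n!)
      open import Data.Nat.Combinatorics.Specification using (nCk≡n!/k![n-k]!)
      open import Data.Nat.Properties using (_!*_!≢0)

      module Exp = Algebra.Properties.Semiring.Exp (CommutativeRing.semiring ring)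
      module Bin = Algebra.Properties.CommutativeSemiring.Binomial (CommutativeRing.commutativeSemiring ring)

      ^≡ : ∀ x n → x Exp.^ n ≡ x ^ n
      ^≡ x zero = refl
      ^≡ x (suc n) = cong (x *_) (^≡ x n)

      ∣⇒×≡0 : ∀ {n} x → p ∣ n → n ×.× x ≡ 0#
      ∣⇒×≡0 {n} x (divides m refl) = begin
        (m ℕ.* p) ×.× x  ≡⟨ cong ((m ℕ.* p) ×.×_) (*-identityˡ x) ⟨
        (m ℕ.* p) ×.× (1# * x)  ≡⟨ ×.×-assoc-* (m ℕ.* p) 1# x ⟨
        ((m ℕ.* p) ×.× 1#) * x  ≡⟨ cong (_* x) (×.×1-homo-* m p) ⟩
        (m ×.× 1#) * (p ×.× 1#) * x  ≡⟨ cong (λ z → (m ×.× 1#) * z * x) p×1≡0 ⟩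
        (m ×.× 1#) * 0# * x  ≡⟨ solve 2 (λ a x → a :* :0 :* x := :0) refl (m ×.× 1#) x ⟩
        0#  ∎
        where open ≡-Reasoning

      -- The prime `p` divides `p ! = (p C k) * (k ! * (p - k) !)` but neither factorial on the
      -- right, whose factors are all smaller than `p`.
      p∣pCk : ∀ {k} → 0 ℕ.< k → k ℕ.< p → p ∣ (p C k)
      p∣pCk {k} 0<k k<p with euclidsLemma (p C k) (k ! ℕ.* (p ℕ.∸ k) !) p-prime (subst (p ∣_) (sym product) (p∣p! (ℕ.<-trans 0<k k<p)))
        where
        instance _ = k !* (p ℕ.∸ k) !≢0
        product : (p C k) ℕ.* (k ! ℕ.* (p ℕ.∸ k) !) ≡ p !
        product = trans (cong (ℕ._* (k ! ℕ.* (p ℕ.∸ k) !)) (nCk≡n!/k![n-k]! (ℕ.<⇒≤ k<p))) (m/n*n≡m (k![n∸k]!∣n! (ℕ.<⇒≤ k<p)))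
        p∣p! : ∀ {n} → 0 ℕ.< n → n ∣ n !
        p∣p! {suc n} _ = m∣m*n (n !)
      ... | inj₁ p∣C = p∣C
      ... | inj₂ p∣rest = ⊥-elim (case euclidsLemma (k !) ((p ℕ.∸ k) !) p-prime p∣rest of λ
              { (inj₁ h) → p∤! k k<p h ; (inj₂ h) → p∤! (p ℕ.∸ k) (ℕ.∸-monoʳ-< 0<k (ℕ.<⇒≤ k<p)) h })
        where
        p∤! : ∀ n → n ℕ.< p → ¬ p ∣ n !
        p∤! zero _ p∣1 = ℕ.<⇒≱ (ℕ.nonTrivial⇒n>1 p {{prime⇒nonTrivial p-prime}}) (∣⇒≤ p∣1)
        p∤! (suc n) n<p p∣ with euclidsLemma (suc n) (n !) p-prime p∣
        ... | inj₁ h = ℕ.<⇒≱ n<p (∣⇒≤ h)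
        ... | inj₂ h = p∤! n (ℕ.<-trans (ℕ.n<1+n n) n<p) h

    frobenius-+ : ∀ x y → (x + y) ^ p ≡ x ^ p + y ^ p
    frobenius-+ x y = go p refl
      where
      -- The exponent is generalised so that it can be split as `suc n`, which exposes the first and
      -- the last binomial term.
      go : ∀ n → n ≡ p → (x + y) ^ n ≡ x ^ n + y ^ n
      go zero 0≡p = contradiction (sym 0≡p) (ℕ.≢-nonZero⁻¹ p {{prime⇒nonZero p-prime}})
      go (suc n) refl = begin
        (x + y) ^ suc n  ≡⟨ ^≡ (x + y) (suc n) ⟨
        (x + y) Exp.^ suc n  ≡⟨ Bin.theorem (suc n) x y ⟩
        Sum.sum (Bin.binomialTerm x y (suc n))  ≡⟨⟩
        term Fin.zero + Sum.sum (term ∘ Fin.suc)  ≡⟨ cong (term Fin.zero +_) (Sum.sum-init-last (term ∘ Fin.suc)) ⟩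
        term Fin.zero + (Sum.sum {n} (λ i → term (Fin.suc (Fin.inject₁ i))) + term (Fin.suc (fromℕ n)))
          ≡⟨ cong₂ (λ a b → a + (b + term (Fin.suc (fromℕ n)))) first (trans (Sum.sum-cong-≗ {n} middle) (Sum.sum-replicate-zero n)) ⟩
        y ^ suc n + (0# + term (Fin.suc (fromℕ n)))  ≡⟨ cong (y ^ suc n +_) (trans (+-identityˡ _) last) ⟩
        y ^ suc n + x ^ suc n  ≡⟨ +-comm _ _ ⟩
        x ^ suc n + y ^ suc n  ∎
        where
        open ≡-Reasoning
        term = Bin.binomialTerm x y (suc n)
        first : term Fin.zero ≡ y ^ suc n
        first = trans (cong (×._× (1# * y Exp.^ suc n)) (trans (nCk≡nC[n∸k] {0} {suc n} z≤n) (nCn≡1 (suc n))))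
          (trans (+-identityʳ _) (trans (*-identityˡ _) (^≡ y (suc n))))
        middle : ∀ i → term (Fin.suc (Fin.inject₁ i)) ≡ 0#
        middle i = ∣⇒×≡0 _ (p∣pCk {toℕ (Fin.suc (Fin.inject₁ i))} (s≤s z≤n) (s≤s (subst (ℕ._< n) (sym (Fin.toℕ-inject₁ i)) (Fin.toℕ<n i))))
        last : term (Fin.suc (fromℕ n)) ≡ x ^ suc n
        last = begin
          term (Fin.suc (fromℕ n))
            ≡⟨ cong (λ k → (suc n C suc k) ×.× (x Exp.^ suc k * y Exp.^ (n ℕ.∸ k))) (Fin.toℕ-fromℕ n) ⟩
          (suc n C suc n) ×.× (x Exp.^ suc n * y Exp.^ (n ℕ.∸ n))
            ≡⟨ cong₂ (λ c k → c ×.× (x Exp.^ suc n * y Exp.^ k)) (nCn≡1 (suc n)) (ℕ.n∸n≡0 n) ⟩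
          x Exp.^ suc n * 1# + 0#
            ≡⟨ trans (+-identityʳ _) (trans (*-identityʳ _) (^≡ x (suc n))) ⟩
          x ^ suc n ∎

    frobeniusⁿ-+ : ∀ n x y → (x + y) ^ (p ℕ.^ n) ≡ x ^ (p ℕ.^ n) + y ^ (p ℕ.^ n)
    frobeniusⁿ-+ zero x y = trans (x^1 _) (sym (cong₂ _+_ (x^1 x) (x^1 y)))
    frobeniusⁿ-+ (suc n) x y = begin
      (x + y) ^ (p ℕ.* p ℕ.^ n)  ≡⟨ ^-* (x + y) p (p ℕ.^ n) ⟩
      ((x + y) ^ (p ℕ.^ n)) ^ p  ≡⟨ cong (_^ p) (frobeniusⁿ-+ n x y) ⟩
      (x ^ (p ℕ.^ n) + y ^ (p ℕ.^ n)) ^ p  ≡⟨ frobenius-+ _ _ ⟩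
      (x ^ (p ℕ.^ n)) ^ p + (y ^ (p ℕ.^ n)) ^ p  ≡⟨ cong₂ _+_ (^-* x p (p ℕ.^ n)) (^-* y p (p ℕ.^ n)) ⟨
      x ^ (p ℕ.* p ℕ.^ n) + y ^ (p ℕ.* p ℕ.^ n)  ∎
      where open ≡-Reasoning

    -- If `1# + 1#` were zero, every odd multiple of `1#` would be `1#`, among them the `p`-fold
    -- one, which vanishes.
    2≢0 : p ≢ 2 → 1# + 1# ≢ 0#
    2≢0 p≢2 2≡0 = odd-or-2 (ℕ.nonTrivial⇒n>1 p {{prime⇒nonTrivial p-prime}})
      where
      double : ∀ m → (2 ℕ.* m) ×.× 1# ≡ 0#
      double m = trans (×.×1-homo-* 2 m) (trans (cong (_* (m ×.× 1#)) (trans (cong (1# +_) (+-identityʳ 1#)) 2≡0)) (zeroˡ _))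
      odd-or-2 : 1 ℕ.< p → ⊥
      odd-or-2 1<p with p ℕ.% 2 in rem
      ... | zero = p≢2 (sym (case prime⇒irreducible p-prime (m%n≡0⇒n∣m p 2 rem) of λ { (inj₁ ()) ; (inj₂ eq) → eq }))
      ... | suc (suc r) = ℕ.<⇒≱ (m%n<n p 2) (subst (2 ℕ.≤_) (sym rem) (s≤s (s≤s z≤n)))
      ... | suc zero = 1≢0 (begin
        1#  ≡⟨ trans (+-identityʳ _) (+-identityʳ _) ⟨
        1# + 0# + 0#  ≡⟨ cong (1# + 0# +_) (double (p ℕ./ 2)) ⟨
        1 ×.× 1# + (2 ℕ.* (p ℕ./ 2)) ×.× 1#  ≡⟨ ×.×-homo-+ 1# 1 (2 ℕ.* (p ℕ./ 2)) ⟨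
        (1 ℕ.+ 2 ℕ.* (p ℕ./ 2)) ×.× 1#  ≡⟨ cong (×._× 1#) (trans (m≡m%n+[m/n]*n p 2) (cong₂ ℕ._+_ rem (ℕ.*-comm (p ℕ./ 2) 2))) ⟨
        p ×.× 1#  ≡⟨ p×1≡0 ⟩
        0#  ∎)
        where open ≡-Reasoning

-- Polynomials as coefficient lists

module Polynomials (K : FiniteField) where
  open FieldProperties K

  eval : List Carrier → Carrier → Carrier
  eval [] x = 0#
  eval (a ∷ as) x = a + x * eval as x

  -- Lists are not normalised, so the zero polynomial has many representations; upper bounds on
  -- lengths play the role of degrees.
  Zero : List Carrier → Set
  Zero = All (_≡ 0#)

  private
    -- Synthetic division: the coefficients of `(P(X) - P(y)) / (X - y)`.
    quotient : List Carrier → Carrier → List Carrier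
    quotient [] y = []
    quotient (a ∷ []) y = []
    quotient (a ∷ as@(_ ∷ _)) y = eval as y ∷ quotient as y

    length-quotient : ∀ as y → length (quotient as y) ≡ ℕ.pred (length as)
    length-quotient [] y = refl
    length-quotient (a ∷ []) y = refl
    length-quotient (a ∷ as@(_ ∷ _)) y = cong suc (length-quotient as y)

    quotient-correct : ∀ as x y → eval as x - eval as y ≡ (x - y) * eval (quotient as y) x
    quotient-correct [] x y = solve 2 (λ x y → :0 :- :0 := (x :- y) :* :0) refl x y
    quotient-correct (a ∷ []) x y =
      solve 3 (λ a x y → (a :+ x :* :0) :- (a :+ y :* :0) := (x :- y) :* :0) refl a x y
    quotient-correct (a ∷ as@(_ ∷ _)) x y = begin
      (a + x * E) - (a + y * F)  ≡⟨ solve 5 (λ a x y E F → (a :+ x :* E) :- (a :+ y :* F) := x :* (E :- F) :+ (x :- y) :* F) refl a x y E F ⟩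
      x * (E - F) + (x - y) * F  ≡⟨ cong (λ z → x * z + (x - y) * F) (quotient-correct as x y) ⟩
      x * ((x - y) * Q) + (x - y) * F  ≡⟨ solve 4 (λ x y Q F → x :* ((x :- y) :* Q) :+ (x :- y) :* F := (x :- y) :* (F :+ x :* Q)) refl x y Q F ⟩
      (x - y) * (F + x * Q)  ∎
      where
      open ≡-Reasoning
      E = eval as x
      F = eval as y
      Q = eval (quotient as y) x

    zero-from-quotient : ∀ as y → eval as y ≡ 0# → Zero (quotient as y) → Zero as
    zero-from-quotient [] y _ _ = []
    zero-from-quotient (a ∷ []) y eq _ = trans (solve 2 (λ a y → a := a :+ y :* :0) refl a y) eq ∷ []
    zero-from-quotient (a ∷ as@(_ ∷ _)) y eq (z ∷ zs) =
      trans (solve 2 (λ a y → a := a :+ y :* :0) refl a y) (trans (cong (λ e → a + y * e) (sym z)) eq)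
      ∷ zero-from-quotient as y z zs

    -- Division by `X - y` at one root `y` shortens the list by one and keeps the remaining points
    -- as roots, because they differ from `y`.
    roots⇒zero : ∀ n as → length as ℕ.≤ n → (point : Fin n → Carrier) → (∀ {i j} → point i ≡ point j → i ≡ j) →
      (∀ i → eval as (point i) ≡ 0#) → Zero as
    roots⇒zero zero [] _ _ _ _ = []
    roots⇒zero (suc n) as len point inj root = zero-from-quotient as y (root Fin.zero)
      (roots⇒zero n (quotient as y) (subst (ℕ._≤ n) (sym (length-quotient as y)) (ℕ.pred-mono-≤ len))
        (point ∘ Fin.suc) (Fin.suc-injective ∘ inj) root′)
      where
      y = point Fin.zero
      root′ : ∀ i → eval (quotient as y) (point (Fin.suc i)) ≡ 0#
      root′ i = no-zero-divisors (trans (sym (quotient-correct as _ y)) (x≡y⇒x-y≡0 (trans (root (Fin.suc i)) (sym (root Fin.zero)))))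
        (λ eq → case inj (x-y≡0⇒x≡y eq) of λ ())

  vanishing⇒zero : ∀ as → length as ℕ.≤ size → (∀ x → eval as x ≡ 0#) → Zero as
  vanishing⇒zero as len root = roots⇒zero (length as) as ℕ.≤-refl (from ∘ λ i → Fin.inject≤ i len)
    (Fin.inject≤-injective len len _ _ ∘ from-injective) (λ i → root _)

  -- Multiplication by `X` supplies the missing root zero and costs one degree, hence the strict
  -- bound.
  vanishing*⇒zero : ∀ as → length as ℕ.< size → (∀ x → x ≢ 0# → eval as x ≡ 0#) → Zero as
  vanishing*⇒zero as len root = All.tail (vanishing⇒zero (0# ∷ as) len root′)
    where
    root′ : ∀ x → 0# + x * eval as x ≡ 0#
    root′ x with x ≟ 0#
    ... | yes refl = trans (+-identityˡ _) (zeroˡ _)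
    ... | no x≢0 = trans (+-identityˡ _) (trans (cong (x *_) (root x x≢0)) (zeroʳ x))

  monomial : ℕ → Carrier → List Carrier
  monomial n a = replicate n 0# ++ a ∷ []

  eval-shift : ∀ n as x → eval (replicate n 0# ++ as) x ≡ x ^ n * eval as x
  eval-shift zero as x = sym (*-identityˡ _)
  eval-shift (suc n) as x = trans (+-identityˡ _) (trans (cong (x *_) (eval-shift n as x)) (sym (*-assoc x _ _)))

  eval-monomial : ∀ n a x → eval (monomial n a) x ≡ a * x ^ n
  eval-monomial n a x = trans (eval-shift n (a ∷ []) x)
    (solve 3 (λ a x y → y :* (a :+ x :* :0) := a :* y) refl a x (x ^ n))

  length-monomial : ∀ n a → length (monomial n a) ≡ suc n
  length-monomial n a = trans (List.length-++ (replicate n 0#)) (trans (cong (ℕ._+ 1) (List.length-replicate n)) (ℕ.+-comm n 1))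

  -- Otherwise `X^(n+1) - 1` would vanish at all `size - 1` nonzero elements, which is more than its
  -- degree.
  ∃-^≢1 : ∀ n → suc (suc (suc n)) ℕ.≤ size → ∃[ x ] (x ≢ 0# × x ^ suc n ≢ 1#)
  ∃-^≢1 n len with ∃? (λ x → ¬? (x ≟ 0#) ×-dec ¬? (x ^ suc n ≟ 1#))
  ... | yes found = found
  ... | no none = contradiction (All.head zero′) (-‿nonzero 1≢0)
    where
    zero′ : Zero (- 1# ∷ monomial n 1#)
    zero′ = vanishing*⇒zero _ (subst (λ l → suc (suc l) ℕ.≤ size) (sym (length-monomial n 1#)) len)
      λ x x≢0 → begin
        - 1# + x * eval (monomial n 1#) x ≡⟨ cong (λ z → - 1# + x * z) (trans (eval-monomial n 1# x) (*-identityˡ _)) ⟩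
        - 1# + x ^ suc n  ≡⟨ cong (- 1# +_) (decidable-stable (x ^ suc n ≟ 1#) (λ neq → none (x , x≢0 , neq))) ⟩
        - 1# + 1#  ≡⟨ -‿inverseˡ 1# ⟩
        0#  ∎
      where open ≡-Reasoning

  -- This is the substitution `X ↦ X^(s+1)`. The `s` zeros also follow the last coefficient, which
  -- makes the length an exact multiple of `suc s`.
  spread : ℕ → List Carrier → List Carrier
  spread s [] = []
  spread s (a ∷ as) = a ∷ replicate s 0# ++ spread s as

  eval-spread : ∀ s as x → eval (spread s as) x ≡ eval as (x ^ suc s)
  eval-spread s [] x = refl
  eval-spread s (a ∷ as) x = cong (a +_) (trans (cong (x *_) (eval-shift s (spread s as) x))
    (trans (sym (*-assoc x _ _)) (cong (x ^ suc s *_) (eval-spread s as x))))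

  length-spread : ∀ s as → length (spread s as) ≡ length as ℕ.* suc s
  length-spread s [] = refl
  length-spread s (a ∷ as) = cong suc (trans (List.length-++ (replicate s 0#)) (cong₂ ℕ._+_ (List.length-replicate s) (length-spread s as)))

  Zero-spread : ∀ s as → Zero (spread s as) → Zero as
  Zero-spread s [] _ = []
  Zero-spread s (a ∷ as) (z ∷ zs) = z ∷ Zero-spread s as (All.++⁻ʳ (replicate s 0#) zs)

  -- It replaces a count of the `(s+1)`-th powers: a polynomial that vanishes on them becomes, after
  -- `X ↦ X^(s+1)`, one that vanishes at every nonzero element.
  vanishing-powers⇒zero : ∀ s as → length as ℕ.* suc s ℕ.< size → (∀ x → x ≢ 0# → eval as (x ^ suc s) ≡ 0#) → Zero as
  vanishing-powers⇒zero s as len root = Zero-spread s as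
    (vanishing*⇒zero _ (subst (ℕ._< size) (sym (length-spread s as)) len) (λ x x≢0 → trans (eval-spread s as x) (root x x≢0)))

  infixl 6 _⊞_
  infixl 7 _⊠_ _⊡_
  infixr 8 _↑_
  _⊞_ : List Carrier → List Carrier → List Carrier
  [] ⊞ bs = bs
  as@(_ ∷ _) ⊞ [] = as
  (a ∷ as) ⊞ (b ∷ bs) = (a + b) ∷ (as ⊞ bs)

  _⊡_ : Carrier → List Carrier → List Carrier
  a ⊡ bs = List.map (a *_) bs

  _⊠_ : List Carrier → List Carrier → List Carrier
  [] ⊠ bs = []
  (a ∷ as) ⊠ bs = a ⊡ bs ⊞ (0# ∷ as ⊠ bs)

  _↑_ : List Carrier → ℕ → List Carrier
  as ↑ zero = 1# ∷ []
  as ↑ suc n = as ⊠ as ↑ n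

  eval-⊞ : ∀ as bs x → eval (as ⊞ bs) x ≡ eval as x + eval bs x
  eval-⊞ [] bs x = sym (+-identityˡ _)
  eval-⊞ (a ∷ as) [] x = sym (+-identityʳ _)
  eval-⊞ (a ∷ as) (b ∷ bs) x = trans (cong (λ z → (a + b) + x * z) (eval-⊞ as bs x))
    (solve 5 (λ a b x p q → (a :+ b) :+ x :* (p :+ q) := (a :+ x :* p) :+ (b :+ x :* q)) refl a b x (eval as x) (eval bs x))

  eval-⊡ : ∀ a bs x → eval (a ⊡ bs) x ≡ a * eval bs x
  eval-⊡ a [] x = sym (zeroʳ a)
  eval-⊡ a (b ∷ bs) x = trans (cong (λ z → a * b + x * z) (eval-⊡ a bs x))
    (solve 4 (λ a b x p → a :* b :+ x :* (a :* p) := a :* (b :+ x :* p)) refl a b x (eval bs x))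

  eval-⊠ : ∀ as bs x → eval (as ⊠ bs) x ≡ eval as x * eval bs x
  eval-⊠ [] bs x = sym (zeroˡ _)
  eval-⊠ (a ∷ as) bs x = begin
    eval (a ⊡ bs ⊞ (0# ∷ as ⊠ bs)) x  ≡⟨ eval-⊞ (a ⊡ bs) _ x ⟩
    eval (a ⊡ bs) x + (0# + x * eval (as ⊠ bs) x)  ≡⟨ cong₂ (λ y z → y + (0# + x * z)) (eval-⊡ a bs x) (eval-⊠ as bs x) ⟩
    a * eval bs x + (0# + x * (eval as x * eval bs x))
      ≡⟨ solve 4 (λ a x p q → a :* q :+ (:0 :+ x :* (p :* q)) := (a :+ x :* p) :* q) refl a x (eval as x) (eval bs x) ⟩
    (a + x * eval as x) * eval bs x  ∎
    where open ≡-Reasoning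

  eval-↑ : ∀ as n x → eval (as ↑ n) x ≡ eval as x ^ n
  eval-↑ as zero x = trans (cong (1# +_) (zeroʳ x)) (+-identityʳ 1#)
  eval-↑ as (suc n) x = trans (eval-⊠ as (as ↑ n) x) (cong (eval as x *_) (eval-↑ as n x))

  length-⊞ : ∀ as bs {n} → length as ℕ.≤ n → length bs ℕ.≤ n → length (as ⊞ bs) ℕ.≤ n
  length-⊞ [] bs _ l = l
  length-⊞ (a ∷ as) [] l _ = l
  length-⊞ (a ∷ as) (b ∷ bs) (s≤s k) (s≤s l) = s≤s (length-⊞ as bs k l)

  length-⊡ : ∀ a bs → length (a ⊡ bs) ≡ length bs
  length-⊡ a bs = List.length-map _ bs

  length-⊠ : ∀ as bs {m n} → length as ℕ.≤ suc m → length bs ℕ.≤ suc n → length (as ⊠ bs) ℕ.≤ suc (m ℕ.+ n)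
  length-⊠ [] bs _ _ = z≤n
  length-⊠ (a ∷ as) bs {m} {n} (s≤s k) l = length-⊞ (a ⊡ bs) _
    (subst (ℕ._≤ _) (sym (length-⊡ a bs)) (ℕ.≤-trans l (s≤s (ℕ.m≤n+m n m)))) (s≤s (tail m as k))
    where
    tail : ∀ m as → length as ℕ.≤ m → length (as ⊠ bs) ℕ.≤ m ℕ.+ n
    tail m [] _ = z≤n
    tail (suc m) as k = length-⊠ as bs k l

  length-↑ : ∀ as n {m} → length as ℕ.≤ suc m → length (as ↑ n) ℕ.≤ suc (n ℕ.* m)
  length-↑ as zero _ = s≤s z≤n
  length-↑ as (suc n) l = length-⊠ as (as ↑ n) l (length-↑ as n l)

  coeff₀ coeff₁ : List Carrier → Carrier
  coeff₀ [] = 0#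
  coeff₀ (a ∷ _) = a
  coeff₁ [] = 0#
  coeff₁ (_ ∷ as) = coeff₀ as

  coeff₀-⊞ : ∀ as bs → coeff₀ (as ⊞ bs) ≡ coeff₀ as + coeff₀ bs
  coeff₀-⊞ [] bs = sym (+-identityˡ _)
  coeff₀-⊞ (a ∷ as) [] = sym (+-identityʳ _)
  coeff₀-⊞ (a ∷ as) (b ∷ bs) = refl

  coeff₁-⊞ : ∀ as bs → coeff₁ (as ⊞ bs) ≡ coeff₁ as + coeff₁ bs
  coeff₁-⊞ [] bs = sym (+-identityˡ _)
  coeff₁-⊞ (a ∷ as) [] = sym (+-identityʳ _)
  coeff₁-⊞ (a ∷ as) (b ∷ bs) = coeff₀-⊞ as bs

  coeff₀-⊡ : ∀ a bs → coeff₀ (a ⊡ bs) ≡ a * coeff₀ bs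
  coeff₀-⊡ a [] = sym (zeroʳ a)
  coeff₀-⊡ a (b ∷ bs) = refl

  coeff₁-⊡ : ∀ a bs → coeff₁ (a ⊡ bs) ≡ a * coeff₁ bs
  coeff₁-⊡ a [] = sym (zeroʳ a)
  coeff₁-⊡ a (b ∷ bs) = coeff₀-⊡ a bs

  coeff₀-⊠ : ∀ as bs → coeff₀ (as ⊠ bs) ≡ coeff₀ as * coeff₀ bs
  coeff₀-⊠ [] bs = sym (zeroˡ _)
  coeff₀-⊠ (a ∷ as) bs = trans (coeff₀-⊞ (a ⊡ bs) _) (trans (+-identityʳ _) (coeff₀-⊡ a bs))

  coeff₁-⊠ : ∀ as bs → coeff₁ (as ⊠ bs) ≡ coeff₀ as * coeff₁ bs + coeff₁ as * coeff₀ bs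
  coeff₁-⊠ [] bs = solve 2 (λ x y → :0 := :0 :* x :+ :0 :* y) refl (coeff₁ bs) (coeff₀ bs)
  coeff₁-⊠ (a ∷ as) bs = trans (coeff₁-⊞ (a ⊡ bs) _) (cong₂ _+_ (coeff₁-⊡ a bs) (coeff₀-⊠ as bs))

  coeff₀-↑ : ∀ as n → coeff₀ (as ↑ n) ≡ coeff₀ as ^ n
  coeff₀-↑ as zero = refl
  coeff₀-↑ as (suc n) = trans (coeff₀-⊠ as (as ↑ n)) (cong (coeff₀ as *_) (coeff₀-↑ as n))

  -- The coefficient of `X` in `(a + b X + …)^n` is `n b a^(n-1)`; the extra factor `a` avoids the
  -- exponent `n - 1`.
  coeff₁-↑ : ∀ as n → coeff₀ as * coeff₁ (as ↑ n) ≡ (n ×.× 1#) * coeff₁ as * coeff₀ as ^ n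
  coeff₁-↑ as zero = solve 3 (λ a b c → a :* :0 := :0 :* b :* c) refl (coeff₀ as) (coeff₁ as) 1#
  coeff₁-↑ as (suc n) = begin
    a * coeff₁ (as ⊠ as ↑ n)  ≡⟨ cong (a *_) (coeff₁-⊠ as (as ↑ n)) ⟩
    a * (a * coeff₁ (as ↑ n) + b * coeff₀ (as ↑ n))  ≡⟨ cong₂ (λ y z → a * (y + b * z)) (coeff₁-↑ as n) (coeff₀-↑ as n) ⟩
    a * ((n ×.× 1#) * b * a ^ n + b * a ^ n)
      ≡⟨ solve 4 (λ a b m e → a :* (m :* b :* e :+ b :* e) := (:1 :+ m) :* b :* (a :* e)) refl a b (n ×.× 1#) (a ^ n) ⟩
    (1# + n ×.× 1#) * b * (a * a ^ n)  ∎
    where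
    open ≡-Reasoning
    a = coeff₀ as
    b = coeff₁ as

  -- Since j ≥ 1, the factor 1 - w X^(j+1) contributes to neither of the coefficients of 1 and X,
  -- and comparing these two coefficients determines u.
  root-unique : ∀ (s m r j : ℕ) {u v κ wᵤ wᵥ} → suc (m ℕ.+ r ℕ.* suc (suc j)) ℕ.* suc s ℕ.< size →
    m ×.× 1# ≢ 0# → u ≢ 0# → v ≢ 0# →
    (∀ x → x ≢ 0# → (x ^ suc s - u) ^ m * (1# - wᵤ * (x ^ suc s) ^ suc (suc j)) ^ r
                  ≡ κ * ((x ^ suc s - v) ^ m * (1# - wᵥ * (x ^ suc s) ^ suc (suc j)) ^ r)) →
    u ≡ v
  root-unique s m r j {u} {v} {κ} {wᵤ} {wᵥ} len m≢0 u≢0 v≢0 agree = result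
    where
    open ≡-Reasoning
    poly : Carrier → Carrier → List Carrier
    poly u w = ((- u ∷ 1# ∷ []) ↑ m) ⊠ ((1# ∷ monomial (suc j) (- w)) ↑ r)
    eval-poly : ∀ u w y → eval (poly u w) y ≡ (y - u) ^ m * (1# - w * y ^ suc (suc j)) ^ r
    eval-poly u w y = trans (eval-⊠ ((- u ∷ 1# ∷ []) ↑ m) _ y) (cong₂ _*_
      (trans (eval-↑ (- u ∷ 1# ∷ []) m y) (cong (_^ m)
        (solve 2 (λ u y → :- u :+ y :* (:1 :+ y :* :0) := y :- u) refl u y)))
      (trans (eval-↑ (1# ∷ monomial (suc j) (- w)) r y) (cong (_^ r)
        (trans (cong (λ z → 1# + y * z) (eval-monomial (suc j) (- w) y))
          (solve 3 (λ w y e → :1 :+ y :* (:- w :* e) := :1 :- w :* (y :* e)) refl w y (y ^ suc j))))))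
    length-poly : ∀ u w → length (poly u w) ℕ.≤ suc (m ℕ.+ r ℕ.* suc (suc j))
    length-poly u w = length-⊠ ((- u ∷ 1# ∷ []) ↑ m) _
      (subst (λ n → length ((- u ∷ 1# ∷ []) ↑ m) ℕ.≤ suc n) (ℕ.*-identityʳ m) (length-↑ (- u ∷ 1# ∷ []) m ℕ.≤-refl))
      (length-↑ (1# ∷ monomial (suc j) (- w)) r (s≤s (ℕ.≤-reflexive (length-monomial (suc j) (- w)))))
    coeff₀-poly : ∀ u w → coeff₀ (poly u w) ≡ (- u) ^ m
    coeff₀-poly u w = trans (coeff₀-⊠ ((- u ∷ 1# ∷ []) ↑ m) _)
      (trans (cong₂ _*_ (coeff₀-↑ (- u ∷ 1# ∷ []) m) (trans (coeff₀-↑ (1# ∷ monomial (suc j) (- w)) r) (1^ r))) (*-identityʳ _))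
    coeff₁-poly : ∀ u w → - u * coeff₁ (poly u w) ≡ (m ×.× 1#) * (- u) ^ m
    coeff₁-poly u w = begin
      - u * coeff₁ (A ⊠ B)  ≡⟨ cong (- u *_) (coeff₁-⊠ A B) ⟩
      - u * (coeff₀ A * coeff₁ B + coeff₁ A * coeff₀ B)  ≡⟨ cong₂ (λ y z → - u * (coeff₀ A * y + coeff₁ A * z)) B₁ B₀ ⟩
      - u * (coeff₀ A * 0# + coeff₁ A * 1#)
        ≡⟨ solve 3 (λ u p q → u :* (p :* :0 :+ q :* :1) := u :* q) refl (- u) (coeff₀ A) (coeff₁ A) ⟩
      - u * coeff₁ A  ≡⟨ coeff₁-↑ (- u ∷ 1# ∷ []) m ⟩
      (m ×.× 1#) * 1# * (- u) ^ m  ≡⟨ cong (_* (- u) ^ m) (*-identityʳ _) ⟩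
      (m ×.× 1#) * (- u) ^ m  ∎
      where
      A = (- u ∷ 1# ∷ []) ↑ m
      b = 1# ∷ monomial (suc j) (- w)
      B = b ↑ r
      B₀ : coeff₀ B ≡ 1#
      B₀ = trans (coeff₀-↑ b r) (1^ r)
      B₁ : coeff₁ B ≡ 0#
      B₁ = trans (sym (*-identityˡ _)) (trans (coeff₁-↑ b r)
        (solve 2 (λ p q → p :* :0 :* q := :0) refl (r ×.× 1#) (1# ^ r)))
    difference = poly u wᵤ ⊞ (- κ) ⊡ poly v wᵥ
    difference-zero : Zero difference
    difference-zero = vanishing-powers⇒zero s difference
      (ℕ.≤-<-trans (ℕ.*-monoˡ-≤ (suc s) (length-⊞ (poly u wᵤ) _ (length-poly u wᵤ)
        (subst (ℕ._≤ _) (sym (length-⊡ (- κ) (poly v wᵥ))) (length-poly v wᵥ)))) len)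
      λ x x≢0 → begin
        eval difference (x ^ suc s)  ≡⟨ eval-⊞ (poly u wᵤ) _ _ ⟩
        eval (poly u wᵤ) (x ^ suc s) + eval ((- κ) ⊡ poly v wᵥ) (x ^ suc s)
          ≡⟨ cong₂ _+_ (trans (eval-poly u wᵤ _) (agree x x≢0)) (trans (eval-⊡ (- κ) (poly v wᵥ) _) (cong (- κ *_) (eval-poly v wᵥ _))) ⟩
        κ * V x + - κ * V x  ≡⟨ solve 2 (λ k e → k :* e :+ :- k :* e := :0) refl κ (V x) ⟩
        0#  ∎
      where V = λ x → (x ^ suc s - v) ^ m * (1# - wᵥ * (x ^ suc s) ^ suc (suc j)) ^ r
    coeff₀-zero : ∀ {as} → Zero as → coeff₀ as ≡ 0#
    coeff₀-zero [] = refl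
    coeff₀-zero (z ∷ _) = z
    coeff₁-zero : ∀ {as} → Zero as → coeff₁ as ≡ 0#
    coeff₁-zero [] = refl
    coeff₁-zero (_ ∷ zs) = coeff₀-zero zs
    -κ : ∀ {a b} → a + - κ * b ≡ 0# → a ≡ κ * b
    -κ {a} {b} eq = x-y≡0⇒x≡y (trans (cong (a +_) (-‿distribˡ-* κ b)) eq)
    eq₀ : (- u) ^ m ≡ κ * (- v) ^ m
    eq₀ = trans (sym (coeff₀-poly u wᵤ)) (trans (-κ (trans (cong (coeff₀ (poly u wᵤ) +_) (sym (coeff₀-⊡ (- κ) (poly v wᵥ))))
      (trans (sym (coeff₀-⊞ (poly u wᵤ) _)) (coeff₀-zero difference-zero)))) (cong (κ *_) (coeff₀-poly v wᵥ)))
    eq₁ : coeff₁ (poly u wᵤ) ≡ κ * coeff₁ (poly v wᵥ)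
    eq₁ = -κ (trans (cong (coeff₁ (poly u wᵤ) +_) (sym (coeff₁-⊡ (- κ) (poly v wᵥ))))
      (trans (sym (coeff₁-⊞ (poly u wᵤ) _)) (coeff₁-zero difference-zero)))
    result : u ≡ v
    result = trans (sym (-‿involutive u)) (trans (cong -_ (sym -v≡-u)) (-‿involutive v))
      where
      c = coeff₁ (poly u wᵤ)
      c≢0 : c ≢ 0#
      c≢0 c≡0 = *-nonzero m≢0 (^-nonzero m (-‿nonzero u≢0)) (trans (sym (coeff₁-poly u wᵤ)) (trans (cong (- u *_) c≡0) (zeroʳ _)))
      -- For both polynomials `(- u) * coeff₁ = m * coeff₀`, and both coefficients differ by the
      -- same factor `κ`; so `- u` and `- v` have the same product with `c`.
      -v≡-u : - v ≡ - u
      -v≡-u = *-cancelʳ c≢0 (begin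
        - v * c  ≡⟨ cong (- v *_) eq₁ ⟩
        - v * (κ * coeff₁ (poly v wᵥ))  ≡⟨ solve 3 (λ a b c → a :* (b :* c) := b :* (a :* c)) refl (- v) κ _ ⟩
        κ * (- v * coeff₁ (poly v wᵥ))  ≡⟨ cong (κ *_) (coeff₁-poly v wᵥ) ⟩
        κ * ((m ×.× 1#) * (- v) ^ m)  ≡⟨ solve 3 (λ a b c → a :* (b :* c) := b :* (a :* c)) refl κ (m ×.× 1#) _ ⟩
        (m ×.× 1#) * (κ * (- v) ^ m)  ≡⟨ cong ((m ×.× 1#) *_) eq₀ ⟨
        (m ×.× 1#) * (- u) ^ m  ≡⟨ coeff₁-poly u wᵤ ⟨
        - u * c  ∎)

  -- The coefficients of `(X^n - a^n) / (X - a)`, with the constant term `a^(n-1)` in front.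
  geometric : ℕ → Carrier → List Carrier
  geometric zero a = []
  geometric (suc n) a = a ^ n ∷ geometric n a

  geometric-sum : ∀ n a x → (x - a) * eval (geometric n a) x ≡ x ^ n - a ^ n
  geometric-sum zero a x = trans (zeroʳ _) (sym (-‿inverseʳ 1#))
  geometric-sum (suc n) a x = begin
    (x - a) * (a ^ n + x * E)  ≡⟨ solve 4 (λ x a b E → (x :- a) :* (b :+ x :* E) := (x :- a) :* b :+ x :* ((x :- a) :* E)) refl x a (a ^ n) E ⟩
    (x - a) * a ^ n + x * ((x - a) * E)  ≡⟨ cong (λ z → (x - a) * a ^ n + x * z) (geometric-sum n a x) ⟩
    (x - a) * a ^ n + x * (x ^ n - a ^ n) ≡⟨ solve 4 (λ x a b c → (x :- a) :* b :+ x :* (c :- b) := x :* c :- a :* b) refl x a (a ^ n) (x ^ n) ⟩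
    x ^ suc n - a ^ suc n  ∎
    where
    open ≡-Reasoning
    E = eval (geometric n a) x

  length-geometric : ∀ n a → length (geometric n a) ≡ n
  length-geometric zero a = refl
  length-geometric (suc n) a = cong suc (length-geometric n a)

  -- If a were not a square, X² - a would have no root, so the nonzero x would all be roots of
  -- (X^(2m) - a^m) / (X² - a), which has degree 2m - 2.
  euler : ∀ m a → size ≡ suc (2 ℕ.* suc m) → a ≢ 0# → a ^ suc m ≡ 1# → ∃[ x ] x * x ≡ a
  euler m a size≡ a≢0 aᵐ≡1 with ∃? (λ x → x * x ≟ a)
  ... | yes found = found
  ... | no none = contradiction (All.head zero′) (^-nonzero m a≢0)
    where
    root : ∀ x → x ≢ 0# → eval (geometric (suc m) a) (x ^ 2) ≡ 0#
    root x x≢0 = no-zero-divisors (begin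
      (x ^ 2 - a) * eval (geometric (suc m) a) (x ^ 2)  ≡⟨ geometric-sum (suc m) a (x ^ 2) ⟩
      (x ^ 2) ^ suc m - a ^ suc m  ≡⟨ cong₂ _-_ x²ᵐ≡1 aᵐ≡1 ⟩
      1# - 1#  ≡⟨ -‿inverseʳ 1# ⟩
      0#  ∎)
      λ eq → none (x , trans (cong (x *_) (sym (x^1 x))) (x-y≡0⇒x≡y eq))
      where
      open ≡-Reasoning
      x²ᵐ≡1 : (x ^ 2) ^ suc m ≡ 1#
      x²ᵐ≡1 = *-cancelˡ x≢0 (begin
        x * (x ^ 2) ^ suc m  ≡⟨ cong (x *_) (^-* x (suc m) 2) ⟨
        x ^ suc (suc m ℕ.* 2)  ≡⟨ cong (λ n → x ^ suc n) (ℕ.*-comm (suc m) 2) ⟩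
        x ^ suc (2 ℕ.* suc m)  ≡⟨ cong (x ^_) size≡ ⟨
        x ^ size  ≡⟨ ^-size x ⟩
        x  ≡⟨ *-identityʳ x ⟨
        x * 1#  ∎)
    zero′ : Zero (geometric (suc m) a)
    zero′ = vanishing-powers⇒zero 1 (geometric (suc m) a)
      (subst₂ (λ l s → suc (l ℕ.* 2) ℕ.≤ s) (sym (length-geometric (suc m) a)) (sym size≡) (s≤s (ℕ.≤-reflexive (ℕ.*-comm (suc m) 2)))) root

-- Endomorphisms of the field

module Endomorphisms (K : FiniteField) where
  open FieldProperties K

  record IsEndomorphism (f : Carrier → Carrier) : Set where
    field
      +-homo : ∀ x y → f (x + y) ≡ f x + f y
      *-homo : ∀ x y → f (x * y) ≡ f x * f y
      1-homo : f 1# ≡ 1#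

    0-homo : f 0# ≡ 0#
    0-homo = x+x≈x⇒x≈0 _ (trans (sym (+-homo 0# 0#)) (cong f (+-identityˡ 0#)))

    -homo : ∀ x → f (- x) ≡ - f x
    -homo x = x+y≡0⇒x≡-y (trans (sym (+-homo _ _)) (trans (cong f (-‿inverseˡ x)) 0-homo))

    2*-homo : ∀ x → f ((1# + 1#) * x) ≡ (1# + 1#) * f x
    2*-homo x = trans (*-homo _ _) (cong (_* f x) (trans (+-homo 1# 1#) (cong₂ _+_ 1-homo 1-homo)))

    nonzero : ∀ {x} → x ≢ 0# → f x ≢ 0#
    nonzero {x} x≢0 fx≡0 = 1≢0 (begin
      1#  ≡⟨ 1-homo ⟨
      f 1#  ≡⟨ cong f (*-inverseʳ x≢0) ⟨
      f (x * x ⁻¹)  ≡⟨ *-homo x (x ⁻¹) ⟩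
      f x * f (x ⁻¹)  ≡⟨ cong (_* f (x ⁻¹)) fx≡0 ⟩
      0# * f (x ⁻¹)  ≡⟨ zeroˡ _ ⟩
      0#  ∎)
      where open ≡-Reasoning

    zero⇒zero : ∀ {x} → f x ≡ 0# → x ≡ 0#
    zero⇒zero {x} eq with x ≟ 0#
    ... | yes x≡0 = x≡0
    ... | no x≢0 = contradiction eq (nonzero x≢0)

    ⁻¹-homo : ∀ {x} → x ≢ 0# → f (x ⁻¹) ≡ f x ⁻¹
    ⁻¹-homo {x} x≢0 = *-cancelˡ (nonzero x≢0) (begin
      f x * f (x ⁻¹)  ≡⟨ *-homo x (x ⁻¹) ⟨
      f (x * x ⁻¹)  ≡⟨ cong f (*-inverseʳ x≢0) ⟩
      f 1#  ≡⟨ 1-homo ⟩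
      1#  ≡⟨ *-inverseʳ (nonzero x≢0) ⟨
      f x * f x ⁻¹  ∎)
      where open ≡-Reasoning

  Coeffs : Set
  Coeffs = Carrier × Carrier × Carrier × Carrier

  -- Quadratic and bilinear forms over ℱ_q on `K`

  -- Names with `real` refer to elements fixed by `bar`, that is, to ℱ_q. The skew element `ι` gives
  -- the decomposition of `K` into ℱ_q and `ι` ℱ_q.
  module QuadraticForms
    (2≢0 : 1# + 1# ≢ 0#)
    (bar : Carrier → Carrier) (bar-isEndo : IsEndomorphism bar) (bar-involutive : ∀ x → bar (bar x) ≡ x)
    (ι : Carrier) (ι≢0 : ι ≢ 0#) (bar-ι : bar ι ≡ - ι) where
    private module Bar = IsEndomorphism bar-isEndo

    2# 4# : Carrier
    2# = 1# + 1#
    4# = 2# + 2#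

    2*-cancel : ∀ {x y} → 2# * x ≡ 2# * y → x ≡ y
    2*-cancel = *-cancelˡ 2≢0

    4≢0 : 4# ≢ 0#
    4≢0 eq = *-nonzero 2≢0 2≢0 (trans (solve 0 (:2 :* :2 := :2 :+ :2) refl) eq)

    x≡-x⇒x≡0 : ∀ {x} → x ≡ - x → x ≡ 0#
    x≡-x⇒x≡0 {x} eq = no-zero-divisors (trans (solve 1 (λ x → :2 :* x := x :- :- x) refl x) (x≡y⇒x-y≡0 eq)) 2≢0

    -- In the basis `1, ι` over ℱ_q this is the determinant of the coordinates of `x` and `y` times
    -- `- 2 ι`; its values are therefore skew, not real.
    det : Carrier → Carrier → Carrier
    det x y = x * bar y - bar x * y

    bar-det : ∀ x y → bar (det x y) ≡ - det x y
    bar-det x y = begin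
      bar (x * bar y - bar x * y)  ≡⟨ trans (Bar.+-homo _ _) (cong (bar (x * bar y) +_) (Bar.-homo _)) ⟩
      bar (x * bar y) - bar (bar x * y)  ≡⟨ cong₂ _-_ (Bar.*-homo _ _) (Bar.*-homo _ _) ⟩
      bar x * bar (bar y) - bar (bar x) * bar y  ≡⟨ cong₂ (λ a b → bar x * a - b * bar y) (bar-involutive y) (bar-involutive x) ⟩
      bar x * y - x * bar y  ≡⟨ solve 2 (λ a b → a :- b := :- (b :- a)) refl (bar x * y) (x * bar y) ⟩
      - det x y  ∎
      where open ≡-Reasoning

    bar-linear : ∀ R P x → bar (R * x + P * bar x) ≡ bar R * bar x + bar P * x
    bar-linear R P x = trans (Bar.+-homo _ _)
      (cong₂ _+_ (Bar.*-homo _ _) (trans (Bar.*-homo _ _) (cong (bar P *_) (bar-involutive x))))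

    -- The map `z ↦ R z + P z̄` has determinant `R R̄ - P P̄` over ℱ_q; this is the polarisation of
    -- that fact in the pair `(R , P)`.
    det-linear : ∀ R P R′ P′ x y →
      det (R * x + P * bar x) (R′ * y + P′ * bar y) + det (R′ * x + P′ * bar x) (R * y + P * bar y)
      ≡ (R * bar R′ + bar R * R′ - P * bar P′ - bar P * P′) * det x y
    det-linear R P R′ P′ x y = trans
      (cong₂ (λ a b → ((R * x + P * bar x) * a - b * (R′ * y + P′ * bar y)) + det (R′ * x + P′ * bar x) (R * y + P * bar y))
        (bar-linear R′ P′ y) (bar-linear R P x))
      (trans (cong₂ (λ a b → ((R * x + P * bar x) * (bar R′ * bar y + bar P′ * y) - (bar R * bar x + bar P * x) * (R′ * y + P′ * bar y))
                    + ((R′ * x + P′ * bar x) * a - b * (R * y + P * bar y))) (bar-linear R P y) (bar-linear R′ P′ x))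
      (solve 12 (λ R P R′ P′ x y R̄ P̄ R̄′ P̄′ x̄ ȳ →
          ((R :* x :+ P :* x̄) :* (R̄′ :* ȳ :+ P̄′ :* y) :- (R̄ :* x̄ :+ P̄ :* x) :* (R′ :* y :+ P′ :* ȳ))
            :+ ((R′ :* x :+ P′ :* x̄) :* (R̄ :* ȳ :+ P̄ :* y) :- (R̄′ :* x̄ :+ P̄′ :* x) :* (R :* y :+ P :* ȳ))
          := (R :* R̄′ :+ R̄ :* R′ :- P :* P̄′ :- P̄ :* P′) :* (x :* ȳ :- x̄ :* y))
        refl R P R′ P′ x y (bar R) (bar P) (bar R′) (bar P′) (bar x) (bar y)))

    -- For real `α` this runs over all quadratic forms on `K` with values in ℱ_q: they have
    -- dimension three, `α` contributes one and `β` two.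
    form : Carrier → Carrier → Carrier → Carrier
    form α β x = α * (x * bar x) + (β * (x * x) + bar β * (bar x * bar x))

    polar : Carrier → Carrier → Carrier → Carrier → Carrier
    polar α β x y = α * (x * bar y + bar x * y) + 2# * (β * (x * y) + bar β * (bar x * bar y))

    -- The usual discriminant in the basis `1, ι` is `4 ι² · disc α β`. As `ι²` is a non-square of
    -- ℱ_q, the customary criterion is reversed: anisotropic forms are those whose `disc` is a
    -- nonzero square.
    disc : Carrier → Carrier → Carrier
    disc α β = α * α - 4# * (β * bar β)

    polar-diagonal : ∀ α β x → polar α β x x ≡ 2# * form α β x
    polar-diagonal α β x = solve 5 (λ α β x β̄ x̄ →
      α :* (x :* x̄ :+ x̄ :* x) :+ :2 :* (β :* (x :* x) :+ β̄ :* (x̄ :* x̄))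
      := :2 :* (α :* (x :* x̄) :+ (β :* (x :* x) :+ β̄ :* (x̄ :* x̄)))) refl α β x (bar β) (bar x)

    -- The general ℱ_q-bilinear map K × K → K, and below its two determinant forms: B c s and B c · x are
    -- ℱ_q-linear endomorphisms of K of determinant q₁ c s and q₁ (swap c) x.
    B : Coeffs → Carrier → Carrier → Carrier
    B (c₀ , c₁ , c₂ , c₃) s x = (c₃ * s + c₁ * bar s) * x + (c₂ * s + c₀ * bar s) * bar x

    swap : Coeffs → Coeffs
    swap (c₀ , c₁ , c₂ , c₃) = c₀ , c₂ , c₁ , c₃

    B-swap : ∀ c s x → B c s x ≡ B (swap c) x s
    B-swap (c₀ , c₁ , c₂ , c₃) s x = solve 8 (λ c₀ c₁ c₂ c₃ s x s̄ x̄ →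
      (c₃ :* s :+ c₁ :* s̄) :* x :+ (c₂ :* s :+ c₀ :* s̄) :* x̄ := (c₃ :* x :+ c₂ :* x̄) :* s :+ (c₁ :* x :+ c₀ :* x̄) :* s̄)
      refl c₀ c₁ c₂ c₃ s x (bar s) (bar x)

    B-+ʳ : ∀ c s x y → B c s (x + y) ≡ B c s x + B c s y
    B-+ʳ (c₀ , c₁ , c₂ , c₃) s x y = trans (cong (λ z → R * (x + y) + P * z) (Bar.+-homo x y))
      (solve 6 (λ R P x y x̄ ȳ → R :* (x :+ y) :+ P :* (x̄ :+ ȳ) := (R :* x :+ P :* x̄) :+ (R :* y :+ P :* ȳ)) refl R P x y (bar x) (bar y))
      where
      R = c₃ * s + c₁ * bar s
      P = c₂ * s + c₀ * bar s

    B-+ˡ : ∀ c s t x → B c (s + t) x ≡ B c s x + B c t x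
    B-+ˡ c s t x = trans (B-swap c _ x) (trans (B-+ʳ (swap c) x s t) (sym (cong₂ _+_ (B-swap c s x) (B-swap c t x))))

    B-*ʳ : ∀ c s r x → bar r ≡ r → B c s (r * x) ≡ r * B c s x
    B-*ʳ (c₀ , c₁ , c₂ , c₃) s r x r̄≡r = trans (cong (λ z → R * (r * x) + P * z) (trans (Bar.*-homo r x) (cong (_* bar x) r̄≡r)))
      (solve 5 (λ R P r x x̄ → R :* (r :* x) :+ P :* (r :* x̄) := r :* (R :* x :+ P :* x̄)) refl R P r x (bar x))
      where
      R = c₃ * s + c₁ * bar s
      P = c₂ * s + c₀ * bar s

    B-*ˡ : ∀ c s r x → bar r ≡ r → B c (r * s) x ≡ r * B c s x
    B-*ˡ c s r x r̄≡r = trans (B-swap c _ x) (trans (B-*ʳ (swap c) x r s r̄≡r) (cong (r *_) (sym (B-swap c s x))))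

    N : Carrier → Carrier
    N x = x * bar x

    α₁ β₁ : Coeffs → Carrier
    α₁ (c₀ , c₁ , c₂ , c₃) = N c₁ + N c₃ - N c₀ - N c₂
    β₁ (c₀ , c₁ , c₂ , c₃) = c₃ * bar c₁ - c₂ * bar c₀

    q₁ : Coeffs → Carrier → Carrier
    q₁ c = form (α₁ c) (β₁ c)

    bar-N : ∀ x → bar (N x) ≡ N x
    bar-N x = trans (Bar.*-homo x _) (trans (cong (bar x *_) (bar-involutive x)) (*-comm _ _))

    bar-β₁ : ∀ c₀ c₁ c₂ c₃ → bar (c₃ * bar c₁ - c₂ * bar c₀) ≡ bar c₃ * c₁ - bar c₂ * c₀
    bar-β₁ c₀ c₁ c₂ c₃ = trans (Bar.+-homo _ _) (cong₂ _+_
      (trans (Bar.*-homo _ _) (cong (bar c₃ *_) (bar-involutive c₁)))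
      (trans (Bar.-homo _) (cong -_ (trans (Bar.*-homo _ _) (cong (bar c₂ *_) (bar-involutive c₀))))))

    bar-- : ∀ x y → bar (x - y) ≡ bar x - bar y
    bar-- x y = trans (Bar.+-homo x (- y)) (cong (bar x +_) (Bar.-homo y))

    bar-α₁ : ∀ c → bar (α₁ c) ≡ α₁ c
    bar-α₁ (c₀ , c₁ , c₂ , c₃) = trans (bar-- _ _) (cong₂ _-_ (trans (bar-- _ _)
      (cong₂ _-_ (trans (Bar.+-homo _ _) (cong₂ _+_ (bar-N c₁) (bar-N c₃))) (bar-N c₀))) (bar-N c₂))

    -- It is polarised in `s` because the degenerate case needs it for two different first
    -- arguments; `det-B₁` is the diagonal.
    det-B : ∀ c s t x y → det (B c s x) (B c t y) + det (B c t x) (B c s y) ≡ polar (α₁ c) (β₁ c) s t * det x y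
    det-B (c₀ , c₁ , c₂ , c₃) s t x y = trans (det-linear R P R′ P′ x y) (cong (_* det x y) (begin
      R * bar R′ + bar R * R′ - P * bar P′ - bar P * P′
        ≡⟨ cong₂ (λ a b → R * a + b * R′ - P * bar P′ - bar P * P′) (bar-linear c₃ c₁ t) (bar-linear c₃ c₁ s) ⟩
      R * (bar c₃ * bar t + bar c₁ * t) + (bar c₃ * bar s + bar c₁ * s) * R′ - P * bar P′ - bar P * P′
        ≡⟨ cong₂ (λ a b → R * (bar c₃ * bar t + bar c₁ * t) + (bar c₃ * bar s + bar c₁ * s) * R′ - P * a - b * P′) (bar-linear c₂ c₀ t) (bar-linear c₂ c₀ s) ⟩
      R * (bar c₃ * bar t + bar c₁ * t) + (bar c₃ * bar s + bar c₁ * s) * R′ - P * (bar c₂ * bar t + bar c₀ * t) - (bar c₂ * bar s + bar c₀ * s) * P′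
        ≡⟨ solve 12 (λ c₀ c₁ c₂ c₃ s t c̄₀ c̄₁ c̄₂ c̄₃ s̄ t̄ →
             (c₃ :* s :+ c₁ :* s̄) :* (c̄₃ :* t̄ :+ c̄₁ :* t) :+ (c̄₃ :* s̄ :+ c̄₁ :* s) :* (c₃ :* t :+ c₁ :* t̄)
             :- (c₂ :* s :+ c₀ :* s̄) :* (c̄₂ :* t̄ :+ c̄₀ :* t) :- (c̄₂ :* s̄ :+ c̄₀ :* s) :* (c₂ :* t :+ c₀ :* t̄)
             := (c₁ :* c̄₁ :+ c₃ :* c̄₃ :- c₀ :* c̄₀ :- c₂ :* c̄₂) :* (s :* t̄ :+ s̄ :* t)
                :+ :2 :* ((c₃ :* c̄₁ :- c₂ :* c̄₀) :* (s :* t) :+ (c̄₃ :* c₁ :- c̄₂ :* c₀) :* (s̄ :* t̄)))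
           refl c₀ c₁ c₂ c₃ s t (bar c₀) (bar c₁) (bar c₂) (bar c₃) (bar s) (bar t) ⟩
      α * (s * bar t + bar s * t) + 2# * (β * (s * t) + (bar c₃ * c₁ - bar c₂ * c₀) * (bar s * bar t))
        ≡⟨ cong (λ b → α * (s * bar t + bar s * t) + 2# * (β * (s * t) + b * (bar s * bar t))) (bar-β₁ c₀ c₁ c₂ c₃) ⟨
      polar α β s t ∎))
      where
      open ≡-Reasoning
      R = c₃ * s + c₁ * bar s
      P = c₂ * s + c₀ * bar s
      R′ = c₃ * t + c₁ * bar t
      P′ = c₂ * t + c₀ * bar t
      α = α₁ (c₀ , c₁ , c₂ , c₃)
      β = β₁ (c₀ , c₁ , c₂ , c₃)

    det-B₁ : ∀ c s x y → det (B c s x) (B c s y) ≡ q₁ c s * det x y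
    det-B₁ c s x y = 2*-cancel (begin
      2# * det (B c s x) (B c s y)  ≡⟨ solve 1 (λ d → :2 :* d := d :+ d) refl (det (B c s x) (B c s y)) ⟩
      det (B c s x) (B c s y) + det (B c s x) (B c s y)  ≡⟨ det-B c s s x y ⟩
      polar (α₁ c) (β₁ c) s s * det x y  ≡⟨ cong (_* det x y) (polar-diagonal (α₁ c) (β₁ c) s) ⟩
      2# * q₁ c s * det x y  ≡⟨ *-assoc _ _ _ ⟩
      2# * (q₁ c s * det x y)  ∎)
      where open ≡-Reasoning

    det-B₂ : ∀ c s t x → det (B c s x) (B c t x) ≡ q₁ (swap c) x * det s t
    det-B₂ c s t x = trans (cong₂ det (B-swap c s x) (B-swap c t x)) (det-B₁ (swap c) x s t)

    -- Up to a constant factor, both sides are Cayley's hyperdeterminant of the 2 × 2 × 2 tensor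
    -- `B c`, which is symmetric in the slots of the tensor.
    disc-swap : ∀ c → disc (α₁ c) (β₁ c) ≡ disc (α₁ (swap c)) (β₁ (swap c))
    disc-swap c@(c₀ , c₁ , c₂ , c₃) = trans
      (cong (λ b → α₁ c * α₁ c - 4# * (β₁ c * b)) (bar-β₁ c₀ c₁ c₂ c₃))
      (trans (solve 8 (λ c₀ c₁ c₂ c₃ d₀ d₁ d₂ d₃ →
        (c₁ :* d₁ :+ c₃ :* d₃ :- c₀ :* d₀ :- c₂ :* d₂) :* (c₁ :* d₁ :+ c₃ :* d₃ :- c₀ :* d₀ :- c₂ :* d₂)
          :- :4 :* ((c₃ :* d₁ :- c₂ :* d₀) :* (d₃ :* c₁ :- d₂ :* c₀))
        := (c₂ :* d₂ :+ c₃ :* d₃ :- c₀ :* d₀ :- c₁ :* d₁) :* (c₂ :* d₂ :+ c₃ :* d₃ :- c₀ :* d₀ :- c₁ :* d₁)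
          :- :4 :* ((c₃ :* d₂ :- c₁ :* d₀) :* (d₃ :* c₂ :- d₁ :* c₀)))
        refl c₀ c₁ c₂ c₃ (bar c₀) (bar c₁) (bar c₂) (bar c₃))
      (cong (λ b → α₁ (swap c) * α₁ (swap c) - 4# * (β₁ (swap c) * b)) (sym (bar-β₁ c₀ c₂ c₁ c₃))))

    det-real : ∀ {x y r} → bar r ≡ r → det x (r * y) ≡ r * det x y
    det-real {x} {y} {r} r̄≡r = trans (cong (λ z → x * z - bar x * (r * y)) (trans (Bar.*-homo r y) (cong (_* bar y) r̄≡r)))
      (solve 5 (λ x x̄ y ȳ r → x :* (r :* ȳ) :- x̄ :* (r :* y) := r :* (x :* ȳ :- x̄ :* y)) refl x (bar x) y (bar y) r)

    det-antisym : ∀ x y → det y x ≡ - det x y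
    det-antisym x y = solve 4 (λ x y x̄ ȳ → y :* x̄ :- ȳ :* x := :- (x :* ȳ :- x̄ :* y)) refl x y (bar x) (bar y)

    det-self : ∀ x → det x x ≡ 0#
    det-self x = x≡-x⇒x≡0 (det-antisym x x)

    det≡0⇒proportional : ∀ {x y} → x ≢ 0# → det x y ≡ 0# → ∃[ r ] (bar r ≡ r × y ≡ r * x)
    det≡0⇒proportional {x} {y} x≢0 eq = y * x ⁻¹ , real , (begin
      y  ≡⟨ *-identityʳ y ⟨
      y * 1#  ≡⟨ cong (y *_) (*-inverseˡ x≢0) ⟨
      y * (x ⁻¹ * x)  ≡⟨ *-assoc _ _ _ ⟨
      y * x ⁻¹ * x  ∎)
      where
      open ≡-Reasoning
      real : bar (y * x ⁻¹) ≡ y * x ⁻¹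
      real = *-cancelˡ (*-nonzero x≢0 (Bar.nonzero x≢0)) (begin
        x * bar x * bar (y * x ⁻¹)  ≡⟨ cong (x * bar x *_) (trans (Bar.*-homo y _) (cong (bar y *_) (Bar.⁻¹-homo x≢0))) ⟩
        x * bar x * (bar y * bar x ⁻¹)  ≡⟨ solve 4 (λ a b c d → a :* b :* (c :* d) := a :* c :* (b :* d)) refl x (bar x) (bar y) (bar x ⁻¹) ⟩
        x * bar y * (bar x * bar x ⁻¹)  ≡⟨ cong₂ _*_ (x-y≡0⇒x≡y eq) (*-inverseʳ (Bar.nonzero x≢0)) ⟩
        bar x * y * 1#  ≡⟨ cong (bar x * y *_) (*-inverseʳ x≢0) ⟨
        bar x * y * (x * x ⁻¹)  ≡⟨ solve 4 (λ a b c d → b :* c :* (a :* d) := a :* b :* (c :* d)) refl x (bar x) y (x ⁻¹) ⟩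
        x * bar x * (y * x ⁻¹)  ∎)

    -- If `y ȳ = 1` then `y (1 + ȳ) = y + 1`, so `x = 1 + y` will do unless it vanishes; for
    -- `y = - 1` the skew element `ι` takes its place.
    hilbert90 : ∀ y → N y ≡ 1# → ∃[ x ] (x ≢ 0# × x ≡ y * bar x)
    hilbert90 y Ny≡1 with 1# + y ≟ 0#
    ... | no 1+y≢0 = 1# + y , 1+y≢0 , (begin
      1# + y  ≡⟨ +-comm 1# y ⟩
      y + 1#  ≡⟨ cong₂ _+_ (sym (*-identityʳ y)) (sym Ny≡1) ⟩
      y * 1# + y * bar y  ≡⟨ distribˡ y 1# (bar y) ⟨
      y * (1# + bar y)  ≡⟨ cong (y *_) (trans (Bar.+-homo 1# y) (cong (_+ bar y) Bar.1-homo)) ⟨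
      y * bar (1# + y)  ∎)
      where open ≡-Reasoning
    ... | yes 1+y≡0 = ι , ι≢0 , (begin
      ι  ≡⟨ solve 1 (λ i → i := (:- :1) :* (:- i)) refl ι ⟩
      - 1# * - ι  ≡⟨ cong₂ _*_ (trans (x+y≡0⇒x≡-y (trans (+-comm y 1#) 1+y≡0)) refl) bar-ι ⟨
      y * bar ι  ∎)
      where open ≡-Reasoning

    disc-β≡0 : ∀ {α β} → β ≡ 0# → disc α β ≡ α * α
    disc-β≡0 {α} {β} β≡0 = trans (cong (λ b → α * α - 4# * (b * bar β)) β≡0)
      (solve 2 (λ a b → a :* a :- :4 :* (:0 :* b) := a :* a) refl α (bar β))

    bar-β≡0 : ∀ {β} → β ≡ 0# → bar β ≡ 0#
    bar-β≡0 β≡0 = trans (cong bar β≡0) Bar.0-homo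

    form-zero : ∀ {α β} x → α ≡ 0# → β ≡ 0# → form α β x ≡ 0#
    form-zero {α} {β} x α≡0 β≡0 = trans (cong₂ (λ a b → a * (x * bar x) + (b * (x * x) + bar β * (bar x * bar x))) α≡0 β≡0)
      (trans (cong (λ b → 0# * (x * bar x) + (0# * (x * x) + b * (bar x * bar x))) (bar-β≡0 β≡0))
        (solve 2 (λ x y → :0 :* (x :* y) :+ (:0 :* (x :* x) :+ :0 :* (y :* y)) := :0) refl x (bar x)))

    private
      -- Substituting x = y x̄ turns the form into x̄² (β y² + α y + β̄), whose roots y are (-α ± δ) / 2β.
      form-y : ∀ α β y x → x ≡ y * bar x → form α β x ≡ bar x * bar x * (β * (y * y) + α * y + bar β)
      form-y α β y x eq = trans (cong (λ z → α * (z * bar x) + (β * (z * z) + bar β * (bar x * bar x))) eq)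
        (solve 5 (λ α β y x̄ β̄ → α :* (y :* x̄ :* x̄) :+ (β :* (y :* x̄ :* (y :* x̄)) :+ β̄ :* (x̄ :* x̄))
          := x̄ :* x̄ :* (β :* (y :* y) :+ α :* y :+ β̄)) refl α β y (bar x) (bar β))

      -- As `δ` is skew, conjugation turns the numerator `δ - α` into `- δ - α`, and the product of
      -- the two is `α² - δ² = 4 β β̄`. Norm 1 is what makes `y` a quotient `x / x̄`.
      quadratic-root : ∀ {α β δ} → β ≢ 0# → bar α ≡ α → δ * δ ≡ disc α β → bar δ ≡ - δ →
        ∃[ y ] (N y ≡ 1# × 2# * (β * y) ≡ δ - α)
      quadratic-root {α} {β} {δ} β≢0 ᾱ≡α δ²≡ δ̄≡-δ = y , Ny , 2βy
        where
        open ≡-Reasoning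
        2β = 2# * β
        2β≢0 = *-nonzero 2≢0 β≢0
        y = (δ - α) * 2β ⁻¹
        2βy : 2# * (β * y) ≡ δ - α
        2βy = begin
          2# * (β * ((δ - α) * 2β ⁻¹))  ≡⟨ solve 4 (λ t b e i → t :* (b :* (e :* i)) := (t :* b) :* i :* e) refl 2# β (δ - α) (2β ⁻¹) ⟩
          2β * 2β ⁻¹ * (δ - α)  ≡⟨ cong (_* (δ - α)) (*-inverseʳ 2β≢0) ⟩
          1# * (δ - α)  ≡⟨ *-identityˡ _ ⟩
          δ - α  ∎
        2βȳ : 2# * (bar β * bar y) ≡ - δ - α
        2βȳ = begin
          2# * (bar β * bar y)  ≡⟨ trans (Bar.2*-homo _) (cong (2# *_) (Bar.*-homo β y)) ⟨
          bar (2# * (β * y))  ≡⟨ cong bar 2βy ⟩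
          bar (δ - α)  ≡⟨ bar-- δ α ⟩
          bar δ - bar α  ≡⟨ cong₂ _-_ δ̄≡-δ ᾱ≡α ⟩
          - δ - α  ∎
        Ny : N y ≡ 1#
        Ny = *-cancelˡ (*-nonzero 4≢0 (*-nonzero β≢0 (Bar.nonzero β≢0))) (begin
          4# * (β * bar β) * (y * bar y)  ≡⟨ solve 4 (λ b y b̄ ȳ → :4 :* (b :* b̄) :* (y :* ȳ)
                                                            := :2 :* (b :* y) :* (:2 :* (b̄ :* ȳ))) refl β y (bar β) (bar y) ⟩
          2# * (β * y) * (2# * (bar β * bar y))  ≡⟨ cong₂ _*_ 2βy 2βȳ ⟩
          (δ - α) * (- δ - α)  ≡⟨ solve 2 (λ d a → (d :- a) :* (:- d :- a) := a :* a :- d :* d) refl δ α ⟩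
          α * α - δ * δ  ≡⟨ cong (λ z → α * α - z) δ²≡ ⟩
          α * α - disc α β  ≡⟨ solve 2 (λ a b → a :- (a :- b) := b :* :1) refl (α * α) (4# * (β * bar β)) ⟩
          4# * (β * bar β) * 1#  ∎)

      form-root : ∀ {α β δ y} → β ≢ 0# → δ * δ ≡ disc α β → 2# * (β * y) ≡ δ - α → β * (y * y) + α * y + bar β ≡ 0#
      form-root {α} {β} {δ} {y} β≢0 δ²≡ 2βy = no-zero-divisors {4# * β} (begin
        4# * β * (β * (y * y) + α * y + bar β)
          ≡⟨ solve 4 (λ a b y c → :4 :* b :* (b :* (y :* y) :+ a :* y :+ c)
               := :2 :* (b :* y) :* (:2 :* (b :* y)) :+ :2 :* a :* (:2 :* (b :* y)) :+ :4 :* (b :* c))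
             refl α β y (bar β) ⟩
        2# * (β * y) * (2# * (β * y)) + 2# * α * (2# * (β * y)) + 4# * (β * bar β)
          ≡⟨ cong (λ z → z * z + 2# * α * z + 4# * (β * bar β)) 2βy ⟩
        (δ - α) * (δ - α) + 2# * α * (δ - α) + 4# * (β * bar β)
          ≡⟨ solve 3 (λ d a e → (d :- a) :* (d :- a) :+ :2 :* a :* (d :- a) :+ e := d :* d :- (a :* a :- e)) refl δ α (4# * (β * bar β)) ⟩
        δ * δ - disc α β  ≡⟨ x≡y⇒x-y≡0 δ²≡ ⟩
        0#  ∎) (*-nonzero 4≢0 β≢0)
        where open ≡-Reasoning

      polar-root : ∀ {α β e y₀} → disc α β ≡ 0# → 2# * (β * y₀) ≡ 0# - α → e ≡ y₀ * bar e → ∀ y → 2# * β * polar α β e y ≡ 0#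
      polar-root {α} {β} {e} {y₀} disc≡0 2βy e≡y₀ē y = begin
        2# * β * polar α β e y
          ≡⟨ cong (λ z → 2# * β * (α * (z * bar y + bar e * y) + 2# * (β * (z * y) + bar β * (bar e * bar y)))) e≡y₀ē ⟩
        2# * β * (α * (y₀ * bar e * bar y + bar e * y) + 2# * (β * (y₀ * bar e * y) + bar β * (bar e * bar y)))
          ≡⟨ solve 7 (λ a b c t e y z → :2 :* b :* (a :* (t :* e :* z :+ e :* y) :+ :2 :* (b :* (t :* e :* y) :+ c :* (e :* z)))
               := a :* (:2 :* (b :* t)) :* (e :* z) :+ :2 :* b :* (a :+ :2 :* (b :* t)) :* (e :* y) :+ :4 :* (b :* c) :* (e :* z))
             refl α β (bar β) y₀ (bar e) y (bar y) ⟩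
        α * (2# * (β * y₀)) * (bar e * bar y) + 2# * β * (α + 2# * (β * y₀)) * (bar e * y) + 4# * (β * bar β) * (bar e * bar y)
          ≡⟨ cong (λ z → α * z * (bar e * bar y) + 2# * β * (α + z) * (bar e * y) + 4# * (β * bar β) * (bar e * bar y)) 2βy ⟩
        α * (0# - α) * (bar e * bar y) + 2# * β * (α + (0# - α)) * (bar e * y) + 4# * (β * bar β) * (bar e * bar y)
          ≡⟨ solve 5 (λ a b d p q → a :* (:0 :- a) :* p :+ :2 :* b :* (a :+ (:0 :- a)) :* q :+ d :* p := :- ((a :* a :- d) :* p))
             refl α β (4# * (β * bar β)) (bar e * bar y) (bar e * y) ⟩
        - (disc α β * (bar e * bar y))  ≡⟨ cong (λ z → - (z * (bar e * bar y))) disc≡0 ⟩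
        - (0# * (bar e * bar y))  ≡⟨ trans (cong -_ (zeroˡ _)) -0#≈0# ⟩
        0#  ∎
        where open ≡-Reasoning

      polar-zero : ∀ {α β} x y → α ≡ 0# → β ≡ 0# → polar α β x y ≡ 0#
      polar-zero {α} {β} x y α≡0 β≡0 = trans (cong₂ (λ a b → a * (x * bar y + bar x * y) + 2# * (b * (x * y) + bar β * (bar x * bar y))) α≡0 β≡0)
        (trans (cong (λ b → 0# * (x * bar y + bar x * y) + 2# * (0# * (x * y) + b * (bar x * bar y))) (bar-β≡0 β≡0))
          (solve 3 (λ p q r → :0 :* p :+ :2 :* (:0 :* q :+ :0 :* r) := :0) refl (x * bar y + bar x * y) (x * y) (bar x * bar y)))

    -- A skew `δ` means that `disc α β` is zero or a non-square of ℱ_q. By `form-y` a zero `x` comes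
    -- from a root `y = x / x̄`, which must have norm 1. For `β = 0` the form is zero, since
    -- `α = ± δ` is both real and skew.
    isotropic : ∀ {α β δ} → bar α ≡ α → δ * δ ≡ disc α β → bar δ ≡ - δ → ∃[ x ] (x ≢ 0# × form α β x ≡ 0#)
    isotropic {α} {β} {δ} ᾱ≡α δ²≡ δ̄≡-δ = by-cases (β ≟ 0#)
      where
      by-cases : Dec (β ≡ 0#) → ∃[ x ] (x ≢ 0# × form α β x ≡ 0#)
      by-cases (yes β≡0) = 1# , 1≢0 , form-zero 1# (α≡0 (square-equal (trans δ²≡ (disc-β≡0 β≡0)))) β≡0
        where
        α≡0 : (δ ≡ α) ⊎ (δ ≡ - α) → α ≡ 0#
        α≡0 (inj₁ δ≡α) = x≡-x⇒x≡0 (trans (sym ᾱ≡α) (trans (cong bar (sym δ≡α)) (trans δ̄≡-δ (cong -_ δ≡α))))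
        α≡0 (inj₂ δ≡-α) = x≡-x⇒x≡0 (trans (trans (sym (-‿involutive α)) (trans (cong -_ (sym δ≡-α)) (sym δ̄≡-δ)))
          (trans (cong bar δ≡-α) (trans (Bar.-homo α) (cong -_ ᾱ≡α))))
      by-cases (no β≢0) =
        let y , Ny≡1 , 2βy = quadratic-root β≢0 ᾱ≡α δ²≡ δ̄≡-δ
            x , x≢0 , x≡yx̄ = hilbert90 y Ny≡1
        in x , x≢0 , trans (form-y α β y x x≡yx̄) (trans (cong (bar x * bar x *_) (form-root β≢0 δ²≡ 2βy)) (zeroʳ _))

    radical : ∀ {α β} → bar α ≡ α → disc α β ≡ 0# → ∃[ e ] (e ≢ 0# × (∀ y → polar α β e y ≡ 0#))
    radical {α} {β} ᾱ≡α disc≡0 = by-cases (β ≟ 0#)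
      where
      by-cases : Dec (β ≡ 0#) → ∃[ e ] (e ≢ 0# × (∀ y → polar α β e y ≡ 0#))
      by-cases (yes β≡0) = 1# , 1≢0 , λ y → polar-zero 1# y α≡0 β≡0
        where
        α≡0 : α ≡ 0#
        α≡0 = ^-zero 2 (trans (cong (α *_) (x^1 α)) (trans (sym (disc-β≡0 β≡0)) disc≡0))
      by-cases (no β≢0) =
        -- Here the root is used with `δ = 0`, which is skew as well as real.
        let y₀ , Ny≡1 , 2βy = quadratic-root β≢0 ᾱ≡α (trans (zeroˡ 0#) (sym disc≡0)) (trans Bar.0-homo (sym -0#≈0#))
            e , e≢0 , e≡y₀ē = hilbert90 y₀ Ny≡1
        in e , e≢0 , λ y → no-zero-divisors (polar-root disc≡0 2βy e≡y₀ē y) (*-nonzero 2≢0 β≢0)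

    polar≡0⇒form≡0 : ∀ {α β x} → polar α β x x ≡ 0# → form α β x ≡ 0#
    polar≡0⇒form≡0 {α} {β} {x} eq = no-zero-divisors (trans (sym (polar-diagonal α β x)) eq) 2≢0

    RealSquareRoots : Set
    RealSquareRoots = ∀ a → bar a ≡ a → ∃[ δ ] δ * δ ≡ a

    bar-2 : bar 2# ≡ 2#
    bar-2 = trans (Bar.+-homo 1# 1#) (cong₂ _+_ Bar.1-homo Bar.1-homo)
    bar-4 : bar 4# ≡ 4#
    bar-4 = trans (Bar.+-homo 2# 2#) (cong₂ _+_ bar-2 bar-2)

    disc-real : ∀ {α β} → bar α ≡ α → bar (disc α β) ≡ disc α β
    disc-real {α} {β} ᾱ≡α = trans (bar-- _ _) (cong₂ _-_ (trans (Bar.*-homo α α) (cong₂ _*_ ᾱ≡α ᾱ≡α))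
      (trans (Bar.*-homo _ _) (cong₂ _*_ bar-4 (bar-N β))))

    Anisotropic : Carrier → Carrier → Set
    Anisotropic α β = ∀ x → x ≢ 0# → form α β x ≢ 0#

    -- A square root in `K` of a real element is real or skew, and by `isotropic` the skew ones,
    -- zero included, are excluded.
    anisotropic⇒disc-square : RealSquareRoots → ∀ {α β} → bar α ≡ α → Anisotropic α β →
      ∃[ δ ] (bar δ ≡ δ × δ ≢ 0# × δ * δ ≡ disc α β)
    anisotropic⇒disc-square sqrt {α} {β} ᾱ≡α aniso with sqrt (disc α β) (disc-real ᾱ≡α)
    ... | δ , δ²≡ = δ , real , nonzero , δ²≡
      where
      ¬imaginary : bar δ ≢ - δ
      ¬imaginary eq = let x , x≢0 , isZero = isotropic ᾱ≡α δ²≡ eq in aniso x x≢0 isZero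
      bar-disc : bar δ * bar δ ≡ δ * δ
      bar-disc = trans (sym (Bar.*-homo δ δ)) (trans (cong bar δ²≡) (trans (disc-real ᾱ≡α) (sym δ²≡)))
      real : bar δ ≡ δ
      real = case square-equal bar-disc of λ { (inj₁ eq) → eq ; (inj₂ eq) → contradiction eq ¬imaginary }
      nonzero : δ ≢ 0#
      nonzero δ≡0 = ¬imaginary (trans (cong bar δ≡0) (trans Bar.0-homo (trans (sym -0#≈0#) (cong -_ (sym δ≡0)))))

    -- α * α′ = 2 (β β̄′ + β̄ β′) says that the two forms are orthogonal for the polarisation of disc.
    degenerate-orthogonal⇒common-zero : ∀ {α β α′ β′} → bar α ≡ α → disc α β ≡ 0# → α * α′ ≡ 2# * (β * bar β′ + bar β * β′) → α ≢ 0# →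
      ∃[ e ] (e ≢ 0# × form α β e ≡ 0# × form α′ β′ e ≡ 0#)
    degenerate-orthogonal⇒common-zero {α} {β} {α′} {β′} ᾱ≡α disc≡0 tangent α≢0 = common (radical ᾱ≡α disc≡0)
      where
      open ≡-Reasoning
      common : ∃[ e ] (e ≢ 0# × (∀ y → polar α β e y ≡ 0#)) → ∃[ e ] (e ≢ 0# × form α β e ≡ 0# × form α′ β′ e ≡ 0#)
      common (e , e≢0 , rad) = e , e≢0 , polar≡0⇒form≡0 (rad e) , no-zero-divisors αf′ α≢0
        where
        -- `P` and `Q` are the coefficients of the linear form `polar α β e y = P y + Q ȳ`. It
        -- vanishes identically; the values `y = 1` and `y = ι` give `P + Q = 0` and `P - Q = 0`.
        P = α * bar e + 2# * (β * e)
        Q = α * e + 2# * (bar β * bar e)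
        P*+Q* : ∀ y → P * y + Q * bar y ≡ 0#
        P*+Q* y = trans (solve 7 (λ a b b̄ e ē y ȳ → (a :* ē :+ :2 :* (b :* e)) :* y :+ (a :* e :+ :2 :* (b̄ :* ē)) :* ȳ
          := a :* (e :* ȳ :+ ē :* y) :+ :2 :* (b :* (e :* y) :+ b̄ :* (ē :* ȳ))) refl α β (bar β) e (bar e) y (bar y)) (rad y)
        P+Q≡0 : P + Q ≡ 0#
        P+Q≡0 = trans (sym (cong₂ _+_ (*-identityʳ P) (trans (cong (Q *_) Bar.1-homo) (*-identityʳ Q)))) (P*+Q* 1#)
        P-Q≡0 : P - Q ≡ 0#
        P-Q≡0 = no-zero-divisors (begin
          ι * (P - Q)  ≡⟨ solve 3 (λ i p q → i :* (p :- q) := p :* i :+ q :* (:- i)) refl ι P Q ⟩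
          P * ι + Q * - ι  ≡⟨ cong (λ z → P * ι + Q * z) bar-ι ⟨
          P * ι + Q * bar ι  ≡⟨ P*+Q* ι ⟩
          0#  ∎) ι≢0
        P≡0 : P ≡ 0#
        P≡0 = no-zero-divisors (trans (solve 2 (λ p q → :2 :* p := (p :+ q) :+ (p :- q)) refl P Q)
          (trans (cong₂ _+_ P+Q≡0 P-Q≡0) (+-identityˡ 0#))) 2≢0
        Q≡0 : Q ≡ 0#
        Q≡0 = trans (sym (+-identityˡ Q)) (trans (cong (_+ Q) (sym P≡0)) P+Q≡0)
        αf′ : α * form α′ β′ e ≡ 0#
        αf′ = begin
          α * (α′ * (e * bar e) + (β′ * (e * e) + bar β′ * (bar e * bar e)))
            ≡⟨ solve 8 (λ a a′ b b̄ b′ b̄′ e ē → a :* (a′ :* (e :* ē) :+ (b′ :* (e :* e) :+ b̄′ :* (ē :* ē)))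
                 := (a :* a′ :- :2 :* (b :* b̄′ :+ b̄ :* b′)) :* (e :* ē) :+ b′ :* e :* (a :* e :+ :2 :* (b̄ :* ē)) :+ b̄′ :* ē :* (a :* ē :+ :2 :* (b :* e)))
               refl α α′ β (bar β) β′ (bar β′) e (bar e) ⟩
          (α * α′ - 2# * (β * bar β′ + bar β * β′)) * (e * bar e) + β′ * e * Q + bar β′ * bar e * P
            ≡⟨ cong₂ _+_ (cong₂ _+_ (cong (_* (e * bar e)) (x≡y⇒x-y≡0 tangent)) (cong (β′ * e *_) Q≡0)) (cong (bar β′ * bar e *_) P≡0) ⟩
          0# * (e * bar e) + β′ * e * 0# + bar β′ * bar e * 0#
            ≡⟨ solve 3 (λ p q r → :0 :* p :+ q :* :0 :+ r :* :0 := :0) refl (e * bar e) (β′ * e) (bar β′ * bar e) ⟩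
          0# ∎

    disc≡0-α≡0⇒β≡0 : ∀ {α β} → disc α β ≡ 0# → α ≡ 0# → β ≡ 0#
    disc≡0-α≡0⇒β≡0 {α} {β} disc≡0 α≡0 = by-cases (β ≟ 0#)
      where
      open ≡-Reasoning
      4ββ̄ : 4# * (β * bar β) ≡ 0#
      4ββ̄ = begin
        4# * (β * bar β)  ≡⟨ solve 2 (λ a b → b := a :* a :- (a :* a :- b)) refl α (4# * (β * bar β)) ⟩
        α * α - disc α β  ≡⟨ cong₂ (λ a d → a * a - d) α≡0 disc≡0 ⟩
        0# * 0# - 0#  ≡⟨ solve 0 (:0 :* :0 :- :0 := :0) refl ⟩
        0#  ∎
      by-cases : Dec (β ≡ 0#) → β ≡ 0#
      by-cases (yes eq) = eq
      by-cases (no β≢0) = contradiction 4ββ̄ (*-nonzero 4≢0 (*-nonzero β≢0 (Bar.nonzero β≢0)))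

    module QuadraticRoots (d m e δ : Carrier) (d≢0 : d ≢ 0#) (d-real : bar d ≡ d) (m-real : bar m ≡ m)
      (δ²≡ : δ * δ ≡ m * m - 4# * (d * e)) where
      open ≡-Reasoning

      2d≢0 : 2# * d ≢ 0#
      2d≢0 = *-nonzero 2≢0 d≢0

      root : Carrier → Carrier
      root ε = (ε - m) * (2# * d) ⁻¹

      2d*root : ∀ ε → 2# * d * root ε ≡ ε - m
      2d*root ε = trans (solve 3 (λ a b c → a :* (b :* c) := b :* (a :* c)) refl (2# * d) (ε - m) _)
        (trans (cong ((ε - m) *_) (*-inverseʳ 2d≢0)) (*-identityʳ _))

      bar-root : ∀ ε → bar (root ε) ≡ root (bar ε)
      bar-root ε = trans (Bar.*-homo _ _) (cong₂ _*_ (trans (bar-- ε m) (cong (λ z → bar ε - z) m-real))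
        (trans (Bar.⁻¹-homo 2d≢0) (cong _⁻¹ (trans (Bar.2*-homo d) (cong (2# *_) d-real)))))

      root-nonzero : e ≢ 0# → ∀ {ε} → ε * ε ≡ δ * δ → root ε ≢ 0#
      root-nonzero e≢0 {ε} ε²≡δ² eq = *-nonzero 4≢0 (*-nonzero d≢0 e≢0) (begin
        4# * (d * e)  ≡⟨ solve 2 (λ m d → d := m :* m :- (m :* m :- d)) refl m (4# * (d * e)) ⟩
        m * m - (m * m - 4# * (d * e))  ≡⟨ cong (λ z → m * m - z) (trans (sym δ²≡) (trans (sym ε²≡δ²) (cong₂ _*_ ε≡m ε≡m))) ⟩
        m * m - m * m  ≡⟨ -‿inverseʳ _ ⟩
        0#  ∎)
        where
        ε≡m : ε ≡ m
        ε≡m = x-y≡0⇒x≡y (trans (sym (2d*root ε)) (trans (cong (2# * d *_) eq) (zeroʳ _)))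

      factored : ∀ z → d * (z * z) + m * z + e ≡ d * ((z - root δ) * (z - root (- δ)))
      factored z = *-cancelˡ (*-nonzero 4≢0 d≢0) (begin
        4# * d * (d * (z * z) + m * z + e)
          ≡⟨ solve 4 (λ d m e z → :4 :* d :* (d :* (z :* z) :+ m :* z :+ e)
               := (:2 :* d :* z :+ m) :* (:2 :* d :* z :+ m) :- (m :* m :- :4 :* (d :* e))) refl d m e z ⟩
        (2# * d * z + m) * (2# * d * z + m) - (m * m - 4# * (d * e))  ≡⟨ cong (λ w → (2# * d * z + m) * (2# * d * z + m) - w) δ²≡ ⟨
        (2# * d * z + m) * (2# * d * z + m) - δ * δ
          ≡⟨ solve 3 (λ y m d → (y :+ m) :* (y :+ m) :- d :* d := (y :- (d :- m)) :* (y :- (:- d :- m))) refl (2# * d * z) m δ ⟩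
        (2# * d * z - (δ - m)) * (2# * d * z - (- δ - m))  ≡⟨ cong₂ (λ u v → (2# * d * z - u) * (2# * d * z - v)) (2d*root δ) (2d*root (- δ)) ⟨
        (2# * d * z - 2# * d * root δ) * (2# * d * z - 2# * d * root (- δ))
          ≡⟨ solve 4 (λ d z u v → (:2 :* d :* z :- :2 :* d :* u) :* (:2 :* d :* z :- :2 :* d :* v)
               := :4 :* d :* (d :* ((z :- u) :* (z :- v)))) refl d z (root δ) (root (- δ)) ⟩
        4# * d * (d * ((z - root δ) * (z - root (- δ))))  ∎)

      roots-equal⇒δ≡0 : root δ ≡ root (- δ) → δ ≡ 0#
      roots-equal⇒δ≡0 eq = 2*-cancel (begin
        2# * δ  ≡⟨ solve 2 (λ d m → :2 :* d := (d :- m) :- (:- d :- m)) refl δ m ⟩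
        (δ - m) - (- δ - m)  ≡⟨ cong₂ _-_ (2d*root δ) (2d*root (- δ)) ⟨
        2# * d * root δ - 2# * d * root (- δ)  ≡⟨ x≡y⇒x-y≡0 (cong (2# * d *_) eq) ⟩
        0#  ≡⟨ zeroʳ 2# ⟨
        2# * 0#  ∎)

      roots-real-or-conjugate : bar e ≡ e → (bar (root δ) ≡ root δ × bar (root (- δ)) ≡ root (- δ)) ⊎ bar (root δ) ≡ root (- δ)
      roots-real-or-conjugate e-real with square-equal {bar δ} {δ} (trans (sym (Bar.*-homo δ δ)) (trans (cong bar δ²≡) (trans δ²-real (sym δ²≡))))
        where
        δ²-real : bar (m * m - 4# * (d * e)) ≡ m * m - 4# * (d * e)
        δ²-real = trans (bar-- _ _) (cong₂ _-_ (trans (Bar.*-homo m m) (cong₂ _*_ m-real m-real))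
          (trans (Bar.*-homo _ _) (cong₂ _*_ bar-4 (trans (Bar.*-homo _ _) (cong₂ _*_ d-real e-real)))))
      ... | inj₁ eq = inj₁ (trans (bar-root δ) (cong root eq) , trans (bar-root (- δ)) (cong root (trans (Bar.-homo δ) (cong -_ eq))))
      ... | inj₂ eq = inj₂ (trans (bar-root δ) (cong root eq))

      double-root : δ ≡ 0# → d * (root 0# * root 0#) + m * root 0# + e ≡ 0#
      double-root δ≡0 = trans (factored (root 0#)) (trans (cong (λ z → d * ((root 0# - root z) * (root 0# - root (- δ)))) δ≡0)
        (solve 3 (λ d u v → d :* ((u :- u) :* v) := :0) refl d (root 0#) (root 0# - root (- δ))))

    -- Pencils of quadratic forms

    module Pencil (αₐ βₐ αᵦ ββ : Carrier) (αₐ-real : bar αₐ ≡ αₐ) (αᵦ-real : bar αᵦ ≡ αᵦ) where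
      open ≡-Reasoning

      α⟨_⟩ β⟨_⟩ : Carrier → Carrier
      α⟨ z ⟩ = αₐ + z * αᵦ
      β⟨ z ⟩ = βₐ + z * ββ

      bar-β⟨⟩ : ∀ {z} → bar z ≡ z → bar β⟨ z ⟩ ≡ bar βₐ + z * bar ββ
      bar-β⟨⟩ z̄≡z = trans (Bar.+-homo _ _) (cong (bar βₐ +_) (trans (Bar.*-homo _ _) (cong (_* bar ββ) z̄≡z)))

      α⟨⟩-real : ∀ {z} → bar z ≡ z → bar α⟨ z ⟩ ≡ α⟨ z ⟩
      α⟨⟩-real z̄≡z = trans (Bar.+-homo _ _) (cong₂ _+_ αₐ-real (trans (Bar.*-homo _ _) (cong₂ _*_ z̄≡z αᵦ-real)))

      pencil-form : ∀ {z} → bar z ≡ z → ∀ x → form α⟨ z ⟩ β⟨ z ⟩ x ≡ form αₐ βₐ x + z * form αᵦ ββ x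
      pencil-form {z} z̄≡z x = trans (cong (λ b → α⟨ z ⟩ * (x * bar x) + (β⟨ z ⟩ * (x * x) + b * (bar x * bar x))) (bar-β⟨⟩ z̄≡z))
        (solve 10 (λ a b a′ b′ c c′ z p q r → (a :+ z :* a′) :* p :+ ((b :+ z :* b′) :* q :+ (c :+ z :* c′) :* r)
          := (a :* p :+ (b :* q :+ c :* r)) :+ z :* (a′ :* p :+ (b′ :* q :+ c′ :* r)))
          refl αₐ βₐ αᵦ ββ (bar βₐ) (bar ββ) z (x * bar x) (x * x) (bar x * bar x))

      -- The values of `disc` at the two forms and its polarisation `m` between them; together they
      -- are the coefficients of `disc` along the pencil.
      dₐ dᵦ m : Carrier
      dₐ = disc αₐ βₐ
      dᵦ = disc αᵦ ββ
      m = 2# * (αₐ * αᵦ) - 4# * (βₐ * bar ββ + bar βₐ * ββ)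

      m-real : bar m ≡ m
      m-real = begin
        bar m  ≡⟨ trans (bar-- _ _) (cong₂ _-_ (trans (Bar.2*-homo _) (cong (2# *_) (trans (Bar.*-homo _ _) (cong₂ _*_ αₐ-real αᵦ-real))))
                        (trans (Bar.*-homo _ _) (cong₂ _*_ bar-4 (trans (Bar.+-homo _ _) (cong₂ _+_
                          (trans (Bar.*-homo _ _) (cong (bar βₐ *_) (bar-involutive ββ))) (trans (Bar.*-homo _ _) (cong (_* bar ββ) (bar-involutive βₐ)))))))) ⟩
        2# * (αₐ * αᵦ) - 4# * (bar βₐ * ββ + βₐ * bar ββ)  ≡⟨ cong (λ z → 2# * (αₐ * αᵦ) - 4# * z) (+-comm _ _) ⟩
        m  ∎

      disc-pencil : ∀ {z} → bar z ≡ z → disc α⟨ z ⟩ β⟨ z ⟩ ≡ dᵦ * (z * z) + m * z + dₐ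
      disc-pencil {z} z̄≡z = trans (cong (λ b → α⟨ z ⟩ * α⟨ z ⟩ - 4# * (β⟨ z ⟩ * b)) (bar-β⟨⟩ z̄≡z))
        (solve 7 (λ a b a′ b′ c c′ z → (a :+ z :* a′) :* (a :+ z :* a′) :- :4 :* ((b :+ z :* b′) :* (c :+ z :* c′))
          := (a′ :* a′ :- :4 :* (b′ :* c′)) :* (z :* z)
             :+ (:2 :* (a :* a′) :- :4 :* (b :* c′ :+ c :* b′)) :* z
             :+ (a :* a :- :4 :* (b :* c)))
          refl αₐ βₐ αᵦ ββ (bar βₐ) (bar ββ) z)

      -- The derivative of disc α⟨ z ⟩ β⟨ z ⟩ vanishes at a double root.
      tangent : ∀ {u} → bar u ≡ u → 2# * dᵦ * u ≡ 0# - m → α⟨ u ⟩ * αᵦ ≡ 2# * (β⟨ u ⟩ * bar ββ + bar β⟨ u ⟩ * ββ)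
      tangent {u} ū≡u 2dᵦu = 2*-cancel (x-y≡0⇒x≡y (begin
        2# * (α⟨ u ⟩ * αᵦ) - 2# * (2# * (β⟨ u ⟩ * bar ββ + bar β⟨ u ⟩ * ββ))
          ≡⟨ cong (λ b → 2# * (α⟨ u ⟩ * αᵦ) - 2# * (2# * (β⟨ u ⟩ * bar ββ + b * ββ))) (bar-β⟨⟩ ū≡u) ⟩
        2# * (α⟨ u ⟩ * αᵦ) - 2# * (2# * (β⟨ u ⟩ * bar ββ + (bar βₐ + u * bar ββ) * ββ))
          ≡⟨ solve 7 (λ a b a′ b′ c c′ z → :2 :* ((a :+ z :* a′) :* a′) :- :2 :* (:2 :* ((b :+ z :* b′) :* c′ :+ (c :+ z :* c′) :* b′))
               := (:2 :* (a :* a′) :- :4 :* (b :* c′ :+ c :* b′))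
                  :+ :2 :* (a′ :* a′ :- :4 :* (b′ :* c′)) :* z)
             refl αₐ βₐ αᵦ ββ (bar βₐ) (bar ββ) u ⟩
        m + 2# * dᵦ * u  ≡⟨ cong (m +_) 2dᵦu ⟩
        m + (0# - m)  ≡⟨ solve 1 (λ m → m :+ (:0 :- m) := :0) refl m ⟩
        0#  ∎))

      -- If disc α⟨ z ⟩ β⟨ z ⟩, a quadratic polynomial in z, has distinct roots, the set T separates them; a double
      -- root u is a degenerate member of the pencil orthogonal to it, hence zero.
      proportional : RealSquareRoots → (T : Carrier → Set) → (∀ {z} → T z → bar z ≡ z) →
        (∀ {a u v} → a ≢ 0# → bar a ≡ a → u ≢ 0# → v ≢ 0# → (bar u ≡ u × bar v ≡ v) ⊎ bar u ≡ v →
          (∀ z → T z → ∃[ δ ] (bar δ ≡ δ × δ ≢ 0# × δ * δ ≡ a * ((z - u) * (z - v)))) → u ≡ v) →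
        (∀ {z} → T z → Anisotropic α⟨ z ⟩ β⟨ z ⟩) → (∀ x → x ≢ 0# → form αₐ βₐ x ≡ 0# → form αᵦ ββ x ≢ 0#) →
        dₐ ≢ 0# → dᵦ ≢ 0# → ∃[ u ] (bar u ≡ u × α⟨ u ⟩ ≡ 0# × β⟨ u ⟩ ≡ 0#)
      proportional sqrt T T-real T-separates aniso no-common dₐ≢0 dᵦ≢0 = from-δ (sqrt (m * m - 4# * (dᵦ * dₐ)) δ²-real)
        where
        dₐ-real : bar dₐ ≡ dₐ
        dₐ-real = disc-real αₐ-real
        dᵦ-real : bar dᵦ ≡ dᵦ
        dᵦ-real = disc-real αᵦ-real
        δ²-real : bar (m * m - 4# * (dᵦ * dₐ)) ≡ m * m - 4# * (dᵦ * dₐ)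
        δ²-real = trans (bar-- _ _) (cong₂ _-_ (trans (Bar.*-homo m m) (cong₂ _*_ m-real m-real))
          (trans (Bar.*-homo _ _) (cong₂ _*_ bar-4 (trans (Bar.*-homo _ _) (cong₂ _*_ dᵦ-real dₐ-real)))))
        finish : ∀ u → bar u ≡ u → disc α⟨ u ⟩ β⟨ u ⟩ ≡ 0# → 2# * dᵦ * u ≡ 0# - m → ∃[ u ] (bar u ≡ u × α⟨ u ⟩ ≡ 0# × β⟨ u ⟩ ≡ 0#)
        finish u ū≡u disc-u 2dᵦu = u , ū≡u , α≡0 , disc≡0-α≡0⇒β≡0 disc-u α≡0
          where
          common-zero-absurd : ∃[ e ] (e ≢ 0# × form α⟨ u ⟩ β⟨ u ⟩ e ≡ 0# × form αᵦ ββ e ≡ 0#) → ⊥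
          common-zero-absurd (e , e≢0 , eq , eqᵦ) = no-common e e≢0 (begin
            form αₐ βₐ e  ≡⟨ solve 2 (λ a u → a := a :+ u :* :0) refl (form αₐ βₐ e) u ⟩
            form αₐ βₐ e + u * 0#  ≡⟨ cong (λ z → form αₐ βₐ e + u * z) eqᵦ ⟨
            form αₐ βₐ e + u * form αᵦ ββ e  ≡⟨ pencil-form ū≡u e ⟨
            form α⟨ u ⟩ β⟨ u ⟩ e  ≡⟨ eq ⟩
            0#  ∎) eqᵦ
          by-cases : Dec (α⟨ u ⟩ ≡ 0#) → α⟨ u ⟩ ≡ 0#
          by-cases (yes eq) = eq
          by-cases (no α≢0) = ⊥-elim (common-zero-absurd (degenerate-orthogonal⇒common-zero (α⟨⟩-real ū≡u) disc-u (tangent ū≡u 2dᵦu) α≢0))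
          α≡0 : α⟨ u ⟩ ≡ 0#
          α≡0 = by-cases (α⟨ u ⟩ ≟ 0#)
        from-δ : ∃[ δ ] δ * δ ≡ m * m - 4# * (dᵦ * dₐ) → ∃[ u ] (bar u ≡ u × α⟨ u ⟩ ≡ 0# × β⟨ u ⟩ ≡ 0#)
        from-δ (δ , δ²≡) = finish (root 0#) u-real (trans (disc-pencil u-real) (double-root δ≡0)) (2d*root 0#)
          where
          open QuadraticRoots dᵦ m dₐ δ dᵦ≢0 dᵦ-real m-real δ²≡
          u-real : bar (root 0#) ≡ root 0#
          u-real = trans (bar-root 0#) (cong root Bar.0-homo)
          square : ∀ z → T z → ∃[ ε ] (bar ε ≡ ε × ε ≢ 0# × ε * ε ≡ dᵦ * ((z - root δ) * (z - root (- δ))))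
          square z tz =
            let ε , ε-real , ε≢0 , ε²≡ = anisotropic⇒disc-square sqrt (α⟨⟩-real (T-real tz)) (aniso tz)
            in ε , ε-real , ε≢0 , trans ε²≡ (trans (disc-pencil (T-real tz)) (factored z))
          δ≡0 : δ ≡ 0#
          δ≡0 = roots-equal⇒δ≡0 (T-separates dᵦ≢0 dᵦ-real (root-nonzero dₐ≢0 refl)
            (root-nonzero dₐ≢0 (solve 1 (λ d → (:- d) :* (:- d) := d :* d) refl δ)) (roots-real-or-conjugate dₐ-real) square)

-- Bilinear maps twisted by an automorphism

module PlanarMaps (K : FiniteField) where
  open FieldProperties K
  open Endomorphisms K

  -- The automorphism `φ` is abstract because it has two instances: `x ↦ x^Q`, and the identity when
  -- `k` divides `ℓ`.
  module WithAutomorphism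
    (2≢0 : 1# + 1# ≢ 0#)
    (bar : Carrier → Carrier) (bar-isEndo : IsEndomorphism bar) (bar-involutive : ∀ x → bar (bar x) ≡ x)
    (ι : Carrier) (ι≢0 : ι ≢ 0#) (bar-ι : bar ι ≡ - ι)
    (φ : Carrier → Carrier) (φ-isEndo : IsEndomorphism φ) (φ-bar : ∀ x → φ (bar x) ≡ bar (φ x)) where
    open QuadraticForms 2≢0 bar bar-isEndo bar-involutive ι ι≢0 bar-ι
    private
      module Bar = IsEndomorphism bar-isEndo
      module Φ = IsEndomorphism φ-isEndo

    φ-injective : ∀ {x y} → φ x ≡ φ y → x ≡ y
    φ-injective {x} {y} eq = x-y≡0⇒x≡y (Φ.zero⇒zero (trans (Φ.+-homo x (- y)) (trans (cong (φ x +_) (Φ.-homo y)) (x≡y⇒x-y≡0 eq))))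

    φ-surjective : ∀ y → ∃[ x ] φ x ≡ y
    φ-surjective = injective⇒surjective φ φ-injective

    φ-real : ∀ {x} → bar x ≡ x → bar (φ x) ≡ φ x
    φ-real {x} x̄≡x = trans (sym (φ-bar x)) (cong φ x̄≡x)

    φ-det : ∀ x y → φ (det x y) ≡ det (φ x) (φ y)
    φ-det x y = trans (Φ.+-homo _ _) (cong₂ _+_ (trans (Φ.*-homo _ _) (cong (φ x *_) (φ-bar y)))
      (trans (Φ.-homo _) (cong -_ (trans (Φ.*-homo _ _) (cong (_* φ y) (φ-bar x))))))

    φ-form : ∀ α β x → φ (form α β x) ≡ form (φ α) (φ β) (φ x)
    φ-form α β x = trans (Φ.+-homo _ _) (cong₂ _+_
      (trans (Φ.*-homo _ _) (cong (φ α *_) (trans (Φ.*-homo _ _) (cong (φ x *_) (φ-bar x)))))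
      (trans (Φ.+-homo _ _) (cong₂ _+_ (trans (Φ.*-homo _ _) (cong (φ β *_) (Φ.*-homo x x)))
        (trans (Φ.*-homo _ _) (cong₂ _*_ (φ-bar β) (trans (Φ.*-homo _ _) (cong₂ _*_ (φ-bar x) (φ-bar x))))))))

    F : Coeffs → Carrier → Carrier
    F c x = B c (φ x) x

    D : Coeffs → Carrier → Carrier → Carrier
    D c a x = B c (φ a) x + B c (φ x) a

    F-+ : ∀ c a x → F c (a + x) ≡ F c a + F c x + D c a x
    F-+ c a x = begin
      B c (φ (a + x)) (a + x)  ≡⟨ cong (λ s → B c s (a + x)) (Φ.+-homo a x) ⟩
      B c (φ a + φ x) (a + x)  ≡⟨ trans (B-+ˡ c (φ a) (φ x) _) (cong₂ _+_ (B-+ʳ c (φ a) a x) (B-+ʳ c (φ x) a x)) ⟩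
      (B c (φ a) a + B c (φ a) x) + (B c (φ x) a + B c (φ x) x)
        ≡⟨ solve 4 (λ p q r s → (p :+ q) :+ (r :+ s) := p :+ s :+ (q :+ r)) refl (B c (φ a) a) (B c (φ a) x) (B c (φ x) a) (B c (φ x) x) ⟩
      F c a + F c x + D c a x  ∎
      where open ≡-Reasoning

    D-+ʳ : ∀ c a x y → D c a (x + y) ≡ D c a x + D c a y
    D-+ʳ c a x y = trans (cong₂ _+_ (B-+ʳ c (φ a) x y) (trans (cong (λ s → B c s a) (Φ.+-homo x y)) (B-+ˡ c (φ x) (φ y) a)))
      (solve 4 (λ p q r s → (p :+ q) :+ (r :+ s) := (p :+ r) :+ (q :+ s)) refl (B c (φ a) x) (B c (φ a) y) (B c (φ x) a) (B c (φ y) a))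

    D-self : ∀ c a s → bar s ≡ s → D c a (s * a) ≡ (s + φ s) * F c a
    D-self c a s s̄≡s = trans (cong₂ _+_ (B-*ʳ c (φ a) s a s̄≡s)
      (trans (cong (λ t → B c t a) (Φ.*-homo s a)) (B-*ˡ c (φ a) (φ s) a (φ-real s̄≡s))))
      (sym (distribʳ (F c a) s (φ s)))

    -- This expresses planarity of `F c`: up to a constant, the difference map in direction `a` is
    -- the additive map `D c a`, which is bijective if and only if its kernel is trivial.
    NonDegenerate : Coeffs → Set
    NonDegenerate c = ∀ a x → a ≢ 0# → D c a x ≡ 0# → x ≡ 0#

    -- It holds for `x ↦ x^Q` when `k / gcd k ℓ` is odd, and for the identity because 2 is
    -- invertible.
    TraceSurjective : Set
    TraceSurjective = ∀ z → bar z ≡ z → ∃[ s ] (bar s ≡ s × s + φ s ≡ z)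

    F≢0 : ∀ {c} → NonDegenerate c → ∀ {a} → a ≢ 0# → F c a ≢ 0#
    F≢0 {c} nd {a} a≢0 Fa≡0 = a≢0 (nd a a a≢0 (trans (cong₂ _+_ Fa≡0 Fa≡0) (+-identityˡ 0#)))

    -- Take x₀ with det a x₀ = y. The hypothesis makes D c a x₀ an ℱ_q-multiple of F c a, and moving x₀ along
    -- the line ℱ_q a changes D c a x₀ by any prescribed such multiple.
    nonvanishing : ∀ {c} → NonDegenerate c → TraceSurjective → ∀ {a y} → a ≢ 0# → y ≢ 0# → bar y ≡ - y →
      q₁ c (φ a) * y + q₁ (swap c) a * φ y ≢ 0#
    nonvanishing {c} nd surj {a} {y} a≢0 y≢0 ȳ≡-y eq = y≢0 (begin
      y  ≡⟨ det-x₀ ⟨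
      det a x₀  ≡⟨ cong (det a) x₀≡-sa ⟩
      det a (- s * a)  ≡⟨ det-real (trans (Bar.-homo s) (cong -_ s̄≡s)) ⟩
      - s * det a a  ≡⟨ trans (cong (- s *_) (det-self a)) (zeroʳ _) ⟩
      0#  ∎)
      where
      open ≡-Reasoning
      2ā = 2# * bar a
      2ā≢0 : 2ā ≢ 0#
      2ā≢0 = *-nonzero 2≢0 (Bar.nonzero a≢0)
      -- As `y` is skew, this choice gives `ā x₀ = - y / 2` and `a x̄₀ = y / 2`, hence
      -- `det a x₀ = y`.
      x₀ = - (y * 2ā ⁻¹)
      2āx₀ : 2# * (bar a * x₀) ≡ - y
      2āx₀ = begin
        2# * (bar a * - (y * 2ā ⁻¹))  ≡⟨ solve 3 (λ a y i → :2 :* (a :* (:- (y :* i))) := :- (y :* (:2 :* a :* i))) refl (bar a) y (2ā ⁻¹) ⟩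
        - (y * (2ā * 2ā ⁻¹))  ≡⟨ cong (λ z → - (y * z)) (*-inverseʳ 2ā≢0) ⟩
        - (y * 1#)  ≡⟨ cong -_ (*-identityʳ y) ⟩
        - y  ∎
      2ax̄₀ : 2# * (a * bar x₀) ≡ y
      2ax̄₀ = begin
        2# * (a * bar x₀)  ≡⟨ cong (λ z → 2# * (z * bar x₀)) (bar-involutive a) ⟨
        2# * (bar (bar a) * bar x₀)  ≡⟨ trans (Bar.2*-homo _) (cong (2# *_) (Bar.*-homo _ _)) ⟨
        bar (2# * (bar a * x₀))  ≡⟨ cong bar 2āx₀ ⟩
        bar (- y)  ≡⟨ trans (Bar.-homo y) (trans (cong -_ ȳ≡-y) (-‿involutive y)) ⟩
        y  ∎
      det-x₀ : det a x₀ ≡ y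
      det-x₀ = 2*-cancel (begin
        2# * (a * bar x₀ - bar a * x₀)  ≡⟨ solve 2 (λ p q → :2 :* (p :- q) := :2 :* p :- :2 :* q) refl (a * bar x₀) (bar a * x₀) ⟩
        2# * (a * bar x₀) - 2# * (bar a * x₀)  ≡⟨ cong₂ _-_ 2ax̄₀ 2āx₀ ⟩
        y - - y  ≡⟨ solve 1 (λ y → y :- :- y := :2 :* y) refl y ⟩
        2# * y  ∎)
      det-D : det (F c a) (D c a x₀) ≡ 0#
      det-D = begin
        det (F c a) (D c a x₀)
          ≡⟨ trans (cong (λ z → F c a * z - bar (F c a) * D c a x₀) (Bar.+-homo _ _))
               (solve 6 (λ f f̄ u ū v v̄ → f :* (ū :+ v̄) :- f̄ :* (u :+ v) := (f :* ū :- f̄ :* u) :+ (f :* v̄ :- f̄ :* v)) refl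
                 (F c a) (bar (F c a)) (B c (φ a) x₀) (bar (B c (φ a) x₀)) (B c (φ x₀) a) (bar (B c (φ x₀) a))) ⟩
        det (F c a) (B c (φ a) x₀) + det (F c a) (B c (φ x₀) a)
          ≡⟨ cong₂ _+_ (det-B₁ c (φ a) a x₀) (det-B₂ c (φ a) (φ x₀) a) ⟩
        q₁ c (φ a) * det a x₀ + q₁ (swap c) a * det (φ a) (φ x₀)
          ≡⟨ cong₂ (λ u v → q₁ c (φ a) * u + q₁ (swap c) a * v) det-x₀ (trans (sym (φ-det a x₀)) (cong φ det-x₀)) ⟩
        q₁ c (φ a) * y + q₁ (swap c) a * φ y  ≡⟨ eq ⟩
        0#  ∎
      multiple = det≡0⇒proportional (F≢0 nd a≢0) det-D
      r = proj₁ multiple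
      r̄≡r = proj₁ (proj₂ multiple)
      shift = surj (- r) (trans (Bar.-homo r) (cong -_ r̄≡r))
      s = proj₁ shift
      s̄≡s = proj₁ (proj₂ shift)
      x₀+sa≡0 : x₀ + s * a ≡ 0#
      x₀+sa≡0 = nd a (x₀ + s * a) a≢0 (begin
        D c a (x₀ + s * a)  ≡⟨ D-+ʳ c a x₀ (s * a) ⟩
        D c a x₀ + D c a (s * a)  ≡⟨ cong₂ _+_ (proj₂ (proj₂ multiple)) (D-self c a s s̄≡s) ⟩
        r * F c a + (s + φ s) * F c a  ≡⟨ cong (λ z → r * F c a + z * F c a) (proj₂ (proj₂ shift)) ⟩
        r * F c a + - r * F c a  ≡⟨ solve 2 (λ r f → r :* f :+ :- r :* f := :0) refl r (F c a) ⟩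
        0#  ∎)
      x₀≡-sa : x₀ ≡ - s * a
      x₀≡-sa = trans (x+y≡0⇒x≡-y x₀+sa≡0) (-‿distribˡ-* s a)

    no-common-zero : ∀ {c} → NonDegenerate c → TraceSurjective → ∀ {a} → a ≢ 0# → q₁ c (φ a) ≡ 0# → q₁ (swap c) a ≢ 0#
    no-common-zero {c} nd surj {a} a≢0 eq₁ eq₂ = nonvanishing nd surj a≢0 ι≢0 bar-ι
      (trans (cong₂ (λ u v → u * ι + v * φ ι) eq₁ eq₂) (solve 2 (λ x y → :0 :* x :+ :0 :* y := :0) refl ι (φ ι)))

    -- The degenerate case

    Δ : Coeffs → Carrier
    Δ c = disc (α₁ c) (β₁ c)

    record DegenerateNormalForm (c : Coeffs) : Set where
      field
        e₁ e₂ b₁ b₂ ε : Carrier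
        e-independent : det e₁ e₂ ≢ 0#
        b-independent : det b₁ b₂ ≢ 0#
        ε-real : bar ε ≡ ε
        ε≢0 : ε ≢ 0#
        ε-nonsquare : ∀ z → bar z ≡ z → z * z ≢ ε
        F-formula : ∀ x y → bar x ≡ x → bar y ≡ y →
          F c (x * e₁ + y * e₂) ≡ (φ x * y) * b₁ + (φ x * x + ε * (φ y * y)) * b₂

    form-+ : ∀ α β x y → form α β (x + y) ≡ form α β x + polar α β x y + form α β y
    form-+ α β x y = trans (cong (λ z → α * ((x + y) * z) + (β * ((x + y) * (x + y)) + bar β * (z * z))) (Bar.+-homo x y))
      (solve 7 (λ α β β̄ x y x̄ ȳ → α :* ((x :+ y) :* (x̄ :+ ȳ)) :+ (β :* ((x :+ y) :* (x :+ y)) :+ β̄ :* ((x̄ :+ ȳ) :* (x̄ :+ ȳ)))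
         := (α :* (x :* x̄) :+ (β :* (x :* x) :+ β̄ :* (x̄ :* x̄))) :+ (α :* (x :* ȳ :+ x̄ :* y) :+ :2 :* (β :* (x :* y) :+ β̄ :* (x̄ :* ȳ)))
            :+ (α :* (y :* ȳ) :+ (β :* (y :* y) :+ β̄ :* (ȳ :* ȳ))))
       refl α β (bar β) x y (bar x) (bar y))

    form-real : ∀ α β r x → bar r ≡ r → form α β (r * x) ≡ r * r * form α β x
    form-real α β r x r̄≡r = trans (cong (λ z → α * (r * x * z) + (β * (r * x * (r * x)) + bar β * (z * z))) (trans (Bar.*-homo r x) (cong (_* bar x) r̄≡r)))
      (solve 6 (λ α β β̄ r x x̄ → α :* (r :* x :* (r :* x̄)) :+ (β :* (r :* x :* (r :* x)) :+ β̄ :* (r :* x̄ :* (r :* x̄)))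
         := r :* r :* (α :* (x :* x̄) :+ (β :* (x :* x) :+ β̄ :* (x̄ :* x̄)))) refl α β (bar β) r x (bar x))

    polar-real : ∀ α β x r y → bar r ≡ r → polar α β x (r * y) ≡ r * polar α β x y
    polar-real α β x r y r̄≡r = trans (cong (λ z → α * (x * z + bar x * (r * y)) + 2# * (β * (x * (r * y)) + bar β * (bar x * z))) (trans (Bar.*-homo r y) (cong (_* bar y) r̄≡r)))
      (solve 8 (λ α β β̄ r x x̄ y ȳ → α :* (x :* (r :* ȳ) :+ x̄ :* (r :* y)) :+ :2 :* (β :* (x :* (r :* y)) :+ β̄ :* (x̄ :* (r :* ȳ)))
         := r :* (α :* (x :* ȳ :+ x̄ :* y) :+ :2 :* (β :* (x :* y) :+ β̄ :* (x̄ :* ȳ)))) refl α β (bar β) r x (bar x) y (bar y))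

    polar-sym : ∀ α β x y → polar α β x y ≡ polar α β y x
    polar-sym α β x y = solve 7 (λ α β β̄ x x̄ y ȳ → α :* (x :* ȳ :+ x̄ :* y) :+ :2 :* (β :* (x :* y) :+ β̄ :* (x̄ :* ȳ))
         := α :* (y :* x̄ :+ ȳ :* x) :+ :2 :* (β :* (y :* x) :+ β̄ :* (ȳ :* x̄))) refl α β (bar β) x (bar x) y (bar y)

    polar-radical⇒form-+ : ∀ {α β e} → (∀ y → polar α β e y ≡ 0#) → ∀ x r → bar r ≡ r → form α β (x + r * e) ≡ form α β x
    polar-radical⇒form-+ {α} {β} {e} rad x r r̄≡r = begin
      form α β (x + r * e)  ≡⟨ form-+ α β x (r * e) ⟩
      form α β x + polar α β x (r * e) + form α β (r * e)
        ≡⟨ cong₂ (λ u v → form α β x + u + v) (trans (polar-real α β x r e r̄≡r) (cong (r *_) (trans (polar-sym α β x e) (rad x))))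
             (trans (form-real α β r e r̄≡r) (cong (r * r *_) (polar≡0⇒form≡0 (rad e)))) ⟩
      form α β x + r * 0# + r * r * 0#  ≡⟨ solve 2 (λ f r → f :+ r :* :0 :+ r :* r :* :0 := f) refl (form α β x) r ⟩
      form α β x  ∎
      where open ≡-Reasoning

    -- Here `e₁` spans the radical of `q₁ (swap c)` and `s₂ = φ e₂` that of `q₁ c`. In these
    -- coordinates `B c` is given by four values: `B₂₁` vanishes and `B₂₂` is a multiple `ε` of
    -- `B₁₁`, which is the shape of `P2` with target basis `B₁₂`, `B₁₁`.
    degenerate⇒normalForm : ∀ {c} → NonDegenerate c → TraceSurjective → Δ c ≡ 0# → DegenerateNormalForm c
    degenerate⇒normalForm {c} nd surj Δ≡0 = record
      { e₁ = e₁ ; e₂ = e₂ ; b₁ = B₁₂ ; b₂ = B₁₁ ; ε = ε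
      ; e-independent = h≢0
      ; b-independent = λ eq → g≢0 (trans (det-antisym B₁₂ B₁₁) (trans (cong -_ eq) -0#≈0#))
      ; ε-real = ε-real ; ε≢0 = ε≢0 ; ε-nonsquare = nonsquare
      ; F-formula = formula }
      where
      open ≡-Reasoning
      c′ = swap c
      rad₂ = radical {α₁ c′} {β₁ c′} (bar-α₁ c′) (trans (sym (disc-swap c)) Δ≡0)
      e₁ = proj₁ rad₂
      e₁≢0 = proj₁ (proj₂ rad₂)
      polar-e₁ = proj₂ (proj₂ rad₂)
      rad₁ = radical {α₁ c} {β₁ c} (bar-α₁ c) Δ≡0
      s₂ = proj₁ rad₁
      polar-s₂ = proj₂ (proj₂ rad₁)
      e₂ = proj₁ (φ-surjective s₂)
      φe₂ : φ e₂ ≡ s₂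
      φe₂ = proj₂ (φ-surjective s₂)
      e₂≢0 : e₂ ≢ 0#
      e₂≢0 eq = proj₁ (proj₂ rad₁) (trans (sym φe₂) (trans (cong φ eq) Φ.0-homo))
      s₁ = φ e₁
      B₁₁ = B c s₁ e₁
      B₁₂ = B c s₁ e₂
      B₂₁ = B c s₂ e₁
      B₂₂ = B c s₂ e₂
      q₂e₁ : q₁ c′ e₁ ≡ 0#
      q₂e₁ = polar≡0⇒form≡0 (polar-e₁ e₁)
      q₁s₂ : q₁ c s₂ ≡ 0#
      q₁s₂ = polar≡0⇒form≡0 (polar-s₂ s₂)
      h = det e₁ e₂
      h≢0 : h ≢ 0#
      h≢0 h≡0 = let r , r̄≡r , e₂≡re₁ = det≡0⇒proportional e₁≢0 h≡0 in
        no-common-zero nd surj e₂≢0 (trans (cong (q₁ c) φe₂) q₁s₂)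
          (trans (cong (q₁ c′) e₂≡re₁) (trans (form-real _ _ r e₁ r̄≡r) (trans (cong (r * r *_) q₂e₁) (zeroʳ _))))
      q₁s₁≢0 : q₁ c s₁ ≢ 0#
      q₁s₁≢0 eq = no-common-zero nd surj e₁≢0 eq q₂e₁
      g = det B₁₁ B₁₂
      g-formula : g ≡ q₁ c s₁ * h
      g-formula = det-B₁ c s₁ e₁ e₂
      g≢0 : g ≢ 0#
      g≢0 eq = *-nonzero q₁s₁≢0 h≢0 (trans (sym g-formula) eq)
      -- Each of the two radicals gives one linear relation between these two determinants; the
      -- relations are independent because 2 is invertible.
      cross₁ : det B₁₁ B₂₂ - det B₁₂ B₂₁ ≡ 0#
      cross₁ = begin
        det B₁₁ B₂₂ - det B₁₂ B₂₁  ≡⟨ cong (det B₁₁ B₂₂ +_) (det-antisym B₁₂ B₂₁) ⟨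
        det B₁₁ B₂₂ + det B₂₁ B₁₂  ≡⟨ det-B c s₁ s₂ e₁ e₂ ⟩
        polar (α₁ c) (β₁ c) s₁ s₂ * h  ≡⟨ cong (_* h) (trans (polar-sym (α₁ c) (β₁ c) s₁ s₂) (polar-s₂ s₁)) ⟩
        0# * h  ≡⟨ zeroˡ h ⟩
        0#  ∎
      cross₂ : det B₁₁ B₂₂ + det B₁₂ B₂₁ ≡ 0#
      cross₂ = begin
        det B₁₁ B₂₂ + det B₁₂ B₂₁
          ≡⟨ cong₂ _+_ (cong₂ det (B-swap c s₁ e₁) (B-swap c s₂ e₂)) (cong₂ det (B-swap c s₁ e₂) (B-swap c s₂ e₁)) ⟩
        det (B c′ e₁ s₁) (B c′ e₂ s₂) + det (B c′ e₂ s₁) (B c′ e₁ s₂)  ≡⟨ det-B c′ e₁ e₂ s₁ s₂ ⟩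
        polar (α₁ c′) (β₁ c′) e₁ e₂ * det s₁ s₂  ≡⟨ cong (_* det s₁ s₂) (polar-e₁ e₂) ⟩
        0# * det s₁ s₂  ≡⟨ zeroˡ _ ⟩
        0#  ∎
      det-B₁₁B₂₂ : det B₁₁ B₂₂ ≡ 0#
      det-B₁₁B₂₂ = no-zero-divisors (begin
        2# * det B₁₁ B₂₂  ≡⟨ solve 2 (λ p q → :2 :* p := (p :- q) :+ (p :+ q)) refl (det B₁₁ B₂₂) (det B₁₂ B₂₁) ⟩
        (det B₁₁ B₂₂ - det B₁₂ B₂₁) + (det B₁₁ B₂₂ + det B₁₂ B₂₁) ≡⟨ cong₂ _+_ cross₁ cross₂ ⟩
        0# + 0#  ≡⟨ +-identityˡ 0# ⟩
        0#  ∎) 2≢0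
      det-B₁₂B₂₁ : det B₁₂ B₂₁ ≡ 0#
      det-B₁₂B₂₁ = trans (sym (+-identityˡ _)) (trans (cong (_+ det B₁₂ B₂₁) (sym det-B₁₁B₂₂)) cross₂)
      B₁₁≢0 : B₁₁ ≢ 0#
      B₁₁≢0 = F≢0 nd e₁≢0
      -- `B₂₁` is a multiple of `B₁₁` because `e₁` is a zero of `q₁ (swap c)`, and it has
      -- determinant zero with `B₁₂`, which is independent of `B₁₁`.
      B₂₁≡0 : B₂₁ ≡ 0#
      B₂₁≡0 = let r , r̄≡r , B₂₁≡rB₁₁ = det≡0⇒proportional B₁₁≢0 (trans (det-B₂ c s₁ s₂ e₁) (trans (cong (_* det s₁ s₂) q₂e₁) (zeroˡ _))) in
        trans B₂₁≡rB₁₁ (trans (cong (_* B₁₁) (no-zero-divisors {x = - g} (begin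
          - g * r  ≡⟨ *-comm _ _ ⟩
          r * - g  ≡⟨ cong (r *_) (det-antisym B₁₁ B₁₂) ⟨
          r * det B₁₂ B₁₁  ≡⟨ det-real r̄≡r ⟨
          det B₁₂ (r * B₁₁)  ≡⟨ cong (det B₁₂) B₂₁≡rB₁₁ ⟨
          det B₁₂ B₂₁  ≡⟨ det-B₁₂B₂₁ ⟩
          0#  ∎) (-‿nonzero g≢0))) (zeroˡ B₁₁))
      multiple = det≡0⇒proportional B₁₁≢0 det-B₁₁B₂₂
      ε = proj₁ multiple
      ε-real = proj₁ (proj₂ multiple)
      B₂₂≡εB₁₁ : B₂₂ ≡ ε * B₁₁
      B₂₂≡εB₁₁ = proj₂ (proj₂ multiple)
      ε≢0 : ε ≢ 0#
      ε≢0 ε≡0 = F≢0 nd e₂≢0 (trans (cong (λ s → B c s e₂) φe₂) (trans B₂₂≡εB₁₁ (trans (cong (_* B₁₁) ε≡0) (zeroˡ B₁₁))))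
      formula : ∀ x y → bar x ≡ x → bar y ≡ y → F c (x * e₁ + y * e₂) ≡ (φ x * y) * B₁₂ + (φ x * x + ε * (φ y * y)) * B₁₁
      formula x y x̄≡x ȳ≡y = begin
        B c (φ (x * e₁ + y * e₂)) (x * e₁ + y * e₂)
          ≡⟨ cong (λ s → B c s (x * e₁ + y * e₂)) (trans (Φ.+-homo _ _) (cong₂ _+_ (Φ.*-homo x e₁) (trans (Φ.*-homo y e₂) (cong (φ y *_) φe₂)))) ⟩
        B c (φ x * s₁ + φ y * s₂) (x * e₁ + y * e₂)
          ≡⟨ trans (B-+ˡ c _ _ _) (cong₂ _+_ (left x s₁ x̄≡x) (left y s₂ ȳ≡y)) ⟩
        φ x * (x * B₁₁ + y * B₁₂) + φ y * (x * B₂₁ + y * B₂₂)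
          ≡⟨ cong₂ (λ u v → φ x * (x * B₁₁ + y * B₁₂) + φ y * (x * u + y * v)) B₂₁≡0 B₂₂≡εB₁₁ ⟩
        φ x * (x * B₁₁ + y * B₁₂) + φ y * (x * 0# + y * (ε * B₁₁))
          ≡⟨ solve 7 (λ p q x y e b d → p :* (x :* b :+ y :* d) :+ q :* (x :* :0 :+ y :* (e :* b))
               := (p :* y) :* d :+ (p :* x :+ e :* (q :* y)) :* b) refl (φ x) (φ y) x y ε B₁₁ B₁₂ ⟩
        (φ x * y) * B₁₂ + (φ x * x + ε * (φ y * y)) * B₁₁  ∎
        where
        left : ∀ r s → bar r ≡ r → B c (φ r * s) (x * e₁ + y * e₂) ≡ φ r * (x * B c s e₁ + y * B c s e₂)
        left r s r̄≡r = trans (B-*ˡ c s (φ r) _ (φ-real r̄≡r)) (cong (φ r *_)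
          (trans (B-+ʳ c s _ _) (cong₂ _+_ (B-*ʳ c s x e₁ x̄≡x) (B-*ʳ c s y e₂ ȳ≡y))))
      -- If ε = z², the vector e₁ + z⁻¹ e₂ violates nonvanishing.
      nonsquare : ∀ z → bar z ≡ z → z * z ≢ ε
      nonsquare z z̄≡z z²≡ε = nonvanishing nd surj a≢0 h≢0 (bar-det e₁ e₂) (begin
        q₁ c (φ a) * h + q₁ c′ a * φ h  ≡⟨ cong₂ (λ u v → u * h + v * φ h) q₁φa q₂a ⟩
        q₁ c s₁ * h + ζ * ζ * q₁ c′ e₂ * φ h  ≡⟨ cong₂ _+_ (sym g-formula) (*-assoc _ _ _) ⟩
        g + ζ * ζ * (q₁ c′ e₂ * φ h)  ≡⟨ cong (λ u → g + ζ * ζ * u) q₂e₂ ⟩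
        g + ζ * ζ * (z * z * - g)  ≡⟨ solve 3 (λ g ζ z → g :+ ζ :* ζ :* (z :* z :* :- g) := g :- (z :* ζ) :* (z :* ζ) :* g) refl g ζ z ⟩
        g - (z * ζ) * (z * ζ) * g  ≡⟨ cong (λ u → g - u * u * g) (*-inverseʳ z≢0) ⟩
        g - 1# * 1# * g  ≡⟨ solve 1 (λ g → g :- :1 :* :1 :* g := :0) refl g ⟩
        0#  ∎)
        where
        z≢0 : z ≢ 0#
        z≢0 z≡0 = ε≢0 (trans (sym z²≡ε) (trans (cong (_* z) z≡0) (zeroˡ z)))
        ζ = z ⁻¹
        ζ̄≡ζ : bar ζ ≡ ζ
        ζ̄≡ζ = trans (Bar.⁻¹-homo z≢0) (cong _⁻¹ z̄≡z)
        a = e₁ + ζ * e₂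
        a≢0 : a ≢ 0#
        a≢0 a≡0 = h≢0 (begin
          det e₁ e₂  ≡⟨ det-antisym e₂ e₁ ⟩
          - det e₂ e₁  ≡⟨ cong (λ x → - det e₂ x) (trans (x+y≡0⇒x≡-y a≡0) (-‿distribˡ-* ζ e₂)) ⟩
          - det e₂ (- ζ * e₂)  ≡⟨ cong -_ (det-real (trans (Bar.-homo ζ) (cong -_ ζ̄≡ζ))) ⟩
          - (- ζ * det e₂ e₂)  ≡⟨ cong (λ x → - (- ζ * x)) (det-self e₂) ⟩
          - (- ζ * 0#)  ≡⟨ trans (cong -_ (zeroʳ _)) -0#≈0# ⟩
          0#  ∎)
        q₁φa : q₁ c (φ a) ≡ q₁ c s₁
        q₁φa = trans (cong (q₁ c) (trans (Φ.+-homo _ _) (cong (s₁ +_) (trans (Φ.*-homo ζ e₂) (cong (φ ζ *_) φe₂)))))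
          (polar-radical⇒form-+ polar-s₂ s₁ (φ ζ) (φ-real ζ̄≡ζ))
        q₂a : q₁ c′ a ≡ ζ * ζ * q₁ c′ e₂
        q₂a = begin
          q₁ c′ (e₁ + ζ * e₂)  ≡⟨ cong (q₁ c′) (trans (+-comm _ _) (cong (ζ * e₂ +_) (sym (*-identityˡ e₁)))) ⟩
          q₁ c′ (ζ * e₂ + 1# * e₁)  ≡⟨ polar-radical⇒form-+ polar-e₁ (ζ * e₂) 1# Bar.1-homo ⟩
          q₁ c′ (ζ * e₂)  ≡⟨ form-real _ _ ζ e₂ ζ̄≡ζ ⟩
          ζ * ζ * q₁ c′ e₂  ∎
        q₂e₂ : q₁ c′ e₂ * φ h ≡ z * z * - g
        q₂e₂ = begin
          q₁ c′ e₂ * φ h  ≡⟨ cong (q₁ c′ e₂ *_) (trans (φ-det e₁ e₂) (cong (det s₁) φe₂)) ⟩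
          q₁ c′ e₂ * det s₁ s₂  ≡⟨ det-B₂ c s₁ s₂ e₂ ⟨
          det B₁₂ B₂₂  ≡⟨ cong (det B₁₂) B₂₂≡εB₁₁ ⟩
          det B₁₂ (ε * B₁₁)  ≡⟨ det-real ε-real ⟩
          ε * det B₁₂ B₁₁  ≡⟨ cong₂ _*_ (sym z²≡ε) (det-antisym B₁₁ B₁₂) ⟩
          z * z * - g  ∎

    -- Linear substitutions and reduction to two terms

    -- The coefficients of `B c s (L μ x)`; `left` does the same for the first argument, and
    -- `transform` for `F c ∘ L μ`.
    right : Coeffs → Carrier → Coeffs
    right (c₀ , c₁ , c₂ , c₃) μ = c₀ + c₁ * μ , c₁ + c₀ * bar μ , c₂ + c₃ * μ , c₃ + c₂ * bar μ

    left : Coeffs → Carrier → Coeffs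
    left c ν = swap (right (swap c) ν)

    L : Carrier → Carrier → Carrier
    L μ x = x + μ * bar x

    bar-L : ∀ μ x → bar (L μ x) ≡ bar x + bar μ * x
    bar-L μ x = trans (Bar.+-homo _ _) (cong (bar x +_) (trans (Bar.*-homo _ _) (cong (bar μ *_) (bar-involutive x))))

    L-+ : ∀ μ x y → L μ (x + y) ≡ L μ x + L μ y
    L-+ μ x y = trans (cong (λ z → x + y + μ * z) (Bar.+-homo x y))
      (solve 5 (λ μ x y x̄ ȳ → x :+ y :+ μ :* (x̄ :+ ȳ) := (x :+ μ :* x̄) :+ (y :+ μ :* ȳ)) refl μ x y (bar x) (bar y))

    φ-L : ∀ μ x → φ (L μ x) ≡ L (φ μ) (φ x)
    φ-L μ x = trans (Φ.+-homo _ _) (cong (φ x +_) (trans (Φ.*-homo _ _) (cong (φ μ *_) (φ-bar x))))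

    -- `L μ` has determinant `1 - N μ` over ℱ_q.
    L-nonzero : ∀ {μ x} → N μ ≢ 1# → x ≢ 0# → L μ x ≢ 0#
    L-nonzero {μ} {x} Nμ≢1 x≢0 eq = Nμ≢1 (*-cancelʳ (*-nonzero x≢0 (Bar.nonzero x≢0)) (begin
      μ * bar μ * (x * bar x)  ≡⟨ solve 4 (λ m n x y → m :* n :* (x :* y) := (:- (m :* y)) :* (:- (n :* x))) refl μ (bar μ) x (bar x) ⟩
      - (μ * bar x) * - (bar μ * x)  ≡⟨ cong₂ _*_ (x+y≡0⇒x≡-y eq) (x+y≡0⇒x≡-y (trans (sym (bar-L μ x)) (trans (cong bar eq) Bar.0-homo))) ⟨
      x * bar x  ≡⟨ *-identityˡ _ ⟨
      1# * (x * bar x)  ∎))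
      where open ≡-Reasoning

    B-right : ∀ c μ s x → B (right c μ) s x ≡ B c s (L μ x)
    B-right (c₀ , c₁ , c₂ , c₃) μ s x = sym (trans (cong (λ z → (c₃ * s + c₁ * bar s) * L μ x + (c₂ * s + c₀ * bar s) * z) (bar-L μ x))
      (solve 10 (λ c₀ c₁ c₂ c₃ s s̄ x x̄ μ ν →
        (c₃ :* s :+ c₁ :* s̄) :* (x :+ μ :* x̄) :+ (c₂ :* s :+ c₀ :* s̄) :* (x̄ :+ ν :* x)
        := ((c₃ :+ c₂ :* ν) :* s :+ (c₁ :+ c₀ :* ν) :* s̄) :* x :+ ((c₂ :+ c₃ :* μ) :* s :+ (c₀ :+ c₁ :* μ) :* s̄) :* x̄)
        refl c₀ c₁ c₂ c₃ s (bar s) x (bar x) μ (bar μ)))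

    B-left : ∀ c ν s x → B (left c ν) s x ≡ B c (L ν s) x
    B-left c ν s x = trans (B-swap (left c ν) s x) (trans (B-right (swap c) ν x s) (sym (B-swap c (L ν s) x)))

    transform : Coeffs → Carrier → Coeffs
    transform c μ = left (right c μ) (φ μ)

    F-transform : ∀ c μ x → F (transform c μ) x ≡ F c (L μ x)
    F-transform c μ x = trans (B-left (right c μ) (φ μ) (φ x) x) (trans (B-right c μ (L (φ μ) (φ x)) x)
      (cong (λ s → B c s (L μ x)) (sym (φ-L μ x))))

    D≡F : ∀ c a x → D c a x ≡ F c (a + x) - F c a - F c x
    D≡F c a x = sym (trans (cong (λ z → z - F c a - F c x) (F-+ c a x))
      (solve 3 (λ p q r → p :+ q :+ r :- p :- q := r) refl (F c a) (F c x) (D c a x)))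

    NonDegenerate-transform : ∀ {c μ} → N μ ≢ 1# → NonDegenerate c → NonDegenerate (transform c μ)
    NonDegenerate-transform {c} {μ} Nμ≢1 nd a x a≢0 eq = case x ≟ 0# of λ
      { (yes x≡0) → x≡0
      ; (no x≢0) → contradiction (nd (L μ a) (L μ x) (L-nonzero Nμ≢1 a≢0) (begin
          D c (L μ a) (L μ x)  ≡⟨ D≡F c (L μ a) (L μ x) ⟩
          F c (L μ a + L μ x) - F c (L μ a) - F c (L μ x)  ≡⟨ cong (λ y → F c y - F c (L μ a) - F c (L μ x)) (L-+ μ a x) ⟨
          F c (L μ (a + x)) - F c (L μ a) - F c (L μ x)  ≡⟨ cong₂ _-_ (cong₂ _-_ (F-transform c μ (a + x)) (F-transform c μ a)) (F-transform c μ x) ⟨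
          F c′ (a + x) - F c′ a - F c′ x  ≡⟨ D≡F c′ a x ⟨
          D c′ a x  ≡⟨ eq ⟩
          0#  ∎)) (L-nonzero Nμ≢1 x≢0) }
      where
      open ≡-Reasoning
      c′ = transform c μ

    bar-linear′ : ∀ a b m → bar (a + b * m) ≡ bar a + bar b * bar m
    bar-linear′ a b m = trans (Bar.+-homo _ _) (cong (bar a +_) (Bar.*-homo b m))

    bar-linear″ : ∀ a b m → bar (a + b * bar m) ≡ bar a + bar b * m
    bar-linear″ a b m = trans (bar-linear′ a b (bar m)) (cong (λ z → bar a + bar b * z) (bar-involutive m))

    -- Composition with `L μ` multiplies the determinant of `B c s` by that of `L μ`.
    β₁-right : ∀ c μ → β₁ (right c μ) ≡ (1# - N μ) * β₁ c
    β₁-right (c₀ , c₁ , c₂ , c₃) μ = trans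
      (cong₂ (λ u v → (c₃ + c₂ * bar μ) * u - (c₂ + c₃ * μ) * v) (bar-linear″ c₁ c₀ μ) (bar-linear′ c₀ c₁ μ))
      (solve 6 (λ c₂ c₃ d₀ d₁ m n → (c₃ :+ c₂ :* n) :* (d₁ :+ d₀ :* m) :- (c₂ :+ c₃ :* m) :* (d₀ :+ d₁ :* n)
        := (:1 :- m :* n) :* (c₃ :* d₁ :- c₂ :* d₀)) refl c₂ c₃ (bar c₀) (bar c₁) μ (bar μ))

    -- The right side is the coefficient of `x²` in `q₁ (swap c) (L μ x)`; `normalising-μ` chooses
    -- `μ` to make it vanish.
    β₁-swap-right : ∀ c μ → β₁ (swap (right c μ)) ≡ β₁ (swap c) + bar μ * α₁ (swap c) + bar μ * bar μ * bar (β₁ (swap c))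
    β₁-swap-right (c₀ , c₁ , c₂ , c₃) μ = trans
      (cong₂ (λ u v → (c₃ + c₂ * bar μ) * u - (c₁ + c₀ * bar μ) * v) (bar-linear′ c₂ c₃ μ) (bar-linear′ c₀ c₁ μ))
      (trans (solve 9 (λ c₀ c₁ c₂ c₃ d₀ d₁ d₂ d₃ n → (c₃ :+ c₂ :* n) :* (d₂ :+ d₃ :* n) :- (c₁ :+ c₀ :* n) :* (d₀ :+ d₁ :* n)
        := (c₃ :* d₂ :- c₁ :* d₀) :+ n :* (c₂ :* d₂ :+ c₃ :* d₃ :- c₀ :* d₀ :- c₁ :* d₁) :+ n :* n :* (d₃ :* c₂ :- d₁ :* c₀))
        refl c₀ c₁ c₂ c₃ (bar c₀) (bar c₁) (bar c₂) (bar c₃) (bar μ))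
      (cong (λ z → β₁ c′ + bar μ * α₁ c′ + bar μ * bar μ * z) (sym (bar-β₁ c₀ c₂ c₁ c₃))))
      where c′ = c₀ , c₂ , c₁ , c₃

    -- μ̄ = (-α + δ) / 2β̄ is a root of β̄ X² + α X + β.
    normalising-μ : ∀ {α β δ} → bar α ≡ α → bar δ ≡ δ → δ ≢ 0# → δ * δ ≡ disc α β → ∃[ μ ] (N μ ≢ 1# × β + bar μ * α + bar μ * bar μ * bar β ≡ 0#)
    normalising-μ {α} {β} {δ} ᾱ≡α δ̄≡δ δ≢0 δ²≡ = by-cases (β ≟ 0#)
      where
      open ≡-Reasoning
      by-cases : Dec (β ≡ 0#) → ∃[ μ ] (N μ ≢ 1# × β + bar μ * α + bar μ * bar μ * bar β ≡ 0#)
      by-cases (yes β≡0) = 0# , (λ eq → 0≢1 (trans (sym (zeroˡ _)) eq)) , trans (cong₂ (λ b m → b + m * α + m * m * bar β) β≡0 Bar.0-homo)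
        (solve 2 (λ a b → :0 :+ :0 :* a :+ :0 :* :0 :* b := :0) refl α (bar β))
      by-cases (no β≢0) = bar w , Nw≢1 , subst (λ m → β + m * α + m * m * bar β ≡ 0#) (sym (bar-involutive w)) root
        where
        2β̄≢0 = *-nonzero 2≢0 (Bar.nonzero β≢0)
        w = (δ - α) * (2# * bar β) ⁻¹
        2β̄w : 2# * bar β * w ≡ δ - α
        2β̄w = trans (solve 3 (λ a b c → a :* (b :* c) := b :* (a :* c)) refl (2# * bar β) (δ - α) _)
          (trans (cong ((δ - α) *_) (*-inverseʳ 2β̄≢0)) (*-identityʳ _))
        4N : 4# * (β * bar β) ≡ (α - δ) * (α + δ)
        4N = begin
          4# * (β * bar β)  ≡⟨ solve 2 (λ a b → b := a :* a :- (a :* a :- b)) refl α (4# * (β * bar β)) ⟩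
          α * α - disc α β  ≡⟨ cong (λ z → α * α - z) δ²≡ ⟨
          α * α - δ * δ  ≡⟨ solve 2 (λ a d → a :* a :- d :* d := (a :- d) :* (a :+ d)) refl α δ ⟩
          (α - δ) * (α + δ)  ∎
        root : β + w * α + w * w * bar β ≡ 0#
        root = no-zero-divisors (begin
          4# * bar β * (β + w * α + w * w * bar β)
            ≡⟨ solve 4 (λ a b c w → :4 :* c :* (b :+ w :* a :+ w :* w :* c)
                 := :4 :* (b :* c) :+ :2 :* a :* (:2 :* c :* w) :+ (:2 :* c :* w) :* (:2 :* c :* w)) refl α β (bar β) w ⟩
          4# * (β * bar β) + 2# * α * (2# * bar β * w) + (2# * bar β * w) * (2# * bar β * w)
            ≡⟨ cong₂ (λ u v → u + 2# * α * v + v * v) 4N 2β̄w ⟩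
          (α - δ) * (α + δ) + 2# * α * (δ - α) + (δ - α) * (δ - α)
            ≡⟨ solve 2 (λ a d → (a :- d) :* (a :+ d) :+ :2 :* a :* (d :- a) :+ (d :- a) :* (d :- a) := :0) refl α δ ⟩
          0#  ∎) (*-nonzero 4≢0 (Bar.nonzero β≢0))
        α-δ≢0 : α - δ ≢ 0#
        α-δ≢0 eq = *-nonzero 4≢0 (*-nonzero β≢0 (Bar.nonzero β≢0)) (trans 4N (trans (cong (_* (α + δ)) eq) (zeroˡ _)))
        2βw̄ : 2# * β * bar w ≡ δ - α
        2βw̄ = begin
          2# * β * bar w  ≡⟨ cong (λ z → 2# * z * bar w) (bar-involutive β) ⟨
          2# * bar (bar β) * bar w  ≡⟨ cong (_* bar w) (Bar.2*-homo (bar β)) ⟨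
          bar (2# * bar β) * bar w  ≡⟨ Bar.*-homo _ w ⟨
          bar (2# * bar β * w)  ≡⟨ cong bar 2β̄w ⟩
          bar (δ - α)  ≡⟨ trans (bar-- δ α) (cong₂ _-_ δ̄≡δ ᾱ≡α) ⟩
          δ - α  ∎
        Nw≢1 : N (bar w) ≢ 1#
        Nw≢1 Nw≡1 = *-nonzero α-δ≢0 (*-nonzero 2≢0 δ≢0) (begin
          (α - δ) * (2# * δ)  ≡⟨ solve 2 (λ a d → (a :- d) :* (:2 :* d) := (a :- d) :* (a :+ d) :- (a :- d) :* (a :- d)) refl α δ ⟩
          (α - δ) * (α + δ) - (α - δ) * (α - δ)  ≡⟨ cong (_- (α - δ) * (α - δ)) 4N ⟨
          4# * (β * bar β) - (α - δ) * (α - δ)  ≡⟨ x≡y⇒x-y≡0 4N′ ⟩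
          0#  ∎)
          where
          4N′ : 4# * (β * bar β) ≡ (α - δ) * (α - δ)
          4N′ = begin
            4# * (β * bar β)  ≡⟨ *-identityʳ _ ⟨
            4# * (β * bar β) * 1#  ≡⟨ cong (4# * (β * bar β) *_) (trans (cong (bar w *_) (sym (bar-involutive w))) Nw≡1) ⟨
            4# * (β * bar β) * (bar w * w)
              ≡⟨ solve 4 (λ b c w v → :4 :* (b :* c) :* (v :* w) := (:2 :* c :* w) :* (:2 :* b :* v)) refl β (bar β) w (bar w) ⟩
            (2# * bar β * w) * (2# * β * bar w)  ≡⟨ cong₂ _*_ 2β̄w 2βw̄ ⟩
            (δ - α) * (δ - α)  ≡⟨ solve 2 (λ a d → (d :- a) :* (d :- a) := (a :- d) :* (a :- d)) refl α δ ⟩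
            (α - δ) * (α - δ)  ∎

    -- It gives `q₁ c (φ x) = w * φ (q₁ (swap c) x)`, so that the two forms vanish together whenever
    -- the second one does.
    Proportional : Coeffs → Set
    Proportional c = ∃[ w ] (α₁ c ≡ w * φ (α₁ (swap c)) × β₁ c ≡ w * φ (β₁ (swap c)) × bar w ≡ w)

    proportional⇒anisotropic : ∀ {c} → NonDegenerate c → TraceSurjective → Proportional c → Anisotropic (α₁ (swap c)) (β₁ (swap c))
    proportional⇒anisotropic {c} nd surj (w , α≡ , β≡ , w̄≡w) x x≢0 eq = no-common-zero nd surj x≢0 (begin
      form (α₁ c) (β₁ c) (φ x)  ≡⟨ cong₂ (λ a b → form a b (φ x)) α≡ β≡ ⟩
      form (w * φ α) (w * φ β) (φ x)  ≡⟨ cong (λ z → w * φ α * (φ x * bar (φ x)) + (w * φ β * (φ x * φ x) + z * (bar (φ x) * bar (φ x))))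
                                                                     (trans (Bar.*-homo w _) (cong (_* bar (φ β)) w̄≡w)) ⟩
      w * φ α * (φ x * bar (φ x)) + (w * φ β * (φ x * φ x) + w * bar (φ β) * (bar (φ x) * bar (φ x)))
        ≡⟨ solve 7 (λ w a b c p q r → w :* a :* p :+ (w :* b :* q :+ w :* c :* r) := w :* (a :* p :+ (b :* q :+ c :* r))) refl
             w (φ α) (φ β) (bar (φ β)) (φ x * bar (φ x)) (φ x * φ x) (bar (φ x) * bar (φ x)) ⟩
      w * form (φ α) (φ β) (φ x)  ≡⟨ cong (w *_) (φ-form α β x) ⟨
      w * φ (form α β x)  ≡⟨ cong (λ z → w * φ z) eq ⟩
      w * φ 0#  ≡⟨ trans (cong (w *_) Φ.0-homo) (zeroʳ w) ⟩
      0#  ∎) eq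
      where
      open ≡-Reasoning
      α = α₁ (swap c)
      β = β₁ (swap c)

    -- The two inequalities on norms make `L μ` and `z ↦ A z + C z̄` invertible, so that the formula
    -- is a linear equivalence.
    record MonomialForm (c : Coeffs) : Set where
      field
        μ A C : Carrier
        Nμ≢1 : N μ ≢ 1#
        NA≢NC : N A ≢ N C
        F-formula : (∀ x → F c (L μ x) ≡ A * (φ x * x) + C * bar (φ x * x))
                  ⊎ (∀ x → F c (L μ x) ≡ A * (φ x * bar x) + C * bar (φ x * bar x))

    private
      conj-eq : ∀ {a b c d} → a * bar b ≡ c * bar d → b * bar a ≡ d * bar c
      conj-eq {a} {b} {c} {d} eq = begin
        b * bar a  ≡⟨ cong (_* bar a) (bar-involutive b) ⟨
        bar (bar b) * bar a  ≡⟨ trans (Bar.*-homo _ _) (*-comm _ _) ⟨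
        bar (a * bar b)  ≡⟨ cong bar eq ⟩
        bar (c * bar d)  ≡⟨ trans (Bar.*-homo _ _) (*-comm _ _) ⟩
        bar (bar d) * bar c  ≡⟨ cong (_* bar c) (bar-involutive d) ⟩
        d * bar c  ∎
        where open ≡-Reasoning

      -- The hypotheses give (N a - N b) x = 0.
      vanish : ∀ {a b x y} → x * bar a ≡ b * bar y → a * bar y ≡ x * bar b → N a ≢ N b → x ≡ 0#
      vanish {a} {b} {x} {y} eq₁ eq₂ Na≢Nb = no-zero-divisors (begin
        (N a - N b) * x  ≡⟨ solve 5 (λ a ā b b̄ x → (a :* ā :- b :* b̄) :* x := a :* (x :* ā) :- b :* (x :* b̄)) refl a (bar a) b (bar b) x ⟩
        a * (x * bar a) - b * (x * bar b) ≡⟨ cong₂ (λ u v → a * u - b * v) eq₁ (sym eq₂) ⟩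
        a * (b * bar y) - b * (a * bar y) ≡⟨ solve 3 (λ a b y → a :* (b :* y) :- b :* (a :* y) := :0) refl a b (bar y) ⟩
        0#  ∎) (Na≢Nb ∘ x-y≡0⇒x≡y)
        where open ≡-Reasoning

    -- The hypotheses on `β₁` read `c₃ c̄₁ = c₂ c̄₀` and `c₃ c̄₂ = c₁ c̄₀`, and `α₁ c ≠ 0` forbids
    -- `N c₃ = N c₀` together with `N c₁ = N c₂`. A pair with different norms forces the other pair
    -- to vanish.
    two-terms : ∀ c → β₁ c ≡ 0# → β₁ (swap c) ≡ 0# → α₁ c ≢ 0# →
      let c₀ , c₁ , c₂ , c₃ = c in (c₁ ≡ 0# × c₂ ≡ 0# × N c₃ ≢ N c₀) ⊎ (c₀ ≡ 0# × c₃ ≡ 0# × N c₂ ≢ N c₁)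
    two-terms c@(c₀ , c₁ , c₂ , c₃) β≡0 β′≡0 α≢0 with N c₃ ≟ N c₀ | N c₁ ≟ N c₂
    ... | no N₃≢N₀ | _ = inj₁ (vanish (conj-eq E₁) E₂ N₃≢N₀ , vanish (conj-eq E₂) E₁ N₃≢N₀ , N₃≢N₀)
      where
      E₁ : c₃ * bar c₁ ≡ c₂ * bar c₀
      E₁ = x-y≡0⇒x≡y β≡0
      E₂ : c₃ * bar c₂ ≡ c₁ * bar c₀
      E₂ = x-y≡0⇒x≡y β′≡0
    ... | yes _ | no N₁≢N₂ = inj₂ (vanish (sym (conj-eq E₂)) (conj-eq E₁) N₁≢N₂ , vanish E₁ (sym E₂) N₁≢N₂ , N₁≢N₂ ∘ sym)
      where
      E₁ : c₃ * bar c₁ ≡ c₂ * bar c₀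
      E₁ = x-y≡0⇒x≡y β≡0
      E₂ : c₃ * bar c₂ ≡ c₁ * bar c₀
      E₂ = x-y≡0⇒x≡y β′≡0
    ... | yes N₃≡N₀ | yes N₁≡N₂ = contradiction (trans (cong₂ (λ u v → u + v - N c₀ - N c₂) N₁≡N₂ N₃≡N₀)
        (solve 2 (λ a b → a :+ b :- b :- a := :0) refl (N c₂) (N c₀))) α≢0

    -- After normalisation `Δ c` is the square of `α₁ (swap c)`. If it vanished, `q₁ (swap c)` would
    -- be zero, and a radical vector of `q₁ c` would give a common zero. This spares the
    -- transformation law of `Δ`.
    normalised⇒Δ≢0 : ∀ {c} → NonDegenerate c → TraceSurjective → β₁ (swap c) ≡ 0# → Δ c ≢ 0#
    normalised⇒Δ≢0 {c} nd surj β′≡0 Δ≡0 = no-common-zero nd surj a≢0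
      (trans (cong (q₁ c) φa≡e) (polar≡0⇒form≡0 (polar-e e))) (form-zero a α′≡0 β′≡0)
      where
      α′≡0 : α₁ (swap c) ≡ 0#
      α′≡0 = ^-zero 2 (trans (cong (α₁ (swap c) *_) (x^1 _)) (trans (sym (disc-β≡0 β′≡0)) (trans (sym (disc-swap c)) Δ≡0)))
      rad = radical {α₁ c} {β₁ c} (bar-α₁ c) Δ≡0
      e = proj₁ rad
      polar-e = proj₂ (proj₂ rad)
      a = proj₁ (φ-surjective e)
      φa≡e = proj₂ (φ-surjective e)
      a≢0 : a ≢ 0#
      a≢0 a≡0 = proj₁ (proj₂ rad) (trans (sym φa≡e) (trans (cong φ a≡0) Φ.0-homo))

    -- Proportionality is used twice: for `c`, to find `μ`, and for the transformed coefficients, to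
    -- make their second `β₁` vanish too. `Good` carries what its proof needs: symmetry of `c` if
    -- `φ` is the identity, nothing if `e ≥ 3`.
    monomialForm : TraceSurjective → RealSquareRoots → ∀ (Good : Coeffs → Set) →
      (∀ {c} μ → Good c → Good (transform c μ)) → (∀ {c} → NonDegenerate c → Good c → Δ c ≢ 0# → Proportional c) →
      ∀ {c} → NonDegenerate c → Good c → Δ c ≢ 0# → MonomialForm c
    monomialForm surj sqrt Good good-transform proportional {c} nd good Δ≢0 = from-terms (two-terms c′ β′≡0 β″≡0 α′≢0)
      where
      open ≡-Reasoning
      square = anisotropic⇒disc-square sqrt (bar-α₁ (swap c)) (proportional⇒anisotropic nd surj (proportional nd good Δ≢0))
      δ = proj₁ square
      normalising = let δ̄≡δ , δ≢0 , δ²≡ = proj₂ square in normalising-μ (bar-α₁ (swap c)) δ̄≡δ δ≢0 δ²≡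
      μ = proj₁ normalising
      Nμ≢1 : N μ ≢ 1#
      Nμ≢1 = proj₁ (proj₂ normalising)
      c′ = transform c μ
      c₀ = proj₁ c′
      c₁ = proj₁ (proj₂ c′)
      c₂ = proj₁ (proj₂ (proj₂ c′))
      c₃ = proj₂ (proj₂ (proj₂ c′))
      nd′ : NonDegenerate c′
      nd′ = NonDegenerate-transform Nμ≢1 nd
      β″≡0 : β₁ (swap c′) ≡ 0#
      β″≡0 = begin
        β₁ (right (swap (right c μ)) (φ μ))  ≡⟨ β₁-right (swap (right c μ)) (φ μ) ⟩
        (1# - N (φ μ)) * β₁ (swap (right c μ))  ≡⟨ cong ((1# - N (φ μ)) *_) (trans (β₁-swap-right c μ) (proj₂ (proj₂ normalising))) ⟩
        (1# - N (φ μ)) * 0#  ≡⟨ zeroʳ _ ⟩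
        0#  ∎
      Δ′≢0 : Δ c′ ≢ 0#
      Δ′≢0 = normalised⇒Δ≢0 nd′ surj β″≡0
      β′≡0 : β₁ c′ ≡ 0#
      β′≡0 = let w , _ , β≡ , _ = proportional nd′ (good-transform μ good) Δ′≢0 in
        trans β≡ (trans (cong (λ z → w * φ z) β″≡0) (trans (cong (w *_) Φ.0-homo) (zeroʳ w)))
      α′≢0 : α₁ c′ ≢ 0#
      α′≢0 α≡0 = Δ′≢0 (trans (disc-β≡0 β′≡0) (trans (cong (_* α₁ c′) α≡0) (zeroˡ _)))
      from-terms : (c₁ ≡ 0# × c₂ ≡ 0# × N c₃ ≢ N c₀) ⊎ (c₀ ≡ 0# × c₃ ≡ 0# × N c₂ ≢ N c₁) → MonomialForm c
      from-terms (inj₁ (c₁≡0 , c₂≡0 , N₃≢N₀)) = record { μ = μ ; A = c₃ ; C = c₀ ; Nμ≢1 = Nμ≢1 ; NA≢NC = N₃≢N₀ ; F-formula = inj₁ λ x → begin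
        F c (L μ x)  ≡⟨ F-transform c μ x ⟨
        (c₃ * φ x + c₁ * bar (φ x)) * x + (c₂ * φ x + c₀ * bar (φ x)) * bar x
          ≡⟨ cong₂ (λ u v → (c₃ * φ x + u * bar (φ x)) * x + (v * φ x + c₀ * bar (φ x)) * bar x) c₁≡0 c₂≡0 ⟩
        (c₃ * φ x + 0# * bar (φ x)) * x + (0# * φ x + c₀ * bar (φ x)) * bar x
          ≡⟨ solve 6 (λ a c s s̄ x x̄ → (a :* s :+ :0 :* s̄) :* x :+ (:0 :* s :+ c :* s̄) :* x̄ := a :* (s :* x) :+ c :* (s̄ :* x̄)) refl c₃ c₀ (φ x) (bar (φ x)) x (bar x) ⟩
        c₃ * (φ x * x) + c₀ * (bar (φ x) * bar x)  ≡⟨ cong (λ z → c₃ * (φ x * x) + c₀ * z) (Bar.*-homo (φ x) x) ⟨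
        c₃ * (φ x * x) + c₀ * bar (φ x * x)  ∎ }
      from-terms (inj₂ (c₀≡0 , c₃≡0 , N₂≢N₁)) = record { μ = μ ; A = c₂ ; C = c₁ ; Nμ≢1 = Nμ≢1 ; NA≢NC = N₂≢N₁ ; F-formula = inj₂ λ x → begin
        F c (L μ x)  ≡⟨ F-transform c μ x ⟨
        (c₃ * φ x + c₁ * bar (φ x)) * x + (c₂ * φ x + c₀ * bar (φ x)) * bar x
          ≡⟨ cong₂ (λ u v → (u * φ x + c₁ * bar (φ x)) * x + (c₂ * φ x + v * bar (φ x)) * bar x) c₃≡0 c₀≡0 ⟩
        (0# * φ x + c₁ * bar (φ x)) * x + (c₂ * φ x + 0# * bar (φ x)) * bar x
          ≡⟨ solve 6 (λ a c s s̄ x x̄ → (:0 :* s :+ c :* s̄) :* x :+ (a :* s :+ :0 :* s̄) :* x̄ := a :* (s :* x̄) :+ c :* (s̄ :* x)) refl c₂ c₁ (φ x) (bar (φ x)) x (bar x) ⟩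
        c₂ * (φ x * bar x) + c₁ * (bar (φ x) * x)  ≡⟨ cong (λ z → c₂ * (φ x * bar x) + c₁ * z) (trans (Bar.*-homo (φ x) (bar x)) (cong (bar (φ x) *_) (bar-involutive x))) ⟨
        c₂ * (φ x * bar x) + c₁ * bar (φ x * bar x)  ∎ }

    symmetric-transform : (∀ x → φ x ≡ x) → ∀ {c} μ → swap c ≡ c → swap (transform c μ) ≡ transform c μ
    symmetric-transform φ≡id {c₀ , c₁ , c₂ , c₃} μ sym-c = cong₂ _,_ refl (cong₂ _,_ (sym mid) (cong₂ _,_ mid refl))
      where
      open ≡-Reasoning
      c₂≡c₁ : c₂ ≡ c₁
      c₂≡c₁ = cong (proj₁ ∘ proj₂) sym-c
      ν = φ μ
      mid : c₁ + c₀ * bar μ + (c₃ + c₂ * bar μ) * ν ≡ (c₂ + c₃ * μ) + (c₀ + c₁ * μ) * bar ν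
      mid = begin
        c₁ + c₀ * bar μ + (c₃ + c₂ * bar μ) * ν  ≡⟨ cong₂ (λ u v → c₁ + c₀ * bar μ + (c₃ + u * bar μ) * v) c₂≡c₁ (φ≡id μ) ⟩
        c₁ + c₀ * bar μ + (c₃ + c₁ * bar μ) * μ  ≡⟨ solve 5 (λ c₀ c₁ c₃ m n → c₁ :+ c₀ :* n :+ (c₃ :+ c₁ :* n) :* m := (c₁ :+ c₃ :* m) :+ (c₀ :+ c₁ :* m) :* n) refl c₀ c₁ c₃ μ (bar μ) ⟩
        (c₁ + c₃ * μ) + (c₀ + c₁ * μ) * bar μ  ≡⟨ cong₂ (λ u v → (u + c₃ * μ) + (c₀ + c₁ * μ) * bar v) c₂≡c₁ (φ≡id μ) ⟨
        (c₂ + c₃ * μ) + (c₀ + c₁ * μ) * bar ν  ∎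

    symmetric⇒proportional : (∀ x → φ x ≡ x) → ∀ {c} → swap c ≡ c → Proportional c
    symmetric⇒proportional φ≡id {c} sym-c = 1# , relate α₁ , relate β₁ , Bar.1-homo
      where
      relate : (f : Coeffs → Carrier) → f c ≡ 1# * φ (f (swap c))
      relate f = sym (trans (*-identityˡ _) (trans (φ≡id _) (cong f sym-c)))

    -- The pencil of the two determinant forms

    -- `θ` is the sign `φ ι / ι`. The arithmetic of `T` enters only through two properties: its
    -- elements are quotients `φ y / y` with real `y`, and it separates the roots of quadratic
    -- polynomials.
    module _ (surj : TraceSurjective) (sqrt : RealSquareRoots)
      (θ : Carrier) (θ²≡1 : θ * θ ≡ 1#) (θ̄≡θ : bar θ ≡ θ) (φθ≡θ : φ θ ≡ θ) (φι≡θι : φ ι ≡ θ * ι)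
      (T : Carrier → Set) (T⇒ratio : ∀ {c} → T c → bar c ≡ c × ∃[ y ] (bar y ≡ y × y ≢ 0# × φ y ≡ c * y))
      (T-separates : ∀ {a u v} → a ≢ 0# → bar a ≡ a → u ≢ 0# → v ≢ 0# → (bar u ≡ u × bar v ≡ v) ⊎ bar u ≡ v →
        (∀ c → T c → ∃[ δ ] (bar δ ≡ δ × δ ≢ 0# × δ * δ ≡ a * ((c - u) * (c - v)))) → u ≡ v)
      {c : Coeffs} (nd : NonDegenerate c) (Δ≢0 : Δ c ≢ 0#) where

      private
        θ≢0 : θ ≢ 0#
        θ≢0 θ≡0 = 0≢1 (trans (sym (zeroˡ θ)) (trans (cong (_* θ) (sym θ≡0)) θ²≡1))

        -- The first form `fₐ` satisfies `φ ∘ fₐ = q₁ c ∘ φ`; it is the `q₁′` of the overview. The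
        -- sign `θ` is absorbed into the second form, so that the pencil has only one kind of
        -- member.
        αₐ βₐ αᵦ ββ : Carrier
        αₐ = proj₁ (φ-surjective (α₁ c))
        βₐ = proj₁ (φ-surjective (β₁ c))
        αᵦ = θ * α₁ (swap c)
        ββ = θ * β₁ (swap c)

        φαₐ : φ αₐ ≡ α₁ c
        φαₐ = proj₂ (φ-surjective (α₁ c))
        φβₐ : φ βₐ ≡ β₁ c
        φβₐ = proj₂ (φ-surjective (β₁ c))

        αₐ-real : bar αₐ ≡ αₐ
        αₐ-real = φ-injective (trans (φ-bar αₐ) (trans (cong bar φαₐ) (trans (bar-α₁ c) (sym φαₐ))))
        αᵦ-real : bar αᵦ ≡ αᵦ
        αᵦ-real = trans (Bar.*-homo _ _) (cong₂ _*_ θ̄≡θ (bar-α₁ (swap c)))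
        bar-ββ : bar ββ ≡ θ * bar (β₁ (swap c))
        bar-ββ = trans (Bar.*-homo _ _) (cong (_* _) θ̄≡θ)

        fₐ fᵦ : Carrier → Carrier
        fₐ = form αₐ βₐ
        fᵦ = form αᵦ ββ

        φfₐ : ∀ x → φ (fₐ x) ≡ q₁ c (φ x)
        φfₐ x = trans (φ-form αₐ βₐ x) (cong₂ (λ u v → form u v (φ x)) φαₐ φβₐ)

        fᵦ≡ : ∀ x → fᵦ x ≡ θ * q₁ (swap c) x
        fᵦ≡ x = trans (cong (λ b → αᵦ * (x * bar x) + (ββ * (x * x) + b * (bar x * bar x))) bar-ββ)
          (solve 6 (λ t a b b̄ x x̄ → t :* a :* (x :* x̄) :+ (t :* b :* (x :* x) :+ t :* b̄ :* (x̄ :* x̄)) := t :* (a :* (x :* x̄) :+ (b :* (x :* x) :+ b̄ :* (x̄ :* x̄))))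
            refl θ (α₁ (swap c)) (β₁ (swap c)) (bar (β₁ (swap c))) x (bar x))

        form-scalar-real : ∀ {α β} x → bar α ≡ α → bar (form α β x) ≡ form α β x
        form-scalar-real {α} {β} x ᾱ≡α = begin
          bar (α * (x * bar x) + (β * (x * x) + bar β * (bar x * bar x)))
            ≡⟨ trans (Bar.+-homo _ _) (cong₂ _+_ (Bar.*-homo _ _) (trans (Bar.+-homo _ _) (cong₂ _+_ (Bar.*-homo _ _) (Bar.*-homo _ _)))) ⟩
          bar α * bar (N x) + (bar β * bar (x * x) + bar (bar β) * bar (bar x * bar x))
            ≡⟨ cong₂ (λ u v → u + v) (cong₂ _*_ ᾱ≡α (bar-N x)) (cong₂ _+_ (cong (bar β *_) (Bar.*-homo x x))
                 (cong₂ _*_ (bar-involutive β) (trans (Bar.*-homo _ _) (cong₂ _*_ (bar-involutive x) (bar-involutive x))))) ⟩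
          α * (x * bar x) + (bar β * (bar x * bar x) + β * (x * x))
            ≡⟨ cong (α * (x * bar x) +_) (+-comm _ _) ⟩
          form α β x ∎
          where open ≡-Reasoning

        no-common : ∀ x → x ≢ 0# → fₐ x ≡ 0# → fᵦ x ≢ 0#
        no-common x x≢0 eq₁ eq₂ = no-common-zero nd surj x≢0 (trans (sym (φfₐ x)) (trans (cong φ eq₁) Φ.0-homo))
          (no-zero-divisors (trans (sym (fᵦ≡ x)) eq₂) θ≢0)

        -- A zero x of fₐ + z fᵦ would contradict nonvanishing at y = ι q₁ (swap c) x φ y₀, where z = φ y₀ / y₀.
        pencil-nonzero : ∀ {z} → T z → ∀ x → x ≢ 0# → fₐ x + z * fᵦ x ≢ 0#
        pencil-nonzero {z} tz x x≢0 eq = nonvanishing nd surj x≢0 y≢0 ȳ≡-y (begin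
          q₁ c (φ x) * y + b * φ y  ≡⟨ cong₂ (λ u v → u * y + b * v) (trans (sym (φfₐ x)) φfₐx) φy ⟩
          - (φ z * (θ * φ b)) * (ι * b * φ y₀) + b * (θ * ι * φ b * (φ z * φ y₀))
            ≡⟨ solve 6 (λ z t f i b y → (:- (z :* (t :* f))) :* (i :* b :* y) :+ b :* (t :* i :* f :* (z :* y)) := :0) refl (φ z) θ (φ b) ι b (φ y₀) ⟩
          0#  ∎)
          where
          open ≡-Reasoning
          b = q₁ (swap c) x
          y₀ = proj₁ (proj₂ (T⇒ratio tz))
          y₀-real = proj₁ (proj₂ (proj₂ (T⇒ratio tz)))
          y₀≢0 = proj₁ (proj₂ (proj₂ (proj₂ (T⇒ratio tz))))
          φy₀ = proj₂ (proj₂ (proj₂ (proj₂ (T⇒ratio tz))))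
          y = ι * b * φ y₀
          fₐx : fₐ x ≡ - (z * fᵦ x)
          fₐx = x+y≡0⇒x≡-y eq
          b≢0 : b ≢ 0#
          b≢0 b≡0 = no-common x x≢0 (trans fₐx (trans (cong (λ w → - (z * w)) fᵦ≡0) (trans (cong -_ (zeroʳ z)) -0#≈0#))) fᵦ≡0
            where
            fᵦ≡0 : fᵦ x ≡ 0#
            fᵦ≡0 = trans (fᵦ≡ x) (trans (cong (θ *_) b≡0) (zeroʳ θ))
          y≢0 : y ≢ 0#
          y≢0 = *-nonzero (*-nonzero ι≢0 b≢0) (Φ.nonzero y₀≢0)
          ȳ≡-y : bar y ≡ - y
          ȳ≡-y = begin
            bar (ι * b * φ y₀)  ≡⟨ trans (Bar.*-homo _ _) (cong (_* bar (φ y₀)) (Bar.*-homo ι b)) ⟩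
            bar ι * bar b * bar (φ y₀)  ≡⟨ cong₂ _*_ (cong₂ _*_ bar-ι (form-scalar-real x (bar-α₁ (swap c)))) (φ-real y₀-real) ⟩
            - ι * b * φ y₀  ≡⟨ solve 3 (λ i b y → (:- i) :* b :* y := :- (i :* b :* y)) refl ι b (φ y₀) ⟩
            - y  ∎
          φfₐx : φ (fₐ x) ≡ - (φ z * (θ * φ b))
          φfₐx = begin
            φ (fₐ x)  ≡⟨ cong φ (trans fₐx (cong (λ w → - (z * w)) (fᵦ≡ x))) ⟩
            φ (- (z * (θ * b)))  ≡⟨ trans (Φ.-homo _) (cong -_ (trans (Φ.*-homo z _) (cong (φ z *_) (trans (Φ.*-homo θ b) (cong (_* φ b) φθ≡θ))))) ⟩
            - (φ z * (θ * φ b))  ∎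
          φy : φ y ≡ θ * ι * φ b * (φ z * φ y₀)
          φy = begin
            φ (ι * b * φ y₀)  ≡⟨ trans (Φ.*-homo _ _) (cong₂ _*_ (Φ.*-homo ι b) (trans (cong φ φy₀) (Φ.*-homo z y₀))) ⟩
            φ ι * φ b * (φ z * φ y₀)  ≡⟨ cong (λ u → u * φ b * (φ z * φ y₀)) φι≡θι ⟩
            θ * ι * φ b * (φ z * φ y₀) ∎

        φ-2 : φ 2# ≡ 2#
        φ-2 = trans (Φ.+-homo 1# 1#) (cong₂ _+_ Φ.1-homo Φ.1-homo)

        dₐ≢0 : disc αₐ βₐ ≢ 0#
        dₐ≢0 eq = Δ≢0 (trans (sym φdₐ) (trans (cong φ eq) Φ.0-homo))
          where
          φdₐ : φ (disc αₐ βₐ) ≡ Δ c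
          φdₐ = begin
            φ (αₐ * αₐ - 4# * (βₐ * bar βₐ))
              ≡⟨ trans (Φ.+-homo _ _) (cong₂ _+_ (Φ.*-homo _ _) (trans (Φ.-homo _) (cong -_ (trans (Φ.*-homo _ _)
                   (cong₂ _*_ (trans (Φ.+-homo _ _) (cong₂ _+_ φ-2 φ-2)) (trans (Φ.*-homo _ _) (cong (φ βₐ *_) (φ-bar βₐ)))))))) ⟩
            φ αₐ * φ αₐ - 4# * (φ βₐ * bar (φ βₐ))  ≡⟨ cong₂ disc φαₐ φβₐ ⟩
            Δ c  ∎
            where open ≡-Reasoning

        dᵦ≢0 : disc αᵦ ββ ≢ 0#
        dᵦ≢0 eq = Δ≢0 (begin
          Δ c  ≡⟨ disc-swap c ⟩
          disc α β  ≡⟨ *-identityˡ _ ⟨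
          1# * disc α β  ≡⟨ cong (_* disc α β) θ²≡1 ⟨
          θ * θ * disc α β  ≡⟨ solve 4 (λ t a b b̄ → t :* t :* (a :* a :- :4 :* (b :* b̄))
                                       := t :* a :* (t :* a) :- :4 :* (t :* b :* (t :* b̄))) refl θ α β (bar β) ⟩
          αᵦ * αᵦ - 4# * (ββ * (θ * bar β))  ≡⟨ cong (λ z → αᵦ * αᵦ - 4# * (ββ * z)) bar-ββ ⟨
          disc αᵦ ββ  ≡⟨ eq ⟩
          0#  ∎)
          where
          open ≡-Reasoning
          α = α₁ (swap c)
          β = β₁ (swap c)

      pencil⇒proportional : Proportional c
      pencil⇒proportional = from-degenerate (Pencil.proportional αₐ βₐ αᵦ ββ αₐ-real αᵦ-real sqrt T (proj₁ ∘ T⇒ratio) T-separates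
          (λ tz x x≢0 eq → pencil-nonzero tz x x≢0 (trans (sym (Pencil.pencil-form αₐ βₐ αᵦ ββ αₐ-real αᵦ-real (proj₁ (T⇒ratio tz)) x)) eq))
          no-common dₐ≢0 dᵦ≢0)
        where
        from-degenerate : ∃[ u ] (bar u ≡ u × αₐ + u * αᵦ ≡ 0# × βₐ + u * ββ ≡ 0#) → Proportional c
        from-degenerate (u , u-real , α≡0 , β≡0) = - (φ u * θ) , relate φαₐ α≡0 , relate φβₐ β≡0 ,
          trans (Bar.-homo _) (cong -_ (trans (Bar.*-homo _ _) (cong₂ _*_ (φ-real u-real) θ̄≡θ)))
          where
          relate : ∀ {x y z} → φ x ≡ y → x + u * (θ * z) ≡ 0# → y ≡ - (φ u * θ) * φ z
          relate {x} {y} {z} φx≡y eq = begin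
            y  ≡⟨ φx≡y ⟨
            φ x  ≡⟨ cong φ (x+y≡0⇒x≡-y eq) ⟩
            φ (- (u * (θ * z)))  ≡⟨ trans (Φ.-homo _) (cong -_ (trans (Φ.*-homo u _) (cong (φ u *_) (trans (Φ.*-homo θ z) (cong (_* φ z) φθ≡θ))))) ⟩
            - (φ u * (θ * φ z))  ≡⟨ solve 3 (λ u t z → :- (u :* (t :* z)) := (:- (u :* t)) :* z) refl (φ u) θ (φ z) ⟩
            - (φ u * θ) * φ z  ∎
            where open ≡-Reasoning

-- Exponents, Frobenius powers and traces

-- The number `1 + y + … + y^(n-1)`; it expresses the quotient of `y^n - 1` by `y - 1` without
-- truncated subtraction.
repunit : ℕ → ℕ → ℕ
repunit y zero = 0
repunit y (suc n) = 1 ℕ.+ y ℕ.* repunit y n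

repunit-^ : ∀ w n → suc w ℕ.^ n ≡ 1 ℕ.+ w ℕ.* repunit (suc w) n
repunit-^ w zero = cong suc (sym (ℕ.*-zeroʳ w))
repunit-^ w (suc n) = trans (cong (suc w ℕ.*_) (repunit-^ w n)) (expand w (repunit (suc w) n))
  where
  expand : ∀ w g → suc w ℕ.* (1 ℕ.+ w ℕ.* g) ≡ 1 ℕ.+ w ℕ.* (1 ℕ.+ suc w ℕ.* g)
  expand = solve-∀

repunit-suc : ∀ y n → repunit y (suc n) ≡ repunit y n ℕ.+ y ℕ.^ n
repunit-suc y zero = cong suc (ℕ.*-zeroʳ y)
repunit-suc y (suc n) = trans (cong (λ g → 1 ℕ.+ y ℕ.* g) (repunit-suc y n)) (expand y (repunit y n) (y ℕ.^ n))
  where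
  expand : ∀ y g h → 1 ℕ.+ y ℕ.* (g ℕ.+ h) ≡ 1 ℕ.+ y ℕ.* g ℕ.+ y ℕ.* h
  expand = solve-∀

EvenOrOdd : ℕ → Set
EvenOrOdd n = (∃[ j ] n ≡ j ℕ.* 2) ⊎ (∃[ j ] n ≡ 1 ℕ.+ j ℕ.* 2)

evenOrOdd : ∀ n → EvenOrOdd n
evenOrOdd zero = inj₁ (0 , refl)
evenOrOdd (suc n) with evenOrOdd n
... | inj₁ (j , refl) = inj₂ (j , refl)
... | inj₂ (j , refl) = inj₁ (suc j , refl)

odd-prime-power : ∀ {p} → Prime p → p ≢ 2 → ∀ n → ∃[ r ] p ℕ.^ n ≡ suc (2 ℕ.* r)
odd-prime-power {p} p-prime p≢2 n with evenOrOdd p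
... | inj₁ (j , p≡2j) = contradiction (sym (case prime⇒irreducible p-prime (divides j p≡2j) of λ { (inj₁ ()) ; (inj₂ eq) → eq })) p≢2
... | inj₂ (j , refl) = j ℕ.* repunit (suc (j ℕ.* 2)) n , trans (repunit-^ (j ℕ.* 2) n) (cong suc (regroup j (repunit (suc (j ℕ.* 2)) n)))
  where
  regroup : ∀ j g → j ℕ.* 2 ℕ.* g ≡ 2 ℕ.* (j ℕ.* g)
  regroup = solve-∀

module Frobenius (p : ℕ) (p-prime : Prime p) (p≢2 : p ≢ 2) (K : FiniteField) (k : ℕ)
  (size≡ : FiniteField.size K ≡ p ℕ.^ (k ℕ.+ k)) (k≢0 : k ≢ 0) where
  open FieldProperties K
  open Polynomials K
  open Endomorphisms K

  p×1≡0 : p ×.× 1# ≡ 0#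
  p×1≡0 = char p (k ℕ.+ k) size≡

  2≠0 : 1# + 1# ≢ 0#
  2≠0 = 2≢0 p p-prime p×1≡0 p≢2

  1<p : 1 ℕ.< p
  1<p = ℕ.nonTrivial⇒n>1 p {{prime⇒nonTrivial p-prime}}

  frob : ℕ → Carrier → Carrier
  frob n x = x ^ (p ℕ.^ n)

  frob-isEndo : ∀ n → IsEndomorphism (frob n)
  frob-isEndo n = record
    { +-homo = frobeniusⁿ-+ p p-prime p×1≡0 n
    ; *-homo = λ x y → ^-distrib-* x y (p ℕ.^ n)
    ; 1-homo = 1^ (p ℕ.^ n) }

  frob-0 : ∀ x → frob 0 x ≡ x
  frob-0 = x^1

  frob-∘ : ∀ m n x → frob m (frob n x) ≡ frob (m ℕ.+ n) x
  frob-∘ m n x = trans (sym (^-* x (p ℕ.^ m) (p ℕ.^ n))) (cong (x ^_) (sym (ℕ.^-distribˡ-+-* p m n)))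

  frob-comm : ∀ m n x → frob m (frob n x) ≡ frob n (frob m x)
  frob-comm m n x = ^-comm x (p ℕ.^ n) (p ℕ.^ m)

  frob-fixed : ∀ {n x} → frob n x ≡ x → ∀ j → frob (j ℕ.* n) x ≡ x
  frob-fixed {n} {x} eq zero = frob-0 x
  frob-fixed {n} {x} eq (suc j) = trans (sym (frob-∘ n (j ℕ.* n) x)) (trans (cong (frob n) (frob-fixed eq j)) eq)

  frob-2k : ∀ x → frob (k ℕ.+ k) x ≡ x
  frob-2k x = trans (cong (x ^_) (sym size≡)) (^-size x)

  bar : Carrier → Carrier
  bar = frob k

  bar-involutive : ∀ x → bar (bar x) ≡ x
  bar-involutive x = trans (frob-∘ k k x) (frob-2k x)

  -- ι is the power of a non-square of K with exponent (p^d + 1)/2 · (1 + p^2d + … + p^2(e-1)d) = (|K| - 1) / 2(p^d - 1).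
  ∃-skew : ∀ d e → k ≡ e ℕ.* d → ∃[ ι ] (ι ≢ 0# × frob d ι ≡ - ι)
  ∃-skew d e k≡ed with odd-prime-power p-prime p≢2 d
  ... | r , D≡ = construct M refl
    where
    G E M : ℕ
    G = repunit (suc (4 ℕ.* (r ℕ.* suc r))) e
    E = suc r ℕ.* G
    M = 2 ℕ.* r ℕ.* E
    size≡2M+1 : size ≡ suc (2 ℕ.* M)
    size≡2M+1 = begin
      size  ≡⟨ size≡ ⟩
      p ℕ.^ (k ℕ.+ k)  ≡⟨ cong (λ n → p ℕ.^ (n ℕ.+ n)) k≡ed ⟩
      p ℕ.^ (e ℕ.* d ℕ.+ e ℕ.* d)  ≡⟨ cong (p ℕ.^_) (rearrange e d) ⟩
      p ℕ.^ (d ℕ.* 2 ℕ.* e)  ≡⟨ trans (ℕ.^-*-assoc p (d ℕ.* 2) e) refl ⟨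
      (p ℕ.^ (d ℕ.* 2)) ℕ.^ e  ≡⟨ cong (ℕ._^ e) (trans (sym (ℕ.^-*-assoc p d 2)) (cong (ℕ._^ 2) D≡)) ⟩
      (suc (2 ℕ.* r) ℕ.^ 2) ℕ.^ e  ≡⟨ cong (ℕ._^ e) (square r) ⟩
      suc (4 ℕ.* (r ℕ.* suc r)) ℕ.^ e  ≡⟨ repunit-^ (4 ℕ.* (r ℕ.* suc r)) e ⟩
      suc (4 ℕ.* (r ℕ.* suc r) ℕ.* G)  ≡⟨ cong suc (regroup r G) ⟩
      suc (2 ℕ.* M)  ∎
      where
      open ≡-Reasoning
      rearrange : ∀ e d → e ℕ.* d ℕ.+ e ℕ.* d ≡ d ℕ.* 2 ℕ.* e
      rearrange = solve-∀
      square : ∀ r → suc (2 ℕ.* r) ℕ.^ 2 ≡ suc (4 ℕ.* (r ℕ.* suc r))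
      square r = trans (cong (suc (2 ℕ.* r) ℕ.*_) (ℕ.*-identityʳ _)) (square′ r)
        where
        square′ : ∀ r → suc (2 ℕ.* r) ℕ.* suc (2 ℕ.* r) ≡ suc (4 ℕ.* (r ℕ.* suc r))
        square′ = solve-∀
      regroup : ∀ r G → 4 ℕ.* (r ℕ.* suc r) ℕ.* G ≡ 2 ℕ.* (2 ℕ.* r ℕ.* (suc r ℕ.* G))
      regroup = solve-∀
    construct : ∀ n → M ≡ n → ∃[ ι ] (ι ≢ 0# × frob d ι ≡ - ι)
    construct zero M≡0 = contradiction (trans (sym size≡) (trans size≡2M+1 (cong (λ n → suc (2 ℕ.* n)) M≡0)))
      (ℕ.>⇒≢ (ℕ.^-monoʳ-< p 1<p {0} {k ℕ.+ k} (ℕ.<-≤-trans (ℕ.n≢0⇒n>0 k≢0) (ℕ.m≤m+n k k))))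
    construct (suc n) M≡ with ∃-^≢1 n (subst (suc (suc (suc n)) ℕ.≤_) (sym (trans size≡2M+1 (cong (λ n → suc (2 ℕ.* n)) M≡))) (s≤s (s≤s (ℕ.≤-trans (ℕ.≤-reflexive (sym (ℕ.+-identityʳ (suc n)))) (ℕ.m≤n+m (suc n ℕ.+ 0) n)))))
    ... | x , x≢0 , xᴹ≢1 = x ^ E , ^-nonzero E x≢0 , (begin
      (x ^ E) ^ (p ℕ.^ d)  ≡⟨ cong ((x ^ E) ^_) D≡ ⟩
      x ^ E * (x ^ E) ^ (2 ℕ.* r)  ≡⟨ cong (x ^ E *_) (trans (sym (^-* x (2 ℕ.* r) E)) (trans (cong (x ^_) M≡) xᴹ≡-1)) ⟩
      x ^ E * - 1#  ≡⟨ solve 1 (λ x → x :* (:- :1) := :- x) refl (x ^ E) ⟩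
      - (x ^ E)  ∎)
      where
      open ≡-Reasoning
      xᴹ≡-1 : x ^ suc n ≡ - 1#
      xᴹ≡-1 = case square-equal {x ^ suc n} {1#} (trans (sym (trans (^-* x 2 (suc n)) (cong (x ^ suc n *_) (x^1 _)))) (trans x²ᴹ≡1 (sym (*-identityˡ 1#)))) of λ
        { (inj₁ eq) → contradiction eq xᴹ≢1 ; (inj₂ eq) → eq }
        where
        x²ᴹ≡1 : x ^ (2 ℕ.* suc n) ≡ 1#
        x²ᴹ≡1 = *-cancelˡ x≢0 (trans (cong (x ^_) (trans (cong (λ n → suc (2 ℕ.* n)) (sym M≡)) (sym size≡2M+1))) (trans (^-size x) (sym (*-identityʳ x))))

  q-odd : ∃[ m ] p ℕ.^ k ≡ suc (2 ℕ.* m)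
  q-odd = odd-prime-power p-prime p≢2 k

  m₀ : ℕ
  m₀ = proj₁ q-odd

  q≡ : p ℕ.^ k ≡ suc (2 ℕ.* m₀)
  q≡ = proj₂ q-odd

  size≡q² : size ≡ suc (2 ℕ.* m₀) ℕ.* suc (2 ℕ.* m₀)
  size≡q² = trans size≡ (trans (ℕ.^-distribˡ-+-* p k k) (cong₂ ℕ._*_ q≡ q≡))

  m₀≢0 : m₀ ≢ 0
  m₀≢0 m₀≡0 = contradiction (trans q≡ (cong (λ n → suc (2 ℕ.* n)) m₀≡0)) (ℕ.>⇒≢ (ℕ.^-monoʳ-< p 1<p {0} {k} (ℕ.n≢0⇒n>0 k≢0)))

  real-^ : ∀ {a} → bar a ≡ a → a ≢ 0# → a ^ (2 ℕ.* m₀) ≡ 1#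
  real-^ {a} ā≡a a≢0 = *-cancelˡ a≢0 (trans (trans (cong (a ^_) (sym q≡)) ā≡a) (sym (*-identityʳ a)))

  -- The exponent in Euler's criterion for `K` is `(q² - 1) / 2 = ((q + 1) / 2) (q - 1)`, a multiple
  -- of `q - 1`, and `a^(q-1) = 1` for nonzero `a` in ℱ_q.
  real-√ : ∀ a → bar a ≡ a → ∃[ δ ] δ * δ ≡ a
  real-√ a ā≡a = case a ≟ 0# of λ
    { (yes a≡0) → 0# , trans (zeroˡ 0#) (sym a≡0)
    ; (no a≢0) → nonzero a≢0 _ refl }
    where
    exponent : ∀ m → suc (2 ℕ.* m) ℕ.* suc (2 ℕ.* m) ≡ suc (2 ℕ.* (suc m ℕ.* (2 ℕ.* m)))
    exponent = solve-∀
    nonzero : a ≢ 0# → ∀ n → n ≡ suc m₀ ℕ.* (2 ℕ.* m₀) → ∃[ δ ] δ * δ ≡ a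
    nonzero a≢0 zero eq = contradiction (case ℕ.m*n≡0⇒m≡0∨n≡0 (suc m₀) (sym eq) of λ { (inj₁ ()) ; (inj₂ eq′) → ℕ.m+n≡0⇒m≡0 m₀ eq′ }) m₀≢0
    nonzero a≢0 (suc n) eq = euler n a (trans size≡q² (trans (exponent m₀) (cong (λ n → suc (2 ℕ.* n)) (sym eq)))) a≢0
      (trans (cong (a ^_) eq) (trans (^-* a (suc m₀) (2 ℕ.* m₀)) (trans (cong (_^ suc m₀) (real-^ ā≡a a≢0)) (1^ (suc m₀)))))

  double-half : ∀ z → (1# + 1#) * (z * (1# + 1#) ⁻¹) ≡ z
  double-half z = trans (solve 3 (λ a z i → a :* (z :* i) := z :* (a :* i)) refl (1# + 1#) z _) (trans (cong (z *_) (*-inverseʳ 2≠0)) (*-identityʳ z))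

  half : Carrier → Carrier
  half z = z * (1# + 1#) ⁻¹

  frob-half : ∀ n z → frob n (half z) ≡ half (frob n z)
  frob-half n z = trans (E.*-homo z _) (cong (frob n z *_) (trans (E.⁻¹-homo 2≠0) (cong _⁻¹ (trans (E.+-homo 1# 1#) (cong₂ _+_ E.1-homo E.1-homo)))))
    where module E = IsEndomorphism (frob-isEndo n)

  module _ (ℓ : ℕ) where
    private
      φ = frob ℓ
      module Φ = IsEndomorphism (frob-isEndo ℓ)
      module Bar = IsEndomorphism (frob-isEndo k)

    -- The sum `z - φ z + φ² z - …` with `n` terms. Adding its image under `φ` telescopes to `z`
    -- plus or minus the `n`-fold image of `z`.
    alternating : ℕ → Carrier → Carrier
    alternating zero z = 0#
    alternating (suc n) z = z - φ (alternating n z)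

    private
      telescope : ∀ {n w} z → alternating n z + φ (alternating n z) ≡ z + w → alternating (suc n) z + φ (alternating (suc n) z) ≡ z - φ w
      telescope {n} {w} z eq = begin
        (z - φ A) + φ (z - φ A)  ≡⟨ cong ((z - φ A) +_) (trans (Φ.+-homo z _) (cong (φ z +_) (Φ.-homo (φ A)))) ⟩
        (z - φ A) + (φ z - φ (φ A))  ≡⟨ solve 4 (λ z a b c → (z :- a) :+ (b :- c) := z :+ (b :- (a :+ c))) refl z (φ A) (φ z) (φ (φ A)) ⟩
        z + (φ z - (φ A + φ (φ A)))  ≡⟨ cong (λ y → z + (φ z - y)) (Φ.+-homo A (φ A)) ⟨
        z + (φ z - φ (A + φ A))  ≡⟨ cong (λ y → z + (φ z - φ y)) eq ⟩
        z + (φ z - φ (z + w))  ≡⟨ cong (λ y → z + (φ z - y)) (Φ.+-homo z w) ⟩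
        z + (φ z - (φ z + φ w))  ≡⟨ solve 3 (λ z a b → z :+ (a :- (a :+ b)) := z :- b) refl z (φ z) (φ w) ⟩
        z - φ w  ∎
        where
        open ≡-Reasoning
        A = alternating n z

      alternating-even : ∀ j z → alternating (j ℕ.* 2) z + φ (alternating (j ℕ.* 2) z) ≡ z - frob (j ℕ.* 2 ℕ.* ℓ) z
      alternating-odd : ∀ j z → alternating (1 ℕ.+ j ℕ.* 2) z + φ (alternating (1 ℕ.+ j ℕ.* 2) z) ≡ z + frob ((1 ℕ.+ j ℕ.* 2) ℕ.* ℓ) z
      alternating-even zero z = trans (+-identityˡ _) (trans Φ.0-homo (sym (x≡y⇒x-y≡0 (sym (frob-0 z)))))
      alternating-even (suc j) z = trans (telescope {1 ℕ.+ j ℕ.* 2} z (alternating-odd j z)) (cong (λ y → z - y) (frob-∘ ℓ _ z))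
      alternating-odd j z = begin
        alternating (1 ℕ.+ j ℕ.* 2) z + φ (alternating (1 ℕ.+ j ℕ.* 2) z)  ≡⟨ telescope {j ℕ.* 2} z (alternating-even j z) ⟩
        z - φ (- frob (j ℕ.* 2 ℕ.* ℓ) z)  ≡⟨ cong (λ y → z - y) (Φ.-homo _) ⟩
        z - - φ (frob (j ℕ.* 2 ℕ.* ℓ) z)  ≡⟨ cong (z +_) (-‿involutive _) ⟩
        z + φ (frob (j ℕ.* 2 ℕ.* ℓ) z)  ≡⟨ cong (z +_) (frob-∘ ℓ _ z) ⟩
        z + frob ((1 ℕ.+ j ℕ.* 2) ℕ.* ℓ) z  ∎
        where open ≡-Reasoning

      alternating-real : ∀ n {z} → bar z ≡ z → bar (alternating n z) ≡ alternating n z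
      alternating-real zero z̄≡z = Bar.0-homo
      alternating-real (suc n) {z} z̄≡z = trans (Bar.+-homo z _) (cong₂ _+_ z̄≡z (trans (Bar.-homo _)
        (cong -_ (trans (frob-comm k ℓ (alternating n z)) (cong φ (alternating-real n z̄≡z))))))

    -- On ℱ_q the `e`-th iterate of `φ` is the identity, because `e ℓ` is a multiple of `k`. As `e`
    -- is odd, the alternating sum of `e` terms has trace `2 z`.
    trace-surjective : ∀ {e g} → (∃[ j ] e ≡ 1 ℕ.+ j ℕ.* 2) → e ℕ.* ℓ ≡ g ℕ.* k →
      ∀ z → bar z ≡ z → ∃[ s ] (bar s ≡ s × s + φ s ≡ z)
    trace-surjective {e} {g} (j , refl) eℓ≡gk z z̄≡z = half A , trans (frob-half k A) (cong half (alternating-real e z̄≡z)) , (begin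
      half A + φ (half A)  ≡⟨ cong (half A +_) (frob-half ℓ A) ⟩
      half A + half (φ A)  ≡⟨ distribʳ ((1# + 1#) ⁻¹) A (φ A) ⟨
      half (A + φ A)  ≡⟨ cong half (alternating-odd j z) ⟩
      half (z + frob (e ℕ.* ℓ) z)  ≡⟨ cong (λ y → half (z + y)) (trans (cong (λ n → frob n z) eℓ≡gk) (frob-fixed z̄≡z g)) ⟩
      half (z + z)  ≡⟨ cong half (solve 1 (λ z → z :+ z := :2 :* z) refl z) ⟩
      half ((1# + 1#) * z)  ≡⟨ *-assoc _ _ _ ⟩
      (1# + 1#) * half z  ≡⟨ double-half z ⟩
      z  ∎)
      where
      open ≡-Reasoning
      A = alternating e z

  module _ {d : ℕ} {ι : Carrier} (skew : frob d ι ≡ - ι) where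
    frob-skew-even : ∀ j → frob (j ℕ.* 2 ℕ.* d) ι ≡ ι
    frob-skew-odd : ∀ j → frob ((1 ℕ.+ j ℕ.* 2) ℕ.* d) ι ≡ - ι
    frob-skew-even zero = frob-0 ι
    frob-skew-even (suc j) = trans (sym (frob-∘ d _ ι)) (trans (cong (frob d) (frob-skew-odd j))
      (trans (IsEndomorphism.-homo (frob-isEndo d) ι) (trans (cong -_ skew) (-‿involutive ι))))
    frob-skew-odd j = trans (sym (frob-∘ d _ ι)) (trans (cong (frob d) (frob-skew-even j)) skew)

bézout : ∀ k ℓ → k ≢ 0 → ℓ ≢ 0 → ∃[ h ] ∃[ i ] h ℕ.* ℓ ≡ gcd k ℓ ℕ.+ i ℕ.* k
bézout zero _ k≢0 _ = contradiction refl k≢0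
bézout (suc _) zero _ ℓ≢0 = contradiction refl ℓ≢0
bézout k@(suc k′) ℓ@(suc ℓ′) _ _ with Bézout.identity (gcd-GCD k ℓ)
... | Bézout.-+ i h eq = h , i , sym eq
-- Here `x ℓ` is `- d` modulo `k`; multiplication by `k - 1`, which is `- 1` modulo `k`, corrects
-- the sign. The summand `k * d` keeps the second witness a natural number.
... | Bézout.+- y x eq = x ℕ.* k′ ℕ.+ k ℕ.* d , y ℕ.* k′ ℕ.+ d ℕ.* ℓ′ , (begin
  (x ℕ.* k′ ℕ.+ k ℕ.* d) ℕ.* ℓ  ≡⟨ expand x k′ d ℓ′ ⟩
  (d ℕ.+ x ℕ.* ℓ) ℕ.* k′ ℕ.+ (d ℕ.+ d ℕ.* ℓ′ ℕ.* k)  ≡⟨ cong (λ z → z ℕ.* k′ ℕ.+ (d ℕ.+ d ℕ.* ℓ′ ℕ.* k)) eq ⟩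
  y ℕ.* k ℕ.* k′ ℕ.+ (d ℕ.+ d ℕ.* ℓ′ ℕ.* k)  ≡⟨ collect y k′ d ℓ′ ⟩
  d ℕ.+ (y ℕ.* k′ ℕ.+ d ℕ.* ℓ′) ℕ.* k  ∎)
  where
  open ≡-Reasoning
  d = gcd k ℓ
  expand : ∀ x k′ d ℓ′ → (x ℕ.* k′ ℕ.+ suc k′ ℕ.* d) ℕ.* suc ℓ′ ≡ (d ℕ.+ x ℕ.* suc ℓ′) ℕ.* k′ ℕ.+ (d ℕ.+ d ℕ.* ℓ′ ℕ.* suc k′)
  expand = solve-∀
  collect : ∀ y k′ d ℓ′ → y ℕ.* suc k′ ℕ.* k′ ℕ.+ (d ℕ.+ d ℕ.* ℓ′ ℕ.* suc k′) ≡ d ℕ.+ (y ℕ.* k′ ℕ.+ d ℕ.* ℓ′) ℕ.* suc k′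
  collect = solve-∀

-- Separation of roots by the group of norm 1

module Separation (p : ℕ) (p-prime : Prime p) (p≢2 : p ≢ 2) (K : FiniteField) (k : ℕ)
  (size≡ : FiniteField.size K ≡ p ℕ.^ (k ℕ.+ k)) (k≢0 : k ≢ 0)
  (d e₂ r′ : ℕ) (d≢0 : d ≢ 0) (k≡ : k ≡ suc (suc (suc e₂)) ℕ.* d) (D≡ : p ℕ.^ d ≡ suc (2 ℕ.* suc r′)) where
  open FieldProperties K
  open Polynomials K
  open Endomorphisms K
  open Frobenius p p-prime p≢2 K k size≡ k≢0

  private
    r e₁ D S W s : ℕ
    r = suc r′
    e₁ = suc (suc e₂)
    D = suc (2 ℕ.* r)
    S = repunit D e₁
    W = D ℕ.^ e₁
    -- As `r` is a successor, `suc s` computes to `(D - 1)(q + 1)`; the polynomial lemmas take their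
    -- exponents in the form `suc s`.
    s = ℕ.pred (2 ℕ.* r ℕ.* suc (p ℕ.^ k))
    module Bar = IsEndomorphism (frob-isEndo k)

    q≡D^e : p ℕ.^ k ≡ D ℕ.^ suc e₁
    q≡D^e = trans (cong (p ℕ.^_) (trans k≡ (ℕ.*-comm (suc e₁) d))) (trans (sym (ℕ.^-*-assoc p d (suc e₁))) (cong (ℕ._^ suc e₁) D≡))

    m₀≡ : m₀ ≡ r ℕ.* (S ℕ.+ W)
    m₀≡ = ℕ.*-cancelˡ-≡ m₀ _ 2 (ℕ.suc-injective (begin
      suc (2 ℕ.* m₀)  ≡⟨ q≡ ⟨
      p ℕ.^ k  ≡⟨ q≡D^e ⟩
      D ℕ.^ suc e₁  ≡⟨ repunit-^ (2 ℕ.* r) (suc e₁) ⟩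
      suc (2 ℕ.* r ℕ.* repunit D (suc e₁))  ≡⟨ cong (λ n → suc (2 ℕ.* r ℕ.* n)) (repunit-suc D e₁) ⟩
      suc (2 ℕ.* r ℕ.* (S ℕ.+ W))  ≡⟨ cong suc (ℕ.*-assoc 2 r _) ⟩
      suc (2 ℕ.* (r ℕ.* (S ℕ.+ W)))  ∎))
      where open ≡-Reasoning

    -- This is where `e ≥ 3` enters: `S ≥ 2` keeps the factor `1 - w X^S` away from the coefficient
    -- of `X` in `root-unique`.
    S≡ : ∃[ j ] S ≡ suc (suc j)
    S≡ = _ , refl

    D×1≡0 : D ×.× 1# ≡ 0#
    D×1≡0 = trans (cong (×._× 1#) (sym D≡)) (power d d≢0)
      where
      power : ∀ n → n ≢ 0 → (p ℕ.^ n) ×.× 1# ≡ 0#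
      power zero n≢0 = contradiction refl n≢0
      power (suc n) _ = trans (×.×1-homo-* p (p ℕ.^ n)) (trans (cong (_* ((p ℕ.^ n) ×.× 1#)) p×1≡0) (zeroˡ _))

    -- The image of `(D - 1) / 2` in `K`, that is, `- 1 / 2`. As `S` is 1 modulo `D`, the exponents
    -- `r S` and `1 + r S` become `- 1 / 2` and `1 / 2`, and so are nonzero in `K`.
    X : Carrier
    X = r ×.× 1#

    1+2X≡0 : 1# + (1# + 1#) * X ≡ 0#
    1+2X≡0 = trans (cong (1# +_) (sym (trans (×.×1-homo-* 2 r) (cong (λ z → (1# + z) * X) (+-identityʳ 1#))))) D×1≡0

    rS×1≡X : (r ℕ.* S) ×.× 1# ≡ X
    rS×1≡X = trans (×.×1-homo-* r S) (trans (cong (X *_) S×1≡1) (*-identityʳ X))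
      where
      S×1≡1 : S ×.× 1# ≡ 1#
      S×1≡1 = trans (×.×-homo-+ 1# 1 (D ℕ.* repunit D (suc e₂)))
        (trans (cong₂ _+_ (+-identityʳ 1#) (trans (×.×1-homo-* D (repunit D (suc e₂))) (trans (cong (_* (repunit D (suc e₂) ×.× 1#)) D×1≡0) (zeroˡ _)))) (+-identityʳ 1#))

  -- The elements of ℱ_q of norm 1 over ℱ_{p^d}, presented as `(D - 1)`-th powers of norms from `K`.
  -- In this form a polynomial on `T` pulls back to one on all nonzero elements of `K`.
  T : Carrier → Set
  T z = ∃[ x ] (x ≢ 0# × z ≡ x ^ suc s)

  private
    -- suc s = (D - 1)(q + 1), so that x ^ suc s = t ^ (D - 1) with t the norm of x.
    base : Carrier → Carrier
    base x = x ^ suc (p ℕ.^ k)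

    base-real : ∀ x → bar (base x) ≡ base x
    base-real x = trans (Bar.*-homo x (bar x)) (trans (cong (bar x *_) (bar-involutive x)) (*-comm _ _))

    power-base : ∀ x → x ^ suc s ≡ base x ^ (2 ℕ.* r)
    power-base x = ^-* x (2 ℕ.* r) (suc (p ℕ.^ k))

    T-real : ∀ {z} → T z → bar z ≡ z
    T-real (x , _ , refl) = trans (cong bar (power-base x)) (trans (^-comm (base x) (2 ℕ.* r) (p ℕ.^ k))
      (trans (cong (_^ (2 ℕ.* r)) (base-real x)) (sym (power-base x))))

    base≢0 : ∀ {x} → x ≢ 0# → base x ≢ 0#
    base≢0 = ^-nonzero (suc (p ℕ.^ k))

    T-order : ∀ {z} → T z → z ^ S * z ^ W ≡ 1#
    T-order {z} (x , x≢0 , refl) = begin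
      z ^ S * z ^ W  ≡⟨ ^-+ z S W ⟨
      z ^ (S ℕ.+ W)  ≡⟨ cong (_^ (S ℕ.+ W)) (power-base x) ⟩
      (base x ^ (2 ℕ.* r)) ^ (S ℕ.+ W)  ≡⟨ ^-* (base x) (S ℕ.+ W) (2 ℕ.* r) ⟨
      base x ^ ((S ℕ.+ W) ℕ.* (2 ℕ.* r))  ≡⟨ cong (base x ^_) (trans (ℕ.*-comm (S ℕ.+ W) (2 ℕ.* r)) (trans (ℕ.*-assoc 2 r (S ℕ.+ W)) (cong (2 ℕ.*_) (sym m₀≡)))) ⟩
      base x ^ (2 ℕ.* m₀)  ≡⟨ real-^ (base-real x) (base≢0 x≢0) ⟩
      1#  ∎
      where open ≡-Reasoning

    ^W-homo : ∀ x y → (x - y) ^ W ≡ x ^ W - y ^ W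
    ^W-homo x y = trans (cong ((x - y) ^_) W≡) (trans (E.+-homo x (- y)) (trans (cong (x ^ (p ℕ.^ (d ℕ.* e₁)) +_) (E.-homo y))
      (sym (cong₂ (λ a b → x ^ a - y ^ b) W≡ W≡))))
      where
      W≡ : W ≡ p ℕ.^ (d ℕ.* e₁)
      W≡ = trans (cong (ℕ._^ e₁) (sym D≡)) (ℕ.^-*-assoc p d e₁)
      module E = IsEndomorphism (frob-isEndo (d ℕ.* e₁))

    -- For z ∈ T, (z - u)^W z^S = 1 - u^W z^S: this lowers the degree of (z - u)^(m₀ + ε) below the size S + W of T.
    lowered : ∀ ε {z} → T z → ∀ u → (z - u) ^ (ε ℕ.+ m₀) * (z ^ S) ^ r ≡ (z - u) ^ (ε ℕ.+ r ℕ.* S) * (1# - u ^ W * z ^ S) ^ r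
    lowered ε {z} tz u = begin
      (z - u) ^ (ε ℕ.+ m₀) * (z ^ S) ^ r
        ≡⟨ cong (λ n → (z - u) ^ n * (z ^ S) ^ r) (trans (cong (ε ℕ.+_) (trans m₀≡ (ℕ.*-distribˡ-+ r S W))) (sym (ℕ.+-assoc ε _ _))) ⟩
      (z - u) ^ (ε ℕ.+ r ℕ.* S ℕ.+ r ℕ.* W) * (z ^ S) ^ r
        ≡⟨ cong (_* (z ^ S) ^ r) (trans (^-+ (z - u) (ε ℕ.+ r ℕ.* S) (r ℕ.* W)) (cong ((z - u) ^ (ε ℕ.+ r ℕ.* S) *_) (^-* (z - u) r W))) ⟩
      (z - u) ^ (ε ℕ.+ r ℕ.* S) * ((z - u) ^ W) ^ r * (z ^ S) ^ r
        ≡⟨ trans (*-assoc _ _ _) (cong ((z - u) ^ (ε ℕ.+ r ℕ.* S) *_) (sym (^-distrib-* ((z - u) ^ W) (z ^ S) r))) ⟩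
      (z - u) ^ (ε ℕ.+ r ℕ.* S) * ((z - u) ^ W * z ^ S) ^ r
        ≡⟨ cong (λ y → (z - u) ^ (ε ℕ.+ r ℕ.* S) * y ^ r) (begin
             (z - u) ^ W * z ^ S  ≡⟨ cong (_* z ^ S) (^W-homo z u) ⟩
             (z ^ W - u ^ W) * z ^ S  ≡⟨ solve 3 (λ a b c → (a :- b) :* c := c :* a :- b :* c) refl (z ^ W) (u ^ W) (z ^ S) ⟩
             z ^ S * z ^ W - u ^ W * z ^ S  ≡⟨ cong (_- u ^ W * z ^ S) (T-order tz) ⟩
             1# - u ^ W * z ^ S  ∎) ⟩
      (z - u) ^ (ε ℕ.+ r ℕ.* S) * (1# - u ^ W * z ^ S) ^ r  ∎
      where open ≡-Reasoning

    -- The first factor is `ε + W`, because `1 + 2 r S = W`; it is at most `S + W`, the order of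
    -- `T`, and `(S + W) (s + 1) = q² - 1`.
    size-bound : ∀ ε → ε ℕ.≤ 1 → suc (ε ℕ.+ r ℕ.* S ℕ.+ r ℕ.* S) ℕ.* suc s ℕ.< size
    size-bound ε ε≤1 = ℕ.≤-<-trans (ℕ.*-monoˡ-≤ (suc s) (begin
        suc (ε ℕ.+ r ℕ.* S ℕ.+ r ℕ.* S)  ≡⟨ rearrange ε r S ⟩
        ε ℕ.+ suc (2 ℕ.* r ℕ.* S)  ≡⟨ cong (ε ℕ.+_) (repunit-^ (2 ℕ.* r) e₁) ⟨
        ε ℕ.+ W                           ≤⟨ ℕ.+-monoˡ-≤ W {ε} {S} (ℕ.≤-trans ε≤1 (s≤s z≤n)) ⟩
        S ℕ.+ W  ∎)) (begin-strict
      (S ℕ.+ W) ℕ.* suc s  ≡⟨⟩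
      (S ℕ.+ W) ℕ.* (2 ℕ.* r ℕ.* suc (p ℕ.^ k))  ≡⟨ regroup (S ℕ.+ W) r (suc (p ℕ.^ k)) ⟩
      2 ℕ.* (r ℕ.* (S ℕ.+ W)) ℕ.* suc (p ℕ.^ k)  ≡⟨ cong₂ (λ a b → 2 ℕ.* a ℕ.* suc b) (sym m₀≡) q≡ ⟩
      2 ℕ.* m₀ ℕ.* suc (suc (2 ℕ.* m₀))                 <⟨ ℕ.≤-refl ⟩
      suc (2 ℕ.* m₀ ℕ.* suc (suc (2 ℕ.* m₀)))  ≡⟨ square (2 ℕ.* m₀) ⟩
      suc (2 ℕ.* m₀) ℕ.* suc (2 ℕ.* m₀)  ≡⟨ size≡q² ⟨
      size  ∎)
      where
      open ℕ.≤-Reasoning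
      rearrange : ∀ ε r S → suc (ε ℕ.+ r ℕ.* S ℕ.+ r ℕ.* S) ≡ ε ℕ.+ suc (2 ℕ.* r ℕ.* S)
      rearrange = solve-∀
      regroup : ∀ a r b → a ℕ.* (2 ℕ.* r ℕ.* b) ≡ 2 ℕ.* (r ℕ.* a) ℕ.* b
      regroup = solve-∀
      square : ∀ a → suc (a ℕ.* suc (suc a)) ≡ suc a ℕ.* suc a
      square = solve-∀

    -- The values 0 and 1 of `ε` give the exponents `(q - 1) / 2` and `(q + 1) / 2`. Multiplying
    -- both sides by `z^(S r)` and applying `lowered` leads to `root-unique`.
    separate : ∀ ε → ε ℕ.≤ 1 → (ε ℕ.+ r ℕ.* S) ×.× 1# ≢ 0# → ∀ {u v κ} → u ≢ 0# → v ≢ 0# →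
      (∀ z → T z → (z - u) ^ (ε ℕ.+ m₀) ≡ κ * (z - v) ^ (ε ℕ.+ m₀)) → u ≡ v
    separate ε ε≤1 m×1≢0 {u} {v} {κ} u≢0 v≢0 agree = root-unique s (ε ℕ.+ r ℕ.* S) r (proj₁ S≡) (size-bound ε ε≤1) m×1≢0 u≢0 v≢0
      λ x x≢0 → let z = x ^ suc s; tz = x , x≢0 , refl in begin
        (z - u) ^ (ε ℕ.+ r ℕ.* S) * (1# - u ^ W * z ^ S) ^ r  ≡⟨ lowered ε tz u ⟨
        (z - u) ^ (ε ℕ.+ m₀) * (z ^ S) ^ r  ≡⟨ cong (_* (z ^ S) ^ r) (agree z tz) ⟩
        κ * (z - v) ^ (ε ℕ.+ m₀) * (z ^ S) ^ r  ≡⟨ *-assoc _ _ _ ⟩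
        κ * ((z - v) ^ (ε ℕ.+ m₀) * (z ^ S) ^ r)  ≡⟨ cong (κ *_) (lowered ε tz v) ⟩
        κ * ((z - v) ^ (ε ℕ.+ r ℕ.* S) * (1# - v ^ W * z ^ S) ^ r)  ∎
      where open ≡-Reasoning

  -- A nonzero square of ℱ_q has `m₀`-th power 1, so `κ (z - u)^m₀ (z - v)^m₀ = 1` on `T`. For real
  -- roots `κ` and `(z - v)^m₀` are signs and can change sides. For conjugate roots
  -- `(z - u)^q = z - v`, and multiplication by `(z - u)^(m₀ + 1)` gives the relation with exponent
  -- `m₀ + 1`.
  T-separates : ∀ {a u v} → a ≢ 0# → bar a ≡ a → u ≢ 0# → v ≢ 0# → (bar u ≡ u × bar v ≡ v) ⊎ bar u ≡ v →
    (∀ z → T z → ∃[ δ ] (bar δ ≡ δ × δ ≢ 0# × δ * δ ≡ a * ((z - u) * (z - v)))) → u ≡ v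
  T-separates {a} {u} {v} a≢0 ā≡a u≢0 v≢0 real-or-conj squares = by-cases real-or-conj
    where
    open ≡-Reasoning
    κ = a ^ m₀
    product : ∀ z → T z → κ * ((z - u) ^ m₀ * (z - v) ^ m₀) ≡ 1#
    product z tz with squares z tz
    ... | δ , δ̄≡δ , δ≢0 , δ²≡ = begin
      a ^ m₀ * ((z - u) ^ m₀ * (z - v) ^ m₀)  ≡⟨ trans (^-distrib-* a _ m₀) (cong (a ^ m₀ *_) (^-distrib-* (z - u) (z - v) m₀)) ⟨
      (a * ((z - u) * (z - v))) ^ m₀  ≡⟨ cong (_^ m₀) δ²≡ ⟨
      (δ * δ) ^ m₀  ≡⟨ trans (^-distrib-* δ δ m₀) (sym (^-+ δ m₀ m₀)) ⟩
      δ ^ (m₀ ℕ.+ m₀)  ≡⟨ cong (λ n → δ ^ (m₀ ℕ.+ n)) (ℕ.+-identityʳ m₀) ⟨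
      δ ^ (2 ℕ.* m₀)  ≡⟨ real-^ δ̄≡δ δ≢0 ⟩
      1#  ∎
    z-v≢0 : ∀ z → T z → z - v ≢ 0#
    z-v≢0 z tz eq with squares z tz
    ... | δ , _ , δ≢0 , δ²≡ = *-nonzero δ≢0 δ≢0 (trans δ²≡ (trans (cong (λ y → a * ((z - u) * y)) eq)
      (solve 2 (λ a b → a :* (b :* :0) := :0) refl a (z - u))))
    split : ∀ {y} → bar y ≡ y → y ≢ 0# → y ^ m₀ * y ^ m₀ ≡ 1#
    split {y} ȳ≡y y≢0 = trans (sym (^-+ y m₀ m₀)) (trans (cong (λ n → y ^ (m₀ ℕ.+ n)) (sym (ℕ.+-identityʳ m₀))) (real-^ ȳ≡y y≢0))
    bar-sub : ∀ {z} → T z → ∀ w → bar (z - w) ≡ z - bar w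
    bar-sub {z} tz w = trans (Bar.+-homo z _) (cong₂ _+_ (T-real tz) (Bar.-homo w))
    by-cases : (bar u ≡ u × bar v ≡ v) ⊎ bar u ≡ v → u ≡ v
    by-cases (inj₁ (_ , v̄≡v)) = separate 0 z≤n (λ eq → 1≢0 (begin
        1#  ≡⟨ solve 1 (λ x → :1 := :1 :+ :2 :* x :- :2 :* x) refl X ⟩
        1# + (1# + 1#) * X - (1# + 1#) * X  ≡⟨ cong₂ (λ a b → a - (1# + 1#) * b) 1+2X≡0 (trans (sym rS×1≡X) eq) ⟩
        0# - (1# + 1#) * 0#  ≡⟨ solve 0 (:0 :- :2 :* :0 := :0) refl ⟩
        0#  ∎)) u≢0 v≢0 λ z tz → begin
      (z - u) ^ m₀  ≡⟨ *-identityʳ _ ⟨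
      (z - u) ^ m₀ * 1#  ≡⟨ cong ((z - u) ^ m₀ *_) (trans (cong₂ _*_ (split ā≡a a≢0) (split (trans (bar-sub tz v) (cong (λ w → z - w) v̄≡v)) (z-v≢0 z tz))) (*-identityˡ 1#)) ⟨
      (z - u) ^ m₀ * (κ * κ * ((z - v) ^ m₀ * (z - v) ^ m₀))  ≡⟨ solve 3 (λ x k y → x :* (k :* k :* (y :* y)) := k :* (x :* y) :* (k :* y)) refl ((z - u) ^ m₀) κ ((z - v) ^ m₀) ⟩
      κ * ((z - u) ^ m₀ * (z - v) ^ m₀) * (κ * (z - v) ^ m₀)  ≡⟨ trans (cong (_* (κ * (z - v) ^ m₀)) (product z tz)) (*-identityˡ _) ⟩
      κ * (z - v) ^ m₀  ∎
    by-cases (inj₂ ū≡v) = separate 1 (s≤s z≤n) (λ eq → 1≢0 (begin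
        1#  ≡⟨ solve 1 (λ x → :1 := :2 :* (:1 :+ x) :- (:1 :+ :2 :* x)) refl X ⟩
        (1# + 1#) * (1# + X) - (1# + (1# + 1#) * X)  ≡⟨ cong₂ (λ a b → (1# + 1#) * a - b) (trans (cong (1# +_) (sym rS×1≡X)) eq) 1+2X≡0 ⟩
        (1# + 1#) * 0# - 0#  ≡⟨ solve 0 (:2 :* :0 :- :0 := :0) refl ⟩
        0#  ∎)) u≢0 v≢0 λ z tz → begin
      (z - u) * (z - u) ^ m₀  ≡⟨ trans (cong (_* ((z - u) * (z - u) ^ m₀)) (product z tz)) (*-identityˡ _) ⟨
      κ * ((z - u) ^ m₀ * (z - v) ^ m₀) * ((z - u) * (z - u) ^ m₀)  ≡⟨ solve 4 (λ k x y w → k :* (x :* y) :* (w :* x) := k :* ((w :* (x :* x)) :* y)) refl κ ((z - u) ^ m₀) ((z - v) ^ m₀) (z - u) ⟩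
      κ * ((z - u) * ((z - u) ^ m₀ * (z - u) ^ m₀) * (z - v) ^ m₀)  ≡⟨ cong (λ y → κ * (y * (z - v) ^ m₀)) (begin
          (z - u) * ((z - u) ^ m₀ * (z - u) ^ m₀)  ≡⟨ cong ((z - u) *_) (trans (sym (^-+ (z - u) m₀ m₀)) (cong (λ n → (z - u) ^ (m₀ ℕ.+ n)) (sym (ℕ.+-identityʳ m₀)))) ⟩
          (z - u) ^ suc (2 ℕ.* m₀)  ≡⟨ cong ((z - u) ^_) q≡ ⟨
          bar (z - u)  ≡⟨ trans (bar-sub tz u) (cong (λ w → z - w) ū≡v) ⟩
          z - v  ∎) ⟩
      κ * ((z - v) * (z - v) ^ m₀)  ∎

  module _ {ℓ h i : ℕ} (bezout : h ℕ.* ℓ ≡ d ℕ.+ i ℕ.* k) where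
    private
      φ = frob ℓ
      module Φ = IsEndomorphism (frob-isEndo ℓ)

      partial-norm : ℕ → Carrier → Carrier
      partial-norm zero t = 1#
      partial-norm (suc n) t = t * φ (partial-norm n t)

      partial-norm-shift : ∀ n t → t * φ (partial-norm n t) ≡ partial-norm n t * frob (n ℕ.* ℓ) t
      partial-norm-shift zero t = trans (trans (cong (t *_) Φ.1-homo) (*-identityʳ t)) (sym (trans (*-identityˡ _) (frob-0 t)))
      partial-norm-shift (suc n) t = begin
        t * φ (t * φ (partial-norm n t))  ≡⟨ cong (λ y → t * φ y) (partial-norm-shift n t) ⟩
        t * φ (partial-norm n t * frob (n ℕ.* ℓ) t)  ≡⟨ cong (t *_) (Φ.*-homo _ _) ⟩
        t * (φ (partial-norm n t) * φ (frob (n ℕ.* ℓ) t))  ≡⟨ *-assoc _ _ _ ⟨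
        t * φ (partial-norm n t) * φ (frob (n ℕ.* ℓ) t)  ≡⟨ cong (t * φ (partial-norm n t) *_) (frob-∘ ℓ (n ℕ.* ℓ) t) ⟩
        t * φ (partial-norm n t) * frob (suc n ℕ.* ℓ) t  ∎
        where open ≡-Reasoning

      partial-norm-real : ∀ n {t} → bar t ≡ t → bar (partial-norm n t) ≡ partial-norm n t
      partial-norm-real zero _ = Bar.1-homo
      partial-norm-real (suc n) {t} t̄≡t = trans (Bar.*-homo t _) (cong₂ _*_ t̄≡t (trans (frob-comm k ℓ (partial-norm n t)) (cong φ (partial-norm-real n t̄≡t))))

      partial-norm≢0 : ∀ n {t} → t ≢ 0# → partial-norm n t ≢ 0#
      partial-norm≢0 zero _ = 1≢0
      partial-norm≢0 (suc n) t≢0 = *-nonzero t≢0 (Φ.nonzero (partial-norm≢0 n t≢0))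

    -- For `y = t φ(t) …` with `h` factors, `φ y / y` telescopes to the `h`-fold image of `t`
    -- divided by `t`. By `bezout` this image is `t^D` for `t` in ℱ_q, so the quotient is
    -- `t^(D - 1) = z`.
    T⇒ratio : ∀ {z} → T z → bar z ≡ z × ∃[ y ] (bar y ≡ y × y ≢ 0# × φ y ≡ z * y)
    T⇒ratio {z} tz@(x , x≢0 , refl) = T-real tz , y , partial-norm-real h (base-real x) , partial-norm≢0 h t≢0 , *-cancelˡ t≢0 (begin
      t * φ y  ≡⟨ partial-norm-shift h t ⟩
      y * frob (h ℕ.* ℓ) t  ≡⟨ cong (λ n → y * frob n t) bezout ⟩
      y * frob (d ℕ.+ i ℕ.* k) t  ≡⟨ cong (y *_) (trans (sym (frob-∘ d (i ℕ.* k) t)) (cong (frob d) (frob-fixed (base-real x) i))) ⟩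
      y * t ^ (p ℕ.^ d)  ≡⟨ cong (λ n → y * t ^ n) D≡ ⟩
      y * (t * t ^ (2 ℕ.* r))  ≡⟨ cong (λ w → y * (t * w)) (power-base x) ⟨
      y * (t * z)  ≡⟨ solve 3 (λ y t z → y :* (t :* z) := t :* (z :* y)) refl y t z ⟩
      t * (z * y)  ∎)
      where
      open ≡-Reasoning
      t = base x
      t≢0 = base≢0 x≢0
      y = partial-norm h t

-- Planarity of the three models and linear equivalence

module Equivalences (p : ℕ) (p-prime : Prime p) (p≢2 : p ≢ 2) (K : FiniteField) (k : ℕ)
  (size≡ : FiniteField.size K ≡ p ℕ.^ (k ℕ.+ k)) (k≢0 : k ≢ 0) (ℓ : ℕ) where
  open FieldProperties K
  open Endomorphisms K
  open Frobenius p p-prime p≢2 K k size≡ k≢0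

  q Q : ℕ
  q = p ℕ.^ k
  Q = p ℕ.^ ℓ

  φ : Carrier → Carrier
  φ = frob ℓ

  private
    module Bar = IsEndomorphism (frob-isEndo k)
    module Φ = IsEndomorphism (frob-isEndo ℓ)

  ∃ι₀ : ∃[ ι ] (ι ≢ 0# × bar ι ≡ - ι)
  ∃ι₀ = ∃-skew k 1 (sym (ℕ.*-identityˡ k))

  ι₀ : Carrier
  ι₀ = proj₁ ∃ι₀

  ι₀≢0 : ι₀ ≢ 0#
  ι₀≢0 = proj₁ (proj₂ ∃ι₀)

  bar-ι₀ : bar ι₀ ≡ - ι₀
  bar-ι₀ = proj₂ (proj₂ ∃ι₀)

  open QuadraticForms 2≠0 bar (frob-isEndo k) bar-involutive ι₀ ι₀≢0 bar-ι₀
    using (det; bar-det; N; bar-N; x≡-x⇒x≡0)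

  injective⇒bijective : ∀ {f : Carrier → Carrier} → Injective _≡_ _≡_ f → Bijective _≡_ _≡_ f
  injective⇒bijective {f} inj = inj , λ y → let x , fx≡y = injective⇒surjective f inj y in x , λ { refl → fx≡y }

  -- For `fc` this is planarity, in a form that mentions no coefficients and is carried along
  -- directly by linear equivalences.
  NonAdditive : (Carrier → Carrier) → Set
  NonAdditive f = ∀ a x → a ≢ 0# → f (a + x) ≡ f a + f x → x ≡ 0#

  NonAdditive-resp : ∀ {f g} → (∀ x → f x ≡ g x) → NonAdditive f → NonAdditive g
  NonAdditive-resp eq na a x a≢0 h = na a x a≢0 (trans (eq _) (trans h (sym (cong₂ _+_ (eq a) (eq x)))))

  additive-0 : ∀ {L : Carrier → Carrier} → Additive K L → L 0# ≡ 0#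
  additive-0 {L} add = x+x≈x⇒x≈0 _ (trans (sym (add 0# 0#)) (cong L (+-identityˡ 0#)))

  linEquiv⇒nonAdditive : ∀ {f g} → LinEquivKK K f g → NonAdditive g → NonAdditive f
  linEquiv⇒nonAdditive {f} {g} (L₁ , L₂ , add₁ , _ , add₂ , (_ , surj₂) , eq) na a x a≢0 h = begin
    x  ≡⟨ L₂v ⟨
    L₂ v  ≡⟨ cong L₂ (na u v u≢0 additive) ⟩
    L₂ 0#  ≡⟨ additive-0 add₂ ⟩
    0#  ∎
    where
    open ≡-Reasoning
    u = proj₁ (surj₂ a)
    v = proj₁ (surj₂ x)
    L₂u : L₂ u ≡ a
    L₂u = proj₂ (surj₂ a) refl
    L₂v : L₂ v ≡ x
    L₂v = proj₂ (surj₂ x) refl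
    u≢0 : u ≢ 0#
    u≢0 u≡0 = a≢0 (trans (sym L₂u) (trans (cong L₂ u≡0) (additive-0 add₂)))
    additive : g (u + v) ≡ g u + g v
    additive = begin
      g (u + v)  ≡⟨ trans (eq (u + v)) (cong (L₁ ∘ f) (trans (add₂ u v) (cong₂ _+_ L₂u L₂v))) ⟩
      L₁ (f (a + x))  ≡⟨ trans (cong L₁ h) (add₁ (f a) (f x)) ⟩
      L₁ (f a) + L₁ (f x)  ≡⟨ cong₂ _+_ (trans (eq u) (cong (L₁ ∘ f) L₂u)) (trans (eq v) (cong (L₁ ∘ f) L₂v)) ⟨
      g u + g v  ∎

  fc-formula : ∀ c₀ c₁ c₂ c₃ x → fc K q Q (c₀ , c₁ , c₂ , c₃) x
    ≡ (c₃ * φ x + c₁ * bar (φ x)) * x + (c₂ * φ x + c₀ * bar (φ x)) * bar x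
  fc-formula c₀ c₁ c₂ c₃ x = begin
    c₀ * x ^ (q ℕ.* Q ℕ.+ q) + c₁ * x ^ (q ℕ.* Q ℕ.+ 1) + c₂ * x ^ (Q ℕ.+ q) + c₃ * x ^ (Q ℕ.+ 1)
      ≡⟨ cong₂ _+_ (cong₂ _+_ (cong₂ (λ a b → c₀ * a + c₁ * b)
           (trans (^-+ x (q ℕ.* Q) q) (cong (_* bar x) (^-* x q Q)))
           (trans (^-+ x (q ℕ.* Q) 1) (cong₂ _*_ (^-* x q Q) (x^1 x))))
           (cong (c₂ *_) (^-+ x Q q))) (cong (c₃ *_) (trans (^-+ x Q 1) (cong (φ x *_) (x^1 x)))) ⟩
    c₀ * (bar (φ x) * bar x) + c₁ * (bar (φ x) * x) + c₂ * (φ x * bar x) + c₃ * (φ x * x)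
      ≡⟨ solve 8 (λ c₀ c₁ c₂ c₃ s s̄ x x̄ → c₀ :* (s̄ :* x̄) :+ c₁ :* (s̄ :* x) :+ c₂ :* (s :* x̄) :+ c₃ :* (s :* x)
           := (c₃ :* s :+ c₁ :* s̄) :* x :+ (c₂ :* s :+ c₀ :* s̄) :* x̄) refl c₀ c₁ c₂ c₃ (φ x) (bar (φ x)) x (bar x) ⟩
    (c₃ * φ x + c₁ * bar (φ x)) * x + (c₂ * φ x + c₀ * bar (φ x)) * bar x  ∎
    where open ≡-Reasoning

  x^[Q+1] : ∀ x → x ^ (Q ℕ.+ 1) ≡ φ x * x
  x^[Q+1] x = trans (^-+ x Q 1) (cong (φ x *_) (x^1 x))

  cross-term : ∀ {f f′ : Carrier → Carrier} → (∀ x y → f (x + y) ≡ f x + f y) → (∀ x y → f′ (x + y) ≡ f′ x + f′ y) →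
    ∀ a x → f (a + x) * f′ (a + x) ≡ f a * f′ a + f x * f′ x → f a * f′ x + f x * f′ a ≡ 0#
  cross-term {f} {f′} add add′ a x h = trans
    (solve 4 (λ a x b y → a :* y :+ x :* b := (a :+ x) :* (b :+ y) :- (a :* b :+ x :* y)) refl (f a) (f x) (f′ a) (f′ x))
    (x≡y⇒x-y≡0 (trans (sym (cong₂ _*_ (add a x) (add′ a x))) h))

  -- Dividing the hypothesis by `f a * a` leaves `w + f w = 0` for `w = x / a`.
  skew-quotient : ∀ {f : Carrier → Carrier} → IsEndomorphism f → ∀ {a x} → a ≢ 0# → f a * x + f x * a ≡ 0# → f (x * a ⁻¹) ≡ - (x * a ⁻¹)
  skew-quotient {f} f-endo {a} {x} a≢0 h = *-cancelˡ (*-nonzero (E.nonzero a≢0) a≢0) (begin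
    f a * a * f (x * a ⁻¹)  ≡⟨ cong (f a * a *_) (trans (E.*-homo x _) (cong (f x *_) (E.⁻¹-homo a≢0))) ⟩
    f a * a * (f x * f a ⁻¹)  ≡⟨ solve 4 (λ p a y i → p :* a :* (y :* i) := y :* a :* (p :* i)) refl (f a) a (f x) (f a ⁻¹) ⟩
    f x * a * (f a * f a ⁻¹)  ≡⟨ trans (cong (f x * a *_) (*-inverseʳ (E.nonzero a≢0))) (*-identityʳ _) ⟩
    f x * a  ≡⟨ x+y≡0⇒x≡-y (trans (+-comm _ _) h) ⟩
    - (f a * x)  ≡⟨ cong -_ (trans (sym (*-identityʳ _)) (cong (f a * x *_) (sym (*-inverseʳ a≢0)))) ⟩
    - (f a * x * (a * a ⁻¹))  ≡⟨ solve 4 (λ p x a i → :- (p :* x :* (a :* i)) := p :* a :* (:- (x :* i))) refl (f a) x a (a ⁻¹) ⟩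
    f a * a * - (x * a ⁻¹)  ∎)
    where
    open ≡-Reasoning
    module E = IsEndomorphism f-endo

  quotient-zero : ∀ {a x} → a ≢ 0# → x * a ⁻¹ ≡ 0# → x ≡ 0#
  quotient-zero {a} {x} a≢0 eq = trans (sym (*-identityʳ x)) (trans (cong (x *_) (sym (*-inverseˡ a≢0)))
    (trans (sym (*-assoc x _ a)) (trans (cong (_* a) eq) (zeroˡ a))))

  -- An odd number of sign changes turns `w` into `- w`.
  frob-skew⇒0 : ∀ {m e w} → (∃[ j ] e ≡ 1 ℕ.+ j ℕ.* 2) → frob m w ≡ - w → frob (e ℕ.* m) w ≡ w → w ≡ 0#
  frob-skew⇒0 {m} (j , refl) skew fixed = x≡-x⇒x≡0 (trans (sym fixed) (frob-skew-odd {m} skew j))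

  frob-even-multiple : ∀ j x → frob (j ℕ.* 2 ℕ.* k) x ≡ x
  frob-even-multiple j x = trans (cong (λ n → frob n x) (regroup j k)) (frob-fixed (frob-2k x) j)
    where
    regroup : ∀ j k → j ℕ.* 2 ℕ.* k ≡ j ℕ.* (k ℕ.+ k)
    regroup = solve-∀

  module _ {e g : ℕ} (eℓ≡gk : e ℕ.* ℓ ≡ g ℕ.* k) (e-odd : ∃[ j ] e ≡ 1 ℕ.+ j ℕ.* 2) where

    -- For even `g`, `e ℓ = g k` is a multiple of `2 k`, so the `e`-th iterate of `φ` is the
    -- identity on all of `K`, whereas it negates `x / a`.
    nonAdditive-X^[Q+1] : (∃[ j ] g ≡ j ℕ.* 2) → NonAdditive (λ x → x ^ (Q ℕ.+ 1))
    nonAdditive-X^[Q+1] (j , refl) a x a≢0 h = quotient-zero a≢0 (frob-skew⇒0 {ℓ} {e} e-odd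
      (skew-quotient (frob-isEndo ℓ) a≢0 (cross-term {φ} {λ x → x} Φ.+-homo (λ _ _ → refl) a x
        (trans (sym (x^[Q+1] _)) (trans h (cong₂ _+_ (x^[Q+1] a) (x^[Q+1] x))))))
      (trans (cong (λ n → frob n (x * a ⁻¹)) eℓ≡gk) (frob-even-multiple j (x * a ⁻¹))))

    -- Conjugating the cross term replaces `φ` by the Frobenius power of index `ℓ + k`. Its `e`-th
    -- iterate is trivial on `K`, since `e (ℓ + k) = (g + e) k` and `g + e` is even.
    nonAdditive-X^[Q+q] : (∃[ j ] g ≡ 1 ℕ.+ j ℕ.* 2) → NonAdditive (λ x → x ^ (Q ℕ.+ q))
    nonAdditive-X^[Q+q] (j , refl) a x a≢0 h = quotient-zero a≢0 (frob-skew⇒0 {ℓ ℕ.+ k} {e} e-odd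
      (skew-quotient (frob-isEndo (ℓ ℕ.+ k)) a≢0 conjugated)
      (trans (cong (λ n → frob n (x * a ⁻¹)) (even e-odd)) (frob-even-multiple (suc (j ℕ.+ proj₁ e-odd)) (x * a ⁻¹))))
      where
      open ≡-Reasoning
      cross : φ a * bar x + φ x * bar a ≡ 0#
      cross = cross-term {φ} {bar} Φ.+-homo Bar.+-homo a x (trans (sym (^-+ _ Q q)) (trans h (cong₂ _+_ (^-+ a Q q) (^-+ x Q q))))
      conjugated : frob (ℓ ℕ.+ k) a * x + frob (ℓ ℕ.+ k) x * a ≡ 0#
      conjugated = begin
        frob (ℓ ℕ.+ k) a * x + frob (ℓ ℕ.+ k) x * a  ≡⟨ cong₂ _+_ (cong₂ _*_ (shift a) (bar-involutive x)) (cong₂ _*_ (shift x) (bar-involutive a)) ⟨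
        bar (φ a) * bar (bar x) + bar (φ x) * bar (bar a) ≡⟨ trans (Bar.+-homo _ _) (cong₂ _+_ (Bar.*-homo _ _) (Bar.*-homo _ _)) ⟨
        bar (φ a * bar x + φ x * bar a)  ≡⟨ trans (cong bar cross) Bar.0-homo ⟩
        0#  ∎
        where
        shift : ∀ y → bar (φ y) ≡ frob (ℓ ℕ.+ k) y
        shift y = trans (frob-∘ k ℓ y) (cong (λ n → frob n y) (ℕ.+-comm k ℓ))
      even : (odd : ∃[ i ] e ≡ 1 ℕ.+ i ℕ.* 2) → e ℕ.* (ℓ ℕ.+ k) ≡ suc (j ℕ.+ proj₁ odd) ℕ.* 2 ℕ.* k
      even (i , e≡) = trans (ℕ.*-distribˡ-+ e ℓ k) (trans (cong₂ ℕ._+_ eℓ≡gk (cong (ℕ._* k) e≡)) (regroup i j k))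
        where
        regroup : ∀ i j k → (1 ℕ.+ j ℕ.* 2) ℕ.* k ℕ.+ (1 ℕ.+ i ℕ.* 2) ℕ.* k ≡ suc (j ℕ.+ i) ℕ.* 2 ℕ.* k
        regroup = solve-∀

    real-skew⇒0 : ∀ {w} → bar w ≡ w → φ w ≡ - w → w ≡ 0#
    real-skew⇒0 {w} w̄≡w skew = frob-skew⇒0 {ℓ} {e} e-odd skew (trans (cong (λ n → frob n w) eℓ≡gk) (frob-fixed w̄≡w g))

  nonAdditive-X² : NonAdditive (λ x → x ^ 2)
  nonAdditive-X² a x a≢0 h = no-zero-divisors (no-zero-divisors (begin
    (1# + 1#) * (a * x)  ≡⟨ solve 2 (λ a x → :2 :* (a :* x) := (a :+ x) :* ((a :+ x) :* :1) :- (a :* (a :* :1) :+ x :* (x :* :1))) refl a x ⟩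
    (a + x) ^ 2 - (a ^ 2 + x ^ 2)  ≡⟨ x≡y⇒x-y≡0 h ⟩
    0#  ∎) 2≠0) a≢0
    where open ≡-Reasoning

  -- The proof component is unique because equality on `K` is decidable.
  Sub-≡ : {x y : Sub K q} → proj₁ x ≡ proj₁ y → x ≡ y
  Sub-≡ {x , x∈} {.x , x∈′} refl = cong (x ,_) (Decidable⇒UIP.≡-irrelevant _≟_ x∈ x∈′)

  Pair-≡ : {u v : Pair K q} → emb K q u ≡ emb K q v → u ≡ v
  Pair-≡ {u₁ , u₂} {v₁ , v₂} eq = cong₂ _,_ (Sub-≡ (cong proj₁ eq)) (Sub-≡ (cong proj₂ eq))

  module Basis (b₁ b₂ : Carrier) (independent : det b₁ b₂ ≢ 0#) where
    private
      -- Both determinants are skew, so their quotient lies in ℱ_q.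
      ratio-real : ∀ x y → bar (det x y * det b₁ b₂ ⁻¹) ≡ det x y * det b₁ b₂ ⁻¹
      ratio-real x y = *-cancelʳ (-‿nonzero independent) (begin
        bar (det x y * det b₁ b₂ ⁻¹) * - det b₁ b₂  ≡⟨ cong (bar (det x y * det b₁ b₂ ⁻¹) *_) (bar-det b₁ b₂) ⟨
        bar (det x y * det b₁ b₂ ⁻¹) * bar (det b₁ b₂)  ≡⟨ Bar.*-homo _ _ ⟨
        bar (det x y * det b₁ b₂ ⁻¹ * det b₁ b₂)  ≡⟨ cong bar (cancel (det x y)) ⟩
        bar (det x y)  ≡⟨ bar-det x y ⟩
        - det x y  ≡⟨ cong -_ (cancel (det x y)) ⟨
        - (det x y * det b₁ b₂ ⁻¹ * det b₁ b₂)  ≡⟨ -‿distribʳ-* _ _ ⟩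
        det x y * det b₁ b₂ ⁻¹ * - det b₁ b₂  ∎)
        where
        open ≡-Reasoning
        cancel : ∀ y → y * det b₁ b₂ ⁻¹ * det b₁ b₂ ≡ y
        cancel y = trans (*-assoc _ _ _) (trans (cong (y *_) (*-inverseˡ independent)) (*-identityʳ y))

    coordinates : Carrier → Pair K q
    coordinates z = (det z b₂ * det b₁ b₂ ⁻¹ , ratio-real z b₂) , (det b₁ z * det b₁ b₂ ⁻¹ , ratio-real b₁ z)

    combination : Pair K q → Carrier
    combination ((x , _) , (y , _)) = x * b₁ + y * b₂

    private
      scale : ∀ {x y} → x ≡ y * det b₁ b₂ → x * det b₁ b₂ ⁻¹ ≡ y
      scale {x} {y} eq = trans (cong (_* det b₁ b₂ ⁻¹) eq) (trans (*-assoc y _ _) (trans (cong (y *_) (*-inverseʳ independent)) (*-identityʳ y)))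

    emb-coordinates : ∀ {x y} → bar x ≡ x → bar y ≡ y → emb K q (coordinates (x * b₁ + y * b₂)) ≡ (x , y)
    emb-coordinates {x} {y} x̄≡x ȳ≡y = cong₂ _,_ (scale (trans (cong (λ z → (x * b₁ + y * b₂) * bar b₂ - z * b₂) bar-sum)
        (solve 6 (λ x y b c b̄ c̄ → (x :* b :+ y :* c) :* c̄ :- (x :* b̄ :+ y :* c̄) :* c := x :* (b :* c̄ :- b̄ :* c)) refl x y b₁ b₂ (bar b₁) (bar b₂))))
      (scale (trans (cong (λ z → b₁ * z - bar b₁ * (x * b₁ + y * b₂)) bar-sum)
        (solve 6 (λ x y b c b̄ c̄ → b :* (x :* b̄ :+ y :* c̄) :- b̄ :* (x :* b :+ y :* c) := y :* (b :* c̄ :- b̄ :* c)) refl x y b₁ b₂ (bar b₁) (bar b₂))))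
      where
      bar-sum : bar (x * b₁ + y * b₂) ≡ x * bar b₁ + y * bar b₂
      bar-sum = trans (Bar.+-homo _ _) (cong₂ _+_ (trans (Bar.*-homo _ _) (cong (_* bar b₁) x̄≡x)) (trans (Bar.*-homo _ _) (cong (_* bar b₂) ȳ≡y)))

    coordinates-combination : ∀ v → coordinates (combination v) ≡ v
    coordinates-combination ((x , x̄≡x) , (y , ȳ≡y)) = Pair-≡ (emb-coordinates x̄≡x ȳ≡y)

    -- Cramer's rule.
    combination-coordinates : ∀ z → combination (coordinates z) ≡ z
    combination-coordinates z = trans
      (solve 7 (λ b c z b̄ c̄ z̄ i → (z :* c̄ :- z̄ :* c) :* i :* b :+ (b :* z̄ :- b̄ :* z) :* i :* c := z :* ((b :* c̄ :- b̄ :* c) :* i)) refl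
        b₁ b₂ z (bar b₁) (bar b₂) (bar z) (det b₁ b₂ ⁻¹))
      (trans (cong (z *_) (*-inverseʳ independent)) (*-identityʳ z))

    coordinates-bijective : Bijective _≡_ _≡_ coordinates
    coordinates-bijective = (λ {x} {y} eq → trans (sym (combination-coordinates x)) (trans (cong combination eq) (combination-coordinates y))) ,
      λ v → combination v , λ { refl → coordinates-combination v }

    combination-bijective : Bijective _≡_ _≡_ combination
    combination-bijective = (λ {u} {v} eq → trans (sym (coordinates-combination u)) (trans (cong coordinates eq) (coordinates-combination v))) ,
      λ z → coordinates z , λ { refl → combination-coordinates z }

    coordinates-additive : AdditiveTo K {q} coordinates
    coordinates-additive x y = cong₂ _,_
      (trans (cong (λ z → ((x + y) * bar b₂ - z * b₂) * det b₁ b₂ ⁻¹) (Bar.+-homo x y))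
        (solve 7 (λ x y x̄ ȳ b b̄ i → ((x :+ y) :* b̄ :- (x̄ :+ ȳ) :* b) :* i := (x :* b̄ :- x̄ :* b) :* i :+ (y :* b̄ :- ȳ :* b) :* i) refl
          x y (bar x) (bar y) b₂ (bar b₂) (det b₁ b₂ ⁻¹)))
      (trans (cong (λ z → (b₁ * z - bar b₁ * (x + y)) * det b₁ b₂ ⁻¹) (Bar.+-homo x y))
        (solve 7 (λ x y x̄ ȳ b b̄ i → (b :* (x̄ :+ ȳ) :- b̄ :* (x :+ y)) :* i := (b :* x̄ :- b̄ :* x) :* i :+ (b :* ȳ :- b̄ :* y) :* i) refl
          x y (bar x) (bar y) b₁ (bar b₁) (det b₁ b₂ ⁻¹)))

    combination-additive : AdditiveFrom K {q} combination
    combination-additive ((x , _) , (y , _)) ((x′ , _) , (y′ , _)) ((x″ , _) , (y″ , _)) eq =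
      trans (cong₂ (λ a b → a * b₁ + b * b₂) (cong proj₁ eq) (cong proj₂ eq))
        (solve 6 (λ x y x′ y′ b c → (x :+ x′) :* b :+ (y :+ y′) :* c := (x :* b :+ y :* c) :+ (x′ :* b :+ y′ :* c)) refl x y x′ y′ b₁ b₂)

  module Invertible (A C : Carrier) (nonsingular : N A ≢ N C) where
    private
      n = N A - N C
      n≢0 : n ≢ 0#
      n≢0 = nonsingular ∘ x-y≡0⇒x≡y
      n-real : bar n ≡ n
      n-real = trans (trans (Bar.+-homo _ _) (cong (bar (N A) +_) (Bar.-homo _)))
        (cong₂ _-_ (bar-N A) (bar-N C))

    -- The map `z ↦ A z + C z̄` has determinant `n = N A - N C` over ℱ_q, and its adjugate is
    -- `z ↦ Ā z - C z̄`.
    invert : Carrier → Carrier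
    invert z = (bar A * z - C * bar z) * n ⁻¹

    invert-correct : ∀ z → invert (A * z + C * bar z) ≡ z
    invert-correct z = trans (cong (λ y → (bar A * (A * z + C * bar z) - C * y) * n ⁻¹) (bar-sum z))
      (trans (solve 7 (λ A C Ā C̄ z z̄ i → (Ā :* (A :* z :+ C :* z̄) :- C :* (Ā :* z̄ :+ C̄ :* z)) :* i := z :* ((A :* Ā :- C :* C̄) :* i)) refl
          A C (bar A) (bar C) z (bar z) (n ⁻¹))
        (trans (cong (z *_) (*-inverseʳ n≢0)) (*-identityʳ z)))
      where
      bar-sum : ∀ z → bar (A * z + C * bar z) ≡ bar A * bar z + bar C * z
      bar-sum z = trans (Bar.+-homo _ _) (cong₂ _+_ (Bar.*-homo _ _) (trans (Bar.*-homo _ _) (cong (bar C *_) (bar-involutive z))))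

    invert-additive : Additive K invert
    invert-additive x y = trans (cong (λ w → (bar A * (x + y) - C * w) * n ⁻¹) (Bar.+-homo x y))
      (solve 7 (λ a c x y x̄ ȳ i → (a :* (x :+ y) :- c :* (x̄ :+ ȳ)) :* i := (a :* x :- c :* x̄) :* i :+ (a :* y :- c :* ȳ) :* i) refl
        (bar A) C x y (bar x) (bar y) (n ⁻¹))

    invert-bijective : Bijective _≡_ _≡_ invert
    invert-bijective = injective⇒bijective inj
      where
      recover : ∀ z → A * invert z + C * bar (invert z) ≡ z
      recover z = trans (cong (λ y → A * invert z + C * y) bar-invert)
        (trans (solve 7 (λ A C Ā C̄ z z̄ i → A :* ((Ā :* z :- C :* z̄) :* i) :+ C :* ((A :* z̄ :- C̄ :* z) :* i) := z :* ((A :* Ā :- C :* C̄) :* i)) refl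
            A C (bar A) (bar C) z (bar z) (n ⁻¹))
          (trans (cong (z *_) (*-inverseʳ n≢0)) (*-identityʳ z)))
        where
        bar-invert : bar (invert z) ≡ (A * bar z - bar C * z) * n ⁻¹
        bar-invert = trans (Bar.*-homo _ _) (cong₂ _*_ (trans (Bar.+-homo _ _) (cong₂ _+_
            (trans (Bar.*-homo _ _) (cong (_* bar z) (bar-involutive A)))
            (trans (Bar.-homo _) (cong -_ (trans (Bar.*-homo _ _) (cong (bar C *_) (bar-involutive z)))))))
          (trans (Bar.⁻¹-homo n≢0) (cong _⁻¹ n-real)))
      inj : Injective _≡_ _≡_ invert
      inj {x} {y} eq = trans (sym (recover x)) (trans (cong (λ z → A * z + C * bar z) eq) (recover y))

  +-real : ∀ {x y} → bar x ≡ x → bar y ≡ y → bar (x + y) ≡ x + y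
  +-real x̄≡x ȳ≡y = trans (Bar.+-homo _ _) (cong₂ _+_ x̄≡x ȳ≡y)

  *-real : ∀ {x y} → bar x ≡ x → bar y ≡ y → bar (x * y) ≡ x * y
  *-real x̄≡x ȳ≡y = trans (Bar.*-homo _ _) (cong₂ _*_ x̄≡x ȳ≡y)

  ⁻¹-real : ∀ {x} → x ≢ 0# → bar x ≡ x → bar (x ⁻¹) ≡ x ⁻¹
  ⁻¹-real x≢0 x̄≡x = trans (Bar.⁻¹-homo x≢0) (cong _⁻¹ x̄≡x)

  ^-real : ∀ {x} n → bar x ≡ x → bar (x ^ n) ≡ x ^ n
  ^-real {x} n x̄≡x = trans (^-comm x n q) (cong (_^ n) x̄≡x)

  φ-real : ∀ {x} → bar x ≡ x → bar (φ x) ≡ φ x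
  φ-real {x} x̄≡x = trans (frob-comm k ℓ x) (cong φ x̄≡x)

  P2-formula : ∀ ε v → P2 K {q} Q ε v ≡ (φ (proj₁ (emb K q v)) * proj₂ (emb K q v) ,
    φ (proj₁ (emb K q v)) * proj₁ (emb K q v) + ε * (φ (proj₂ (emb K q v)) * proj₂ (emb K q v)))
  P2-formula ε ((x , _) , (y , _)) = cong (φ x * y ,_) (cong₂ (λ a b → a + ε * b) (x^[Q+1] x) (x^[Q+1] y))

  -- For a, x, b, y ≠ 0 put w = x/a and t = y/b. The first equation says t = - φ w, and then the second one
  -- reads φ a · a · U = ε · φ b · b · φ U with U = w + φ w; as Q + 1 and Q - 1 are even, U ≠ 0 makes ε a square.
  module _ {e g : ℕ} (eℓ≡gk : e ℕ.* ℓ ≡ g ℕ.* k) (e-odd : ∃[ j ] e ≡ 1 ℕ.+ j ℕ.* 2)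
    {ε : Carrier} (ε≢0 : ε ≢ 0#) (ε-nonsquare : ∀ z → bar z ≡ z → z * z ≢ ε) where
    private
      -- `ρ = (Q - 1) / 2`, so that `φ x` is `x` times the square of `x^ρ`.
      ρ = proj₁ (odd-prime-power p-prime p≢2 ℓ)

      φ≡^ : ∀ x → φ x ≡ x * (x ^ ρ * x ^ ρ)
      φ≡^ x = trans (cong (x ^_) (proj₂ (odd-prime-power p-prime p≢2 ℓ))) (cong (x *_) (trans (cong (λ n → x ^ (ρ ℕ.+ n)) (ℕ.+-identityʳ ρ)) (^-+ x ρ ρ)))

      skew⇒0 : ∀ {a x} → bar a ≡ a → bar x ≡ x → a ≢ 0# → φ a * x + φ x * a ≡ 0# → x ≡ 0#
      skew⇒0 ā≡a x̄≡x a≢0 h = quotient-zero a≢0 (real-skew⇒0 {e} {g} eℓ≡gk e-odd (*-real x̄≡x (⁻¹-real a≢0 ā≡a)) (skew-quotient (frob-isEndo ℓ) a≢0 h))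

      square-root : ∀ {a b U} → bar a ≡ a → bar b ≡ b → bar U ≡ U → a ≢ 0# → b ≢ 0# → φ a * a * U ≡ ε * (φ b * b * φ U) → U ≡ 0#
      square-root {a} {b} {U} ā≡a b̄≡b Ū≡U a≢0 b≢0 eq with U ≟ 0#
      ... | yes U≡0 = U≡0
      ... | no U≢0 = contradiction z²≡ε (ε-nonsquare (s * t ⁻¹) (*-real s-real (⁻¹-real t≢0 t-real)))
        where
        open ≡-Reasoning
        s = a * a ^ ρ
        t = b * b ^ ρ * U ^ ρ
        s-real = *-real ā≡a (^-real ρ ā≡a)
        t-real = *-real (*-real b̄≡b (^-real ρ b̄≡b)) (^-real ρ Ū≡U)
        t≢0 : t ≢ 0#
        t≢0 = *-nonzero (*-nonzero b≢0 (^-nonzero ρ b≢0)) (^-nonzero ρ U≢0)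
        s²≡εt² : s * s ≡ ε * (t * t)
        s²≡εt² = *-cancelʳ U≢0 (begin
          a * a ^ ρ * (a * a ^ ρ) * U  ≡⟨ solve 3 (λ a x u → a :* x :* (a :* x) :* u := a :* (x :* x) :* a :* u) refl a (a ^ ρ) U ⟩
          a * (a ^ ρ * a ^ ρ) * a * U  ≡⟨ cong (λ y → y * a * U) (φ≡^ a) ⟨
          φ a * a * U  ≡⟨ eq ⟩
          ε * (φ b * b * φ U)  ≡⟨ cong₂ (λ x y → ε * (x * b * y)) (φ≡^ b) (φ≡^ U) ⟩
          ε * (b * (b ^ ρ * b ^ ρ) * b * (U * (U ^ ρ * U ^ ρ)))
            ≡⟨ solve 5 (λ e b x u y → e :* (b :* (x :* x) :* b :* (u :* (y :* y))) := e :* (b :* x :* y :* (b :* x :* y)) :* u) refl ε b (b ^ ρ) U (U ^ ρ) ⟩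
          ε * (t * t) * U  ∎)
        z²≡ε : s * t ⁻¹ * (s * t ⁻¹) ≡ ε
        z²≡ε = begin
          s * t ⁻¹ * (s * t ⁻¹)  ≡⟨ solve 2 (λ s i → s :* i :* (s :* i) := s :* s :* (i :* i)) refl s (t ⁻¹) ⟩
          s * s * (t ⁻¹ * t ⁻¹)  ≡⟨ cong (_* (t ⁻¹ * t ⁻¹)) s²≡εt² ⟩
          ε * (t * t) * (t ⁻¹ * t ⁻¹)  ≡⟨ solve 3 (λ e t i → e :* (t :* t) :* (i :* i) := e :* (t :* i :* (t :* i))) refl ε t (t ⁻¹) ⟩
          ε * (t * t ⁻¹ * (t * t ⁻¹))  ≡⟨ cong (λ y → ε * (y * y)) (*-inverseʳ t≢0) ⟩
          ε * (1# * 1#)  ≡⟨ trans (cong (ε *_) (*-identityˡ 1#)) (*-identityʳ ε) ⟩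
          ε  ∎

      cross-zero : ∀ {a b x y} → bar a ≡ a → bar b ≡ b → bar x ≡ x → bar y ≡ y → (a , b) ≢ (0# , 0#) →
        φ a * y + φ x * b ≡ 0# → (φ a * x + φ x * a) + ε * (φ b * y + φ y * b) ≡ 0# → (x , y) ≡ (0# , 0#)
      cross-zero {a} {b} {x} {y} ā≡a b̄≡b x̄≡x ȳ≡y ab≢0 eq₁ eq₂ with a ≟ 0# | b ≟ 0#
      ... | yes a≡0 | yes b≡0 = contradiction (cong₂ _,_ a≡0 b≡0) ab≢0
      ... | yes a≡0 | no b≢0 = cong₂ _,_ x≡0 (skew⇒0 b̄≡b ȳ≡y b≢0 (no-zero-divisors (begin
          ε * (φ b * y + φ y * b)  ≡⟨ +-identityˡ _ ⟨
          0# + ε * (φ b * y + φ y * b)  ≡⟨ cong (_+ ε * (φ b * y + φ y * b)) first ⟨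
          (φ a * x + φ x * a) + ε * (φ b * y + φ y * b)  ≡⟨ eq₂ ⟩
          0#  ∎) ε≢0))
        where
        open ≡-Reasoning
        φa≡0 : φ a ≡ 0#
        φa≡0 = trans (cong φ a≡0) Φ.0-homo
        x≡0 : x ≡ 0#
        x≡0 = Φ.zero⇒zero (no-zero-divisors (trans (*-comm b (φ x)) (trans (sym (trans (cong (λ z → z * y + φ x * b) φa≡0)
          (solve 2 (λ y z → :0 :* y :+ z := z) refl y (φ x * b)))) eq₁)) b≢0)
        first : φ a * x + φ x * a ≡ 0#
        first = trans (cong₂ (λ u v → u * x + φ x * v) φa≡0 a≡0) (solve 2 (λ x y → :0 :* x :+ y :* :0 := :0) refl x (φ x))
      ... | no a≢0 | yes b≡0 = cong₂ _,_ (skew⇒0 ā≡a x̄≡x a≢0 (begin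
          φ a * x + φ x * a  ≡⟨ solve 2 (λ u e → u := u :+ e :* :0) refl _ ε ⟩
          (φ a * x + φ x * a) + ε * 0#  ≡⟨ cong (λ z → (φ a * x + φ x * a) + ε * z) second ⟨
          (φ a * x + φ x * a) + ε * (φ b * y + φ y * b)  ≡⟨ eq₂ ⟩
          0#  ∎)) y≡0
        where
        open ≡-Reasoning
        y≡0 : y ≡ 0#
        y≡0 = no-zero-divisors (trans (sym (trans (cong (λ z → φ a * y + φ x * z) b≡0) (trans (cong (φ a * y +_) (zeroʳ _)) (+-identityʳ _)))) eq₁) (Φ.nonzero a≢0)
        second : φ b * y + φ y * b ≡ 0#
        second = trans (cong₂ (λ u v → φ b * u + φ y * v) y≡0 b≡0) (solve 2 (λ x y → x :* :0 :+ y :* :0 := :0) refl (φ b) (φ y))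
      ... | no a≢0 | no b≢0 = cong₂ _,_ x≡0 (trans y≡bt (trans (cong (b *_) (trans (cong -_ (trans (cong φ w≡0) Φ.0-homo)) -0#≈0#)) (zeroʳ b)))
        where
        open ≡-Reasoning
        w = x * a ⁻¹
        t = - φ w
        w-real = *-real x̄≡x (⁻¹-real a≢0 ā≡a)
        x≡aw : x ≡ a * w
        x≡aw = sym (trans (solve 3 (λ a x i → a :* (x :* i) := x :* (a :* i)) refl a x (a ⁻¹)) (trans (cong (x *_) (*-inverseʳ a≢0)) (*-identityʳ x)))
        φx≡ : φ x ≡ φ a * φ w
        φx≡ = trans (cong φ x≡aw) (Φ.*-homo a w)
        y≡bt : y ≡ b * t
        y≡bt = *-cancelˡ (Φ.nonzero a≢0) (begin
          φ a * y  ≡⟨ x+y≡0⇒x≡-y eq₁ ⟩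
          - (φ x * b)  ≡⟨ cong (λ z → - (z * b)) φx≡ ⟩
          - (φ a * φ w * b)  ≡⟨ solve 3 (λ p w b → :- (p :* w :* b) := p :* (b :* :- w)) refl (φ a) (φ w) b ⟩
          φ a * (b * t)  ∎)
        φy≡ : φ y ≡ φ b * - φ (φ w)
        φy≡ = trans (cong φ y≡bt) (trans (Φ.*-homo b t) (cong (φ b *_) (Φ.-homo (φ w))))
        U = w + φ w
        U-real : bar U ≡ U
        U-real = +-real w-real (φ-real w-real)
        relation : φ a * a * U ≡ ε * (φ b * b * φ U)
        relation = x-y≡0⇒x≡y (begin
          φ a * a * U - ε * (φ b * b * φ U)  ≡⟨ cong (λ z → φ a * a * U - ε * (φ b * b * z)) (Φ.+-homo w (φ w)) ⟩
          φ a * a * U - ε * (φ b * b * (φ w + φ (φ w)))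
            ≡⟨ solve 8 (λ a p b r w v z e → p :* a :* (w :+ v) :- e :* (r :* b :* (v :+ z))
                 := (p :* (a :* w) :+ p :* v :* a) :+ e :* (r :* (b :* :- v) :+ r :* (:- z) :* b)) refl a (φ a) b (φ b) w (φ w) (φ (φ w)) ε ⟩
          (φ a * (a * w) + φ a * φ w * a) + ε * (φ b * (b * t) + φ b * - φ (φ w) * b)
            ≡⟨ cong₂ (λ u v → u + ε * v) (cong₂ (λ u v → φ a * u + v * a) x≡aw φx≡) (cong₂ (λ u v → φ b * u + v * b) y≡bt φy≡) ⟨
          (φ a * x + φ x * a) + ε * (φ b * y + φ y * b)  ≡⟨ eq₂ ⟩
          0#  ∎)
        w≡0 : w ≡ 0#
        w≡0 = real-skew⇒0 {e} {g} eℓ≡gk e-odd w-real (x+y≡0⇒x≡-y (trans (+-comm _ _) (square-root ā≡a b̄≡b U-real a≢0 b≢0 relation)))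
        x≡0 : x ≡ 0#
        x≡0 = trans x≡aw (trans (cong (a *_) w≡0) (zeroʳ a))

    nonAdditive-P2 : ∀ u v w → emb K q w ≡ _+²_ K (emb K q u) (emb K q v) → emb K q u ≢ (0# , 0#) →
      P2 K {q} Q ε w ≡ _+²_ K (P2 K {q} Q ε u) (P2 K {q} Q ε v) → emb K q v ≡ (0# , 0#)
    nonAdditive-P2 u@((a , ā≡a) , (b , b̄≡b)) v@((x , x̄≡x) , (y , ȳ≡y)) w@((w₁ , _) , (w₂ , _)) w≡ u≢0 h =
      cross-zero ā≡a b̄≡b x̄≡x ȳ≡y u≢0 eq₁ eq₂
      where
      open ≡-Reasoning
      h′ : (φ (a + x) * (b + y) , φ (a + x) * (a + x) + ε * (φ (b + y) * (b + y)))
         ≡ (φ a * b + φ x * y , (φ a * a + ε * (φ b * b)) + (φ x * x + ε * (φ y * y)))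
      h′ = trans (cong₂ (λ s t → φ s * t , φ s * s + ε * (φ t * t)) (sym (cong proj₁ w≡)) (sym (cong proj₂ w≡)))
        (trans (sym (P2-formula ε w)) (trans h (cong₂ (_+²_ K) (P2-formula ε u) (P2-formula ε v))))
      eq₁ : φ a * y + φ x * b ≡ 0#
      eq₁ = trans (solve 4 (λ p s b y → p :* y :+ s :* b := (p :+ s) :* (b :+ y) :- (p :* b :+ s :* y)) refl (φ a) (φ x) b y)
        (x≡y⇒x-y≡0 (trans (cong (_* (b + y)) (sym (Φ.+-homo a x))) (cong proj₁ h′)))
      eq₂ : (φ a * x + φ x * a) + ε * (φ b * y + φ y * b) ≡ 0#
      eq₂ = trans (solve 9 (λ a b x y p r s t e → (p :* x :+ s :* a) :+ e :* (r :* y :+ t :* b)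
          := ((p :+ s) :* (a :+ x) :+ e :* ((r :+ t) :* (b :+ y))) :- ((p :* a :+ e :* (r :* b)) :+ (s :* x :+ e :* (t :* y)))) refl a b x y (φ a) (φ b) (φ x) (φ y) ε)
        (x≡y⇒x-y≡0 (trans (cong₂ (λ m n → m * (a + x) + ε * (n * (b + y))) (sym (Φ.+-homo a x)) (sym (Φ.+-homo b y))) (cong proj₂ h′)))

    linEquivPair⇒nonAdditive : ∀ {f} → LinEquivKPair K q f (P2 K {q} Q ε) → NonAdditive f
    linEquivPair⇒nonAdditive {f} (L₁ , L₂ , add₁ , _ , add₂ , (_ , surj₂) , eq) a x a≢0 h =
      trans (sym L₂v) (zero-image v (nonAdditive-P2 u v w refl u≢0 additive))
      where
      open ≡-Reasoning
      u = proj₁ (surj₂ a)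
      v = proj₁ (surj₂ x)
      L₂u : L₂ u ≡ a
      L₂u = proj₂ (surj₂ a) refl
      L₂v : L₂ v ≡ x
      L₂v = proj₂ (surj₂ x) refl
      w : Pair K q
      w = (_ , +-real (proj₂ (proj₁ u)) (proj₂ (proj₁ v))) , (_ , +-real (proj₂ (proj₂ u)) (proj₂ (proj₂ v)))
      zero-image : ∀ v → emb K q v ≡ (0# , 0#) → L₂ v ≡ 0#
      zero-image v v≡0 = x+x≈x⇒x≈0 _ (sym (add₂ v v v (trans v≡0 (sym (trans (cong₂ (_+²_ K) v≡0 v≡0) (cong₂ _,_ (+-identityˡ 0#) (+-identityˡ 0#)))))))
      u≢0 : emb K q u ≢ (0# , 0#)
      u≢0 u≡0 = a≢0 (trans (sym L₂u) (zero-image u u≡0))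
      additive : P2 K {q} Q ε w ≡ _+²_ K (P2 K {q} Q ε u) (P2 K {q} Q ε v)
      additive = begin
        P2 K {q} Q ε w  ≡⟨ trans (eq w) (cong (emb K q ∘ L₁ ∘ f) (trans (add₂ u v w refl) (cong₂ _+_ L₂u L₂v))) ⟩
        emb K q (L₁ (f (a + x)))  ≡⟨ trans (cong (emb K q ∘ L₁) h) (add₁ (f a) (f x)) ⟩
        _+²_ K (emb K q (L₁ (f a))) (emb K q (L₁ (f x)))  ≡⟨ cong₂ (_+²_ K) (trans (eq u) (cong (emb K q ∘ L₁ ∘ f) L₂u)) (trans (eq v) (cong (emb K q ∘ L₁ ∘ f) L₂v)) ⟨
        _+²_ K (P2 K {q} Q ε u) (P2 K {q} Q ε v)  ∎

-- Classification of the planar maps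

module Classification (p : ℕ) (p-prime : Prime p) (p≢2 : p ≢ 2) (K : FiniteField) (k : ℕ)
  (size≡ : FiniteField.size K ≡ p ℕ.^ (k ℕ.+ k)) (k≢0 : k ≢ 0) (ℓ : ℕ)
  (c : FiniteField.Carrier K × FiniteField.Carrier K × FiniteField.Carrier K × FiniteField.Carrier K) where
  open FieldProperties K
  open Endomorphisms K
  open Frobenius p p-prime p≢2 K k size≡ k≢0
  open Equivalences p p-prime p≢2 K k size≡ k≢0 ℓ
  private
    module Bar = IsEndomorphism (frob-isEndo k)
    module Φ = IsEndomorphism (frob-isEndo ℓ)

    -- Two skew elements are used: `ι₀`, which exists for all `k` and `ℓ`, and for odd `e` one that
    -- `φ` maps to itself or its negative.
    module WithSkew (ι : Carrier) (ι≢0 : ι ≢ 0#) (bar-ι : bar ι ≡ - ι) =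
      PlanarMaps.WithAutomorphism K 2≠0 bar (frob-isEndo k) bar-involutive ι ι≢0 bar-ι φ (frob-isEndo ℓ) (frob-comm ℓ k)

    module W₀ = WithSkew ι₀ ι₀≢0 bar-ι₀
    open W₀ using (L)
    open QuadraticForms 2≠0 bar (frob-isEndo k) bar-involutive ι₀ ι₀≢0 bar-ι₀ using (N)

  f : Carrier → Carrier
  f = fc K q Q c

  private
    f≡F : ∀ x → f x ≡ W₀.F c x
    f≡F = fc-formula (proj₁ c) (proj₁ (proj₂ c)) (proj₁ (proj₂ (proj₂ c))) (proj₂ (proj₂ (proj₂ c)))

    f-+ : ∀ a x → f (a + x) ≡ f a + f x + W₀.D c a x
    f-+ a x = trans (f≡F _) (trans (W₀.F-+ c a x) (cong (_+ W₀.D c a x) (sym (cong₂ _+_ (f≡F a) (f≡F x)))))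

    D≡0⇒additive : ∀ {a x} → W₀.D c a x ≡ 0# → f (a + x) ≡ f a + f x
    D≡0⇒additive {a} {x} eq = trans (f-+ a x) (trans (cong (f a + f x +_) eq) (+-identityʳ _))

    additive⇒D≡0 : ∀ {a x} → f (a + x) ≡ f a + f x → W₀.D c a x ≡ 0#
    additive⇒D≡0 {a} {x} eq = +-cancelˡ (f a + f x) _ _ (trans (sym (f-+ a x)) (trans eq (sym (+-identityʳ _))))

    D-0 : ∀ a → W₀.D c a 0# ≡ 0#
    D-0 a = x+x≈x⇒x≈0 _ (trans (sym (W₀.D-+ʳ c a 0# 0#)) (cong (W₀.D c a) (+-identityˡ 0#)))

    difference : ∀ a x → f (x + a) - f x ≡ f a + W₀.D c a x
    difference a x = trans (cong (_- f x) (trans (cong f (+-comm x a)) (f-+ a x)))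
      (solve 3 (λ u v w → u :+ v :+ w :- v := u :+ w) refl (f a) (f x) (W₀.D c a x))

  planar⇒nonDegenerate : Planar K f → W₀.NonDegenerate c
  planar⇒nonDegenerate planar a x a≢0 eq = proj₁ (planar a a≢0)
    (trans (difference a x) (trans (cong (f a +_) (trans eq (sym (D-0 a)))) (sym (difference a 0#))))

  nonDegenerate⇒planar : W₀.NonDegenerate c → Planar K f
  nonDegenerate⇒planar nd a a≢0 = injective⇒bijective λ {x} {y} eq → x-y≡0⇒x≡y (nd a (x - y) a≢0
    (+-cancelˡ (W₀.D c a y) _ _ (begin
      W₀.D c a y + W₀.D c a (x - y)  ≡⟨ W₀.D-+ʳ c a y (x - y) ⟨
      W₀.D c a (y + (x - y))  ≡⟨ cong (W₀.D c a) (solve 2 (λ x y → y :+ (x :- y) := x) refl x y) ⟩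
      W₀.D c a x  ≡⟨ +-cancelˡ (f a) _ _ (trans (sym (difference a x)) (trans eq (difference a y))) ⟩
      W₀.D c a y  ≡⟨ +-identityʳ _ ⟨
      W₀.D c a y + 0#  ∎)))
    where open ≡-Reasoning

  nonAdditive⇒planar : NonAdditive f → Planar K f
  nonAdditive⇒planar na = nonDegenerate⇒planar λ a x a≢0 eq → na a x a≢0 (D≡0⇒additive eq)

  planar⇒nonAdditive : Planar K f → NonAdditive f
  planar⇒nonAdditive planar a x a≢0 eq = planar⇒nonDegenerate planar a x a≢0 (additive⇒D≡0 eq)

  private
    L-additive : ∀ μ → Additive K (L μ)
    L-additive μ = W₀.L-+ μ

    L-bijective : ∀ {μ} → N μ ≢ 1# → Bijective _≡_ _≡_ (L μ)
    L-bijective {μ} Nμ≢1 = injective⇒bijective λ {x} {y} eq → case x - y ≟ 0# of λ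
      { (yes x-y≡0) → x-y≡0⇒x≡y x-y≡0
      ; (no x-y≢0) → contradiction (trans (W₀.L-+ μ x (- y)) (trans (cong₂ _+_ eq (L-neg y)) (-‿inverseʳ _))) (W₀.L-nonzero Nμ≢1 x-y≢0) }
      where
      L-neg : ∀ y → L μ (- y) ≡ - L μ y
      L-neg y = trans (cong (λ z → - y + μ * z) (Bar.-homo y)) (solve 3 (λ y m z → :- y :+ m :* :- z := :- (y :+ m :* z)) refl y μ (bar y))

    monomial⇒linEquiv : ∀ {μ A C} {F G : Carrier → Carrier} → N μ ≢ 1# → N A ≢ N C →
      (∀ x → F (L μ x) ≡ A * G x + C * bar (G x)) → LinEquivKK K F G
    monomial⇒linEquiv {μ} {A} {C} {F} {G} Nμ≢1 NA≢NC formula = invert , L μ , invert-additive , invert-bijective , L-additive μ , L-bijective Nμ≢1 ,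
      λ x → sym (trans (cong invert (formula x)) (invert-correct (G x)))
      where open Invertible A C NA≢NC

    linEquiv-resp : ∀ {F F′ G G′} → (∀ x → F x ≡ F′ x) → (∀ x → G x ≡ G′ x) → LinEquivKK K F G → LinEquivKK K F′ G′
    linEquiv-resp F≡ G≡ (L₁ , L₂ , add₁ , bij₁ , add₂ , bij₂ , eq) = L₁ , L₂ , add₁ , bij₁ , add₂ , bij₂ ,
      λ x → trans (sym (G≡ x)) (trans (eq x) (cong L₁ (F≡ (L₂ x))))

    bar-injective : Injective _≡_ _≡_ bar
    bar-injective {x} {y} eq = trans (sym (bar-involutive x)) (trans (cong bar eq) (bar-involutive y))

    linEquiv-bar : ∀ {F G} → LinEquivKK K F G → LinEquivKK K F (bar ∘ G)
    linEquiv-bar (L₁ , L₂ , add₁ , (inj₁′ , _) , add₂ , bij₂ , eq) = bar ∘ L₁ , L₂ ,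
      (λ x y → trans (cong bar (add₁ x y)) (Bar.+-homo _ _)) , injective⇒bijective (λ eq → inj₁′ (bar-injective eq)) , add₂ , bij₂ , λ x → cong bar (eq x)

    -- Additivity of `z` at `1#` and `ι` would pass to `F` at `L μ 1#` and `L μ ι`. This excludes
    -- the monomial that does not fit the parity of `g`.
    monomial-nonAdditive : ∀ {F z : Carrier → Carrier} {μ A C ι} → NonAdditive F → N μ ≢ 1# → ι ≢ 0# →
      (∀ x → F (L μ x) ≡ A * z x + C * bar (z x)) → z (1# + ι) ≢ z 1# + z ι
    monomial-nonAdditive {F} {z} {μ} {A} {C} {ι} na Nμ≢1 ι≢0 formula z-sum =
      W₀.L-nonzero Nμ≢1 ι≢0 (na (L μ 1#) (L μ ι) (W₀.L-nonzero Nμ≢1 1≢0) (begin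
        F (L μ 1# + L μ ι)  ≡⟨ cong F (L-additive μ 1# ι) ⟨
        F (L μ (1# + ι))  ≡⟨ formula (1# + ι) ⟩
        A * z (1# + ι) + C * bar (z (1# + ι))  ≡⟨ cong (λ y → A * y + C * bar y) z-sum ⟩
        A * (z 1# + z ι) + C * bar (z 1# + z ι)  ≡⟨ cong (λ y → A * (z 1# + z ι) + C * y) (Bar.+-homo _ _) ⟩
        A * (z 1# + z ι) + C * (bar (z 1#) + bar (z ι))
          ≡⟨ solve 6 (λ a c u v ū v̄ → a :* (u :+ v) :+ c :* (ū :+ v̄) := (a :* u :+ c :* ū) :+ (a :* v :+ c :* v̄)) refl A C (z 1#) (z ι) (bar (z 1#)) (bar (z ι)) ⟩
        (A * z 1# + C * bar (z 1#)) + (A * z ι + C * bar (z ι))  ≡⟨ cong₂ _+_ (formula 1#) (formula ι) ⟨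
        F (L μ 1#) + F (L μ ι)  ∎))
      where open ≡-Reasoning

    -- The cross terms `ψ ι` and `χ ι` cancel.
    opposite⇒additive : ∀ {ψ χ : Carrier → Carrier} → IsEndomorphism ψ → IsEndomorphism χ → ∀ {ι} → χ ι ≡ - ψ ι →
      ψ (1# + ι) * χ (1# + ι) ≡ ψ 1# * χ 1# + ψ ι * χ ι
    opposite⇒additive {ψ} {χ} ψ-endo χ-endo {ι} eq = begin
      ψ (1# + ι) * χ (1# + ι)  ≡⟨ cong₂ _*_ (trans (Ψ.+-homo 1# ι) (cong (_+ ψ ι) Ψ.1-homo)) (trans (X.+-homo 1# ι) (cong₂ _+_ X.1-homo eq)) ⟩
      (1# + ψ ι) * (1# - ψ ι)  ≡⟨ solve 1 (λ i → (:1 :+ i) :* (:1 :- i) := :1 :* :1 :+ i :* :- i) refl (ψ ι) ⟩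
      1# * 1# + ψ ι * - ψ ι  ≡⟨ cong₂ _+_ (cong₂ _*_ Ψ.1-homo X.1-homo) (cong (ψ ι *_) eq) ⟨
      ψ 1# * χ 1# + ψ ι * χ ι  ∎
      where
      open ≡-Reasoning
      module Ψ = IsEndomorphism ψ-endo
      module X = IsEndomorphism χ-endo

    idEndo : IsEndomorphism (λ x → x)
    idEndo = record { +-homo = λ _ _ → refl ; *-homo = λ _ _ → refl ; 1-homo = refl }

  -- On K, the maps x ↦ x^Q with k ∣ ℓ are the identity and bar, so f is a quadratic form a x² + b x x̄ + c x̄² over ℱ_q;
  -- it is written as B c* x x with c* symmetric.
  module SymmetricCase {g : ℕ} (ℓ≡gk : ℓ ≡ g ℕ.* k) where
    module Id = PlanarMaps.WithAutomorphism K 2≠0 bar (frob-isEndo k) bar-involutive ι₀ ι₀≢0 bar-ι₀ (λ x → x) idEndo (λ _ → refl)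
    open QuadraticForms 2≠0 bar (frob-isEndo k) bar-involutive ι₀ ι₀≢0 bar-ι₀ using (swap; q₁; α₁; β₁; bar-α₁; radical; polar≡0⇒form≡0)

    c₀ = proj₁ c
    c₁ = proj₁ (proj₂ c)
    c₂ = proj₁ (proj₂ (proj₂ c))
    c₃ = proj₂ (proj₂ (proj₂ c))

    φ-even : (∃[ j ] g ≡ j ℕ.* 2) → ∀ x → φ x ≡ x
    φ-even (j , refl) x = trans (cong (λ n → frob n x) ℓ≡gk) (frob-even-multiple j x)

    φ-odd : (∃[ j ] g ≡ 1 ℕ.+ j ℕ.* 2) → ∀ x → φ x ≡ bar x
    φ-odd (j , refl) x = trans (cong (λ n → frob n x) ℓ≡gk) (trans (sym (frob-∘ k (j ℕ.* 2 ℕ.* k) x)) (cong bar (frob-even-multiple j x)))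

    symmetrised : ∃[ c* ] (swap c* ≡ c* × (∀ x → f x ≡ Id.F c* x))
    symmetrised with evenOrOdd g
    ... | inj₁ even = (c₀ , h , h , c₃) , refl , λ x → begin
        f x  ≡⟨ f≡F x ⟩
        (c₃ * φ x + c₁ * bar (φ x)) * x + (c₂ * φ x + c₀ * bar (φ x)) * bar x
          ≡⟨ cong (λ y → (c₃ * y + c₁ * bar y) * x + (c₂ * y + c₀ * bar y) * bar x) (φ-even even x) ⟩
        (c₃ * x + c₁ * bar x) * x + (c₂ * x + c₀ * bar x) * bar x
          ≡⟨ solve 6 (λ a b c d x y → (d :* x :+ b :* y) :* x :+ (c :* x :+ a :* y) :* y := d :* (x :* x) :+ a :* (y :* y) :+ (b :+ c) :* (x :* y)) refl c₀ c₁ c₂ c₃ x (bar x) ⟩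
        c₃ * (x * x) + c₀ * (bar x * bar x) + (c₁ + c₂) * (x * bar x)  ≡⟨ cong (λ y → c₃ * (x * x) + c₀ * (bar x * bar x) + y * (x * bar x)) (double-half _) ⟨
        c₃ * (x * x) + c₀ * (bar x * bar x) + (1# + 1#) * h * (x * bar x)
          ≡⟨ solve 5 (λ a d h x y → d :* (x :* x) :+ a :* (y :* y) :+ :2 :* h :* (x :* y) := (d :* x :+ h :* y) :* x :+ (h :* x :+ a :* y) :* y) refl c₀ c₃ h x (bar x) ⟩
        (c₃ * x + h * bar x) * x + (h * x + c₀ * bar x) * bar x  ∎
      where
      open ≡-Reasoning
      h = half (c₁ + c₂)
    ... | inj₂ odd = (c₂ , h , h , c₁) , refl , λ x → begin
        f x  ≡⟨ f≡F x ⟩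
        (c₃ * φ x + c₁ * bar (φ x)) * x + (c₂ * φ x + c₀ * bar (φ x)) * bar x
          ≡⟨ cong₂ (λ y z → (c₃ * y + c₁ * z) * x + (c₂ * y + c₀ * z) * bar x) (φ-odd odd x) (trans (cong bar (φ-odd odd x)) (bar-involutive x)) ⟩
        (c₃ * bar x + c₁ * x) * x + (c₂ * bar x + c₀ * x) * bar x
          ≡⟨ solve 6 (λ a b c d x y → (d :* y :+ b :* x) :* x :+ (c :* y :+ a :* x) :* y := b :* (x :* x) :+ c :* (y :* y) :+ (a :+ d) :* (x :* y)) refl c₀ c₁ c₂ c₃ x (bar x) ⟩
        c₁ * (x * x) + c₂ * (bar x * bar x) + (c₀ + c₃) * (x * bar x)  ≡⟨ cong (λ y → c₁ * (x * x) + c₂ * (bar x * bar x) + y * (x * bar x)) (double-half _) ⟨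
        c₁ * (x * x) + c₂ * (bar x * bar x) + (1# + 1#) * h * (x * bar x)
          ≡⟨ solve 5 (λ b c h x y → b :* (x :* x) :+ c :* (y :* y) :+ :2 :* h :* (x :* y) := (b :* x :+ h :* y) :* x :+ (h :* x :+ c :* y) :* y) refl c₁ c₂ h x (bar x) ⟩
        (c₁ * x + h * bar x) * x + (h * x + c₂ * bar x) * bar x  ∎
      where
      open ≡-Reasoning
      h = half (c₀ + c₃)

    surjective : Id.TraceSurjective
    surjective z z̄≡z = half z , trans (frob-half k z) (cong half z̄≡z) , trans (solve 1 (λ s → s :+ s := :2 :* s) refl (half z)) (double-half z)

    linEquiv-X² : NonAdditive f → LinEquivKK K f (λ x → x ^ 2)
    linEquiv-X² na = linEquiv (proj₁ symmetrised) (proj₁ (proj₂ symmetrised)) (proj₂ (proj₂ symmetrised))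
      where
      linEquiv : ∀ c* → swap c* ≡ c* → (∀ x → f x ≡ Id.F c* x) → LinEquivKK K f (λ x → x ^ 2)
      linEquiv c* sym-c* f≡ = from-form form′
        where
        na* : NonAdditive (Id.F c*)
        na* = NonAdditive-resp f≡ na
        nd : Id.NonDegenerate c*
        nd a x a≢0 D≡0 = na* a x a≢0 (trans (Id.F-+ c* a x) (trans (cong (Id.F c* a + Id.F c* x +_) D≡0) (+-identityʳ _)))
        -- By symmetry the two determinant forms coincide, so a radical vector is already a common
        -- zero.
        Δ≢0 : Id.Δ c* ≢ 0#
        Δ≢0 Δ≡0 = let e , e≢0 , rad = radical {α₁ c*} {β₁ c*} (bar-α₁ c*) Δ≡0
                      q≡0 = polar≡0⇒form≡0 {α₁ c*} {β₁ c*} {e} (rad e)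
                  in Id.no-common-zero nd surjective e≢0 q≡0 (trans (cong (λ c → q₁ c e) sym-c*) q≡0)
        form′ : Id.MonomialForm c*
        form′ = Id.monomialForm surjective real-√ (λ c → swap c ≡ c) (λ {c} μ → Id.symmetric-transform (λ _ → refl) {c} μ)
          (λ _ s _ → Id.symmetric⇒proportional (λ _ → refl) s) nd sym-c* Δ≢0
        from-form : Id.MonomialForm c* → LinEquivKK K f (λ x → x ^ 2)
        from-form record { Nμ≢1 = Nμ≢1 ; NA≢NC = NA≢NC ; F-formula = inj₁ formula } =
          linEquiv-resp {Id.F c*} {f} {λ x → x * x} (λ x → sym (f≡ x)) (λ x → cong (x *_) (sym (x^1 x))) (monomial⇒linEquiv {F = Id.F c*} {G = λ x → x * x} Nμ≢1 NA≢NC formula)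
        from-form record { Nμ≢1 = Nμ≢1 ; F-formula = inj₂ formula } =
          contradiction (opposite⇒additive idEndo (frob-isEndo k) bar-ι₀) (monomial-nonAdditive {z = N} na* Nμ≢1 ι₀≢0 formula)

    linEquiv-X^[Q+1] : (∃[ j ] g ≡ j ℕ.* 2) → NonAdditive f → LinEquivKK K f (λ x → x ^ (Q ℕ.+ 1))
    linEquiv-X^[Q+1] even na = linEquiv-resp {f} {f} (λ _ → refl) (λ x → sym (trans (x^[Q+1] x)
      (trans (cong (_* x) (φ-even even x)) (cong (x *_) (sym (x^1 x)))))) (linEquiv-X² na)

    -- For odd `g`, `φ` is `bar`, so `x^(Q+q)` is the conjugate of `x²`.
    linEquiv-X^[Q+q] : (∃[ j ] g ≡ 1 ℕ.+ j ℕ.* 2) → NonAdditive f → LinEquivKK K f (λ x → x ^ (Q ℕ.+ q))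
    linEquiv-X^[Q+q] odd na = linEquiv-resp {f} {f} (λ _ → refl) (λ x → sym (trans (^-+ x Q q)
      (trans (cong (_* bar x) (φ-odd odd x)) (sym (trans (cong (λ y → bar (x * y)) (x^1 x)) (Bar.*-homo x x)))))) (linEquiv-bar {f} {λ x → x ^ 2} (linEquiv-X² na))

  module General (d e g h i : ℕ) (d≢0 : d ≢ 0) (k≡ed : k ≡ e ℕ.* d) (ℓ≡gd : ℓ ≡ g ℕ.* d)
    (not-both-even : ∀ a b → e ≡ a ℕ.* 2 → g ≡ b ℕ.* 2 → ⊥) (bezout : h ℕ.* ℓ ≡ d ℕ.+ i ℕ.* k) where

    eℓ≡gk : e ℕ.* ℓ ≡ g ℕ.* k
    eℓ≡gk = trans (cong (e ℕ.*_) ℓ≡gd) (trans (exchange e g d) (cong (g ℕ.*_) (sym k≡ed)))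
      where
      exchange : ∀ e g d → e ℕ.* (g ℕ.* d) ≡ g ℕ.* (e ℕ.* d)
      exchange = solve-∀

    private
      ∃ι = ∃-skew d e k≡ed
      ι = proj₁ ∃ι
      ι≢0 = proj₁ (proj₂ ∃ι)
      skew : frob d ι ≡ - ι
      skew = proj₂ (proj₂ ∃ι)

      φι-even : (∃[ j ] g ≡ j ℕ.* 2) → φ ι ≡ ι
      φι-even (j , g≡) = trans (cong (λ n → frob n ι) (trans ℓ≡gd (cong (ℕ._* d) g≡))) (frob-skew-even {d} skew j)

      φι-odd : (∃[ j ] g ≡ 1 ℕ.+ j ℕ.* 2) → φ ι ≡ - ι
      φι-odd (j , g≡) = trans (cong (λ n → frob n ι) (trans ℓ≡gd (cong (ℕ._* d) g≡))) (frob-skew-odd {d} skew j)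

    -- If `e` is even then `g` is odd, hence `ι` lies in ℱ_q and `φ ι = - ι`. By `D-self`,
    -- `D c 1# ι = (ι + φ ι) * F c 1#` is then zero.
    e-odd : NonAdditive f → ∃[ j ] e ≡ 1 ℕ.+ j ℕ.* 2
    e-odd na with evenOrOdd e | evenOrOdd g
    ... | inj₂ odd | _ = odd
    ... | inj₁ (a , e≡) | inj₁ (b , g≡) = ⊥-elim (not-both-even a b e≡ g≡)
    ... | inj₁ (a , e≡) | inj₂ odd = contradiction (na 1# (ι * 1#) 1≢0 (D≡0⇒additive (begin
        W₀.D c 1# (ι * 1#)  ≡⟨ W₀.D-self c 1# ι (trans (cong (λ n → frob n ι) (trans k≡ed (cong (ℕ._* d) e≡))) (frob-skew-even {d} skew a)) ⟩
        (ι + φ ι) * W₀.F c 1#  ≡⟨ cong (λ y → (ι + y) * W₀.F c 1#) (φι-odd odd) ⟩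
        (ι - ι) * W₀.F c 1#  ≡⟨ trans (cong (_* W₀.F c 1#) (-‿inverseʳ ι)) (zeroˡ _) ⟩
        0#  ∎))) (*-nonzero ι≢0 1≢0)
      where open ≡-Reasoning

    -- Only the parity of `g` is recorded here; that of `e` comes from `e-odd` in one direction and
    -- from the conditions of the theorem in the other.
    Item₁ Item₂ Item₃ : Set
    Item₁ = (∃[ j ] g ≡ j ℕ.* 2) × LinEquivKK K f (λ x → x ^ (Q ℕ.+ 1))
    Item₂ = (∃[ j ] g ≡ 1 ℕ.+ j ℕ.* 2) × LinEquivKK K f (λ x → x ^ (Q ℕ.+ q))
    Item₃ = Σ (Sub K q) λ ε → NonSquare K q ε × LinEquivKPair K q f (P2 K {q} Q (proj₁ ε))

    private
      module LargeExtension (na : NonAdditive f) (j : ℕ) (e≡ : e ≡ 1 ℕ.+ suc j ℕ.* 2) where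
        bar-ι : bar ι ≡ - ι
        bar-ι = trans (cong (λ n → frob n ι) (trans k≡ed (cong (ℕ._* d) e≡))) (frob-skew-odd {d} skew (suc j))

        module W = WithSkew ι ι≢0 bar-ι

        -- `D` does not involve `ι`, so `W.D` and `W₀.D` unfold to the same term.
        nd : W.NonDegenerate c
        nd a x a≢0 eq = na a x a≢0 (D≡0⇒additive eq)

        surjective : W.TraceSurjective
        surjective = trace-surjective ℓ {e} {g} (suc j , e≡) eℓ≡gk

        degenerate : W.Δ c ≡ 0# → Item₃
        degenerate Δ≡0 = (ε , ε-real) , (ε≢0 , λ { ((z , z̄≡z) , z²≡ε) → ε-nonsquare z z̄≡z z²≡ε }) ,
            E₁.coordinates , E₂.combination , E₁.coordinates-additive , E₁.coordinates-bijective ,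
            E₂.combination-additive , E₂.combination-bijective , formula
          where
          open W.DegenerateNormalForm (W.degenerate⇒normalForm nd surjective Δ≡0)
          module E₁ = Basis b₁ b₂ b-independent
          module E₂ = Basis e₁ e₂ e-independent
          formula : ∀ v → P2 K {q} Q ε v ≡ emb K q (E₁.coordinates (f (E₂.combination v)))
          formula v@((x , x̄≡x) , (y , ȳ≡y)) = trans (P2-formula ε v) (sym (trans
            (cong (emb K q ∘ E₁.coordinates) (trans (f≡F _) (F-formula x y x̄≡x ȳ≡y)))
            (E₁.emb-coordinates (*-real (φ-real x̄≡x) ȳ≡y)
              (+-real (*-real (φ-real x̄≡x) x̄≡x) (*-real ε-real (*-real (φ-real ȳ≡y) ȳ≡y))))))

        nondegenerate : W.Δ c ≢ 0# → Item₁ ⊎ Item₂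
        nondegenerate Δ≢0 = from-radix (odd-prime-power p-prime p≢2 d)
          where
          from-form : W.MonomialForm c → Item₁ ⊎ Item₂
          from-form record { Nμ≢1 = Nμ≢1 ; NA≢NC = NA≢NC ; F-formula = inj₁ formula } with evenOrOdd g
          ... | inj₁ even = inj₁ (even , linEquiv-resp {f} {f} {λ x → φ x * x} (λ _ → refl) (λ x → sym (x^[Q+1] x))
                  (monomial⇒linEquiv {F = f} {G = λ x → φ x * x} Nμ≢1 NA≢NC (λ x → trans (f≡F _) (formula x))))
          -- For odd `g`, `φ ι = - ι` makes `φ x * x` additive at `1#` and `ι`. For even `g` the
          -- same happens to `φ x * bar x`, since there `bar ι = - φ ι`.
          ... | inj₂ odd = contradiction (opposite⇒additive (frob-isEndo ℓ) idEndo (trans (sym (-‿involutive ι)) (cong -_ (sym (φι-odd odd)))))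
                  (monomial-nonAdditive {F = f} {z = λ x → φ x * x} na Nμ≢1 ι≢0 (λ x → trans (f≡F _) (formula x)))
          from-form record { Nμ≢1 = Nμ≢1 ; NA≢NC = NA≢NC ; F-formula = inj₂ formula } with evenOrOdd g
          ... | inj₁ even = contradiction (opposite⇒additive (frob-isEndo ℓ) (frob-isEndo k) (trans bar-ι (cong -_ (sym (φι-even even)))))
                  (monomial-nonAdditive {F = f} {z = λ x → φ x * bar x} na Nμ≢1 ι≢0 (λ x → trans (f≡F _) (formula x)))
          ... | inj₂ odd = inj₂ (odd , linEquiv-resp {f} {f} {λ x → φ x * bar x} (λ _ → refl) (λ x → sym (^-+ x Q q))
                  (monomial⇒linEquiv {F = f} {G = λ x → φ x * bar x} Nμ≢1 NA≢NC (λ x → trans (f≡F _) (formula x))))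
          from-radix : ∃[ r ] p ℕ.^ d ≡ suc (2 ℕ.* r) → Item₁ ⊎ Item₂
          from-radix (zero , D≡) = contradiction D≡ (ℕ.>⇒≢ (ℕ.^-monoʳ-< p 1<p {0} {d} (ℕ.n≢0⇒n>0 d≢0)))
          from-radix (suc r′ , D≡) = from-form (W.monomialForm surjective real-√ (λ _ → ⊤) (λ _ _ → tt)
              (λ nd′ _ Δ′≢0 → proportional nd′ Δ′≢0) nd tt Δ≢0)
            where
            -- `e = 1 + suc j * 2` computes to `3 + j * 2`, hence the argument `j * 2` for `e₂`.
            module Sep = Separation p p-prime p≢2 K k size≡ k≢0 d (j ℕ.* 2) r′ d≢0 (trans k≡ed (cong (ℕ._* d) e≡)) D≡
            proportional : ∀ {c} → W.NonDegenerate c → W.Δ c ≢ 0# → W.Proportional c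
            proportional nd′ Δ′≢0 with evenOrOdd g
            ... | inj₁ even = W.pencil⇒proportional surjective real-√ 1# (*-identityˡ 1#) Bar.1-homo Φ.1-homo
                    (trans (φι-even even) (sym (*-identityˡ ι))) Sep.T (Sep.T⇒ratio {ℓ} {h} {i} bezout) Sep.T-separates nd′ Δ′≢0
            ... | inj₂ odd = W.pencil⇒proportional surjective real-√ (- 1#) (solve 0 ((:- :1) :* (:- :1) := :1) refl)
                    (trans (Bar.-homo 1#) (cong -_ Bar.1-homo)) (trans (Φ.-homo 1#) (cong -_ Φ.1-homo))
                    (trans (φι-odd odd) (solve 1 (λ i → :- i := (:- :1) :* i) refl ι)) Sep.T (Sep.T⇒ratio {ℓ} {h} {i} bezout) Sep.T-separates nd′ Δ′≢0

    classify : NonAdditive f → Item₁ ⊎ Item₂ ⊎ Item₃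
    classify na with e-odd na
    ... | zero , e≡1 = symmetric (evenOrOdd g)
      where
      open SymmetricCase {g} (trans ℓ≡gd (cong (g ℕ.*_) (sym (trans k≡ed (trans (cong (ℕ._* d) e≡1) (ℕ.*-identityˡ d))))))
      symmetric : EvenOrOdd g → Item₁ ⊎ Item₂ ⊎ Item₃
      symmetric (inj₁ even) = inj₁ (even , linEquiv-X^[Q+1] even na)
      symmetric (inj₂ odd) = inj₂ (inj₁ (odd , linEquiv-X^[Q+q] odd na))
    ... | suc j , e≡ = by-cases (W.Δ c ≟ 0#)
      where
      open LargeExtension na j e≡
      by-cases : Dec (W.Δ c ≡ 0#) → Item₁ ⊎ Item₂ ⊎ Item₃
      by-cases (yes Δ≡0) = inj₂ (inj₂ (degenerate Δ≡0))
      by-cases (no Δ≢0) = case nondegenerate Δ≢0 of λ { (inj₁ item) → inj₁ item ; (inj₂ item) → inj₂ (inj₁ item) }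

    -- Since e and g are not both even, g even forces e odd.
    unclassify₁ : Item₁ → NonAdditive f
    unclassify₁ ((j , g≡) , equiv) = linEquiv⇒nonAdditive equiv (nonAdditive-X^[Q+1] {e} {g} eℓ≡gk odd (j , g≡))
      where
      odd : ∃[ j ] e ≡ 1 ℕ.+ j ℕ.* 2
      odd = case evenOrOdd e of λ { (inj₁ (i , e≡)) → ⊥-elim (not-both-even i j e≡ g≡) ; (inj₂ odd) → odd }

    unclassify₂ : (∃[ j ] e ≡ 1 ℕ.+ j ℕ.* 2) → Item₂ → NonAdditive f
    unclassify₂ odd (g-odd , equiv) = linEquiv⇒nonAdditive equiv (nonAdditive-X^[Q+q] {e} {g} eℓ≡gk odd g-odd)

    unclassify₃ : (∃[ j ] e ≡ 1 ℕ.+ j ℕ.* 2) → Item₃ → NonAdditive f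
    unclassify₃ odd (ε , (ε≢0 , nonsquare) , equiv) =
      linEquivPair⇒nonAdditive {e} {g} eℓ≡gk odd ε≢0 (λ z z̄≡z z²≡ε → nonsquare ((z , z̄≡z) , z²≡ε)) equiv

-- Parity conditions and the theorem

open import Data.Nat using (_^_; _*_; _+_)

odd⇒¬2∣ : ∀ {n} → (∃[ j ] n ≡ 1 + j * 2) → Odd n
odd⇒¬2∣ (j , n≡) (divides i n≡′) = ℕ.even≢odd i j (trans (ℕ.*-comm 2 i) (trans (sym n≡′) (trans n≡ (cong ℕ.suc (ℕ.*-comm j 2)))))

¬2∣⇒odd : ∀ {n} → Odd n → ∃[ j ] n ≡ 1 + j * 2
¬2∣⇒odd {n} odd = case evenOrOdd n of λ { (inj₁ (j , eq)) → contradiction (divides j eq) odd ; (inj₂ odd′) → odd′ }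

odd-*ˡ : ∀ {m n} → Odd (m * n) → Odd m
odd-*ˡ {m} {n} odd (divides j m≡) = odd (divides (j * n) (trans (cong (_* n) m≡) (regroup j n)))
  where
  regroup : ∀ j n → j * 2 * n ≡ j * n * 2
  regroup = solve-∀

odd-*ʳ : ∀ {m n} → Odd (m * n) → Odd n
odd-*ʳ {m} {n} odd = odd-*ˡ {n} {m} (odd ∘ subst (2 ∣_) (ℕ.*-comm n m))

odd-* : ∀ {m n} → (∃[ j ] m ≡ 1 + j * 2) → (∃[ j ] n ≡ 1 + j * 2) → ∃[ j ] m * n ≡ 1 + j * 2
odd-* (i , refl) (j , refl) = i + j + i * j * 2 , expand i j
  where
  expand : ∀ i j → (1 + i * 2) * (1 + j * 2) ≡ 1 + (i + j + i * j * 2) * 2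
  expand = solve-∀

module Parameters (k ℓ : ℕ) .{{_ : NonZero k}} .{{_ : NonZero ℓ}} where
  d e g : ℕ
  d = gcd k ℓ
  e = k /gcd[ k , ℓ ]
  g = ℓ /gcd[ k , ℓ ]

  k≢0 : k ≢ 0
  k≢0 = ℕ.≢-nonZero⁻¹ k

  ℓ≢0 : ℓ ≢ 0
  ℓ≢0 = ℕ.≢-nonZero⁻¹ ℓ

  d≢0 : d ≢ 0
  d≢0 = gcd[m,n]≢0 k ℓ (inj₁ k≢0)

  private instance
    d-nonZero : NonZero d
    d-nonZero = gcd-nonZero k ℓ

  k≡ed : k ≡ e * d
  k≡ed = sym (m/n*n≡m (gcd[m,n]∣m k ℓ))

  ℓ≡gd : ℓ ≡ g * d
  ℓ≡gd = sym (m/n*n≡m (gcd[m,n]∣n k ℓ))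

  kℓ/d²≡eg : (k * ℓ) /gcd[ k , ℓ ] /gcd[ k , ℓ ] ≡ e * g
  kℓ/d²≡eg = begin
    (k * ℓ) / d / d  ≡⟨ cong (λ n → n / d / d) (cong₂ _*_ k≡ed ℓ≡gd) ⟩
    (e * d) * (g * d) / d / d  ≡⟨ cong (λ n → n / d / d) (regroup e g d) ⟩
    (e * g * d) * d / d / d  ≡⟨ cong (_/ d) (m*n/n≡m (e * g * d) d) ⟩
    e * g * d / d  ≡⟨ m*n/n≡m (e * g) d ⟩
    e * g  ∎
    where
    open ≡-Reasoning
    regroup : ∀ e g d → (e * d) * (g * d) ≡ (e * g * d) * d
    regroup = solve-∀

  -- Otherwise `2 d` would be a common divisor of `k` and `ℓ` larger than their greatest one.
  not-both-even : ∀ a b → e ≡ a * 2 → g ≡ b * 2 → ⊥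
  not-both-even a b e≡ g≡ = ℕ.<⇒≱ (ℕ.m<m+n d (ℕ.n≢0⇒n>0 (d≢0 ∘ trans (sym (ℕ.+-identityʳ d))))) (∣⇒≤ (gcd-greatest
    (divides a (trans k≡ed (trans (cong (_* d) e≡) (ℕ.*-assoc a 2 d)))) (divides b (trans ℓ≡gd (trans (cong (_* d) g≡) (ℕ.*-assoc b 2 d))))))

theorem1p1 : (p k ℓ : ℕ) → Prime p → ¬ (p ≡ 2) → .{{_ : NonZero k}} → .{{_ : NonZero ℓ}} →
    (K : FiniteField) → FiniteField.size K ≡ (p ^ k) ^ 2 →
    (c : FiniteField.Carrier K × FiniteField.Carrier K × FiniteField.Carrier K × FiniteField.Carrier K) →
    (Planar K (fc K (p ^ k) (p ^ ℓ) c) ⇔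
    ((Even (ℓ /gcd[ k , ℓ ]) × LinEquivKK K (fc K (p ^ k) (p ^ ℓ) c) (λ x → FiniteField._^_ K x (p ^ ℓ + 1)))
    ⊎ (Odd (((k * ℓ) /gcd[ k , ℓ ]) /gcd[ k , ℓ ]) × LinEquivKK K (fc K (p ^ k) (p ^ ℓ) c) (λ x → FiniteField._^_ K x (p ^ ℓ + p ^ k)))
    ⊎ (Odd (k /gcd[ k , ℓ ]) × Σ (Sub K (p ^ k)) λ ε → NonSquare K (p ^ k) ε × LinEquivKPair K (p ^ k) (fc K (p ^ k) (p ^ ℓ) c) (P2 K {p ^ k} (p ^ ℓ) (Data.Product.proj₁ ε)))))
    × (k ∣ ℓ → (Planar K (fc K (p ^ k) (p ^ ℓ) c) ⇔ LinEquivKK K (fc K (p ^ k) (p ^ ℓ) c) (λ x → FiniteField._^_ K x 2)))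
theorem1p1 p k ℓ p-prime p≢2 K size≡q² c = mk⇔ classify-planar planar-from-item , λ k∣ℓ → mk⇔ (planar⇒X² k∣ℓ) X²⇒planar
  where
  open Parameters k ℓ
  size≡ : FiniteField.size K ≡ p ^ (k + k)
  size≡ = trans size≡q² (trans (cong (p ^ k *_) (ℕ.*-identityʳ (p ^ k))) (sym (ℕ.^-distribˡ-+-* p k k)))
  Bézout = bézout k ℓ k≢0 ℓ≢0
  h = proj₁ Bézout
  i = proj₁ (proj₂ Bézout)
  module C = Classification p p-prime p≢2 K k size≡ k≢0 ℓ c
  module G = C.General d e g h i d≢0 k≡ed ℓ≡gd not-both-even (proj₂ (proj₂ Bézout))
  module E = Equivalences p p-prime p≢2 K k size≡ k≢0 ℓ

  Item₁ Item₂ Item₃ : Set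
  Item₁ = Even (ℓ /gcd[ k , ℓ ]) × LinEquivKK K (fc K (p ^ k) (p ^ ℓ) c) (λ x → FiniteField._^_ K x (p ^ ℓ + 1))
  Item₂ = Odd (((k * ℓ) /gcd[ k , ℓ ]) /gcd[ k , ℓ ]) × LinEquivKK K (fc K (p ^ k) (p ^ ℓ) c) (λ x → FiniteField._^_ K x (p ^ ℓ + p ^ k))
  Item₃ = Odd (k /gcd[ k , ℓ ]) × Σ (Sub K (p ^ k)) λ ε → NonSquare K (p ^ k) ε × LinEquivKPair K (p ^ k) (fc K (p ^ k) (p ^ ℓ) c) (P2 K {p ^ k} (p ^ ℓ) (Data.Product.proj₁ ε))

  classify-planar : Planar K (fc K (p ^ k) (p ^ ℓ) c) → Item₁ ⊎ Item₂ ⊎ Item₃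
  classify-planar planar = from-classified (G.classify na)
    where
    na = C.planar⇒nonAdditive planar
    e-odd = G.e-odd na
    from-classified : G.Item₁ ⊎ G.Item₂ ⊎ G.Item₃ → Item₁ ⊎ Item₂ ⊎ Item₃
    from-classified (inj₁ ((j , g≡) , equiv)) = inj₁ (divides j g≡ , equiv)
    from-classified (inj₂ (inj₁ (g-odd , equiv))) = inj₂ (inj₁ (subst Odd (sym kℓ/d²≡eg) (odd⇒¬2∣ (odd-* e-odd g-odd)) , equiv))
    from-classified (inj₂ (inj₂ item)) = inj₂ (inj₂ (odd⇒¬2∣ e-odd , item))

  planar-from-item : Item₁ ⊎ Item₂ ⊎ Item₃ → Planar K (fc K (p ^ k) (p ^ ℓ) c)
  planar-from-item (inj₁ (divides j g≡ , equiv)) = C.nonAdditive⇒planar (G.unclassify₁ ((j , g≡) , equiv))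
  planar-from-item (inj₂ (inj₁ (odd , equiv))) = C.nonAdditive⇒planar (G.unclassify₂ (¬2∣⇒odd (odd-*ˡ {e} {g} eg-odd)) (¬2∣⇒odd (odd-*ʳ {e} {g} eg-odd) , equiv))
    where eg-odd = subst Odd kℓ/d²≡eg odd
  planar-from-item (inj₂ (inj₂ (odd , item))) = C.nonAdditive⇒planar (G.unclassify₃ (¬2∣⇒odd odd) item)

  planar⇒X² : k ∣ ℓ → Planar K (fc K (p ^ k) (p ^ ℓ) c) → LinEquivKK K (fc K (p ^ k) (p ^ ℓ) c) (λ x → FiniteField._^_ K x 2)
  planar⇒X² (divides j ℓ≡jk) planar = C.SymmetricCase.linEquiv-X² {j} ℓ≡jk (C.planar⇒nonAdditive planar)

  X²⇒planar : LinEquivKK K (fc K (p ^ k) (p ^ ℓ) c) (λ x → FiniteField._^_ K x 2) → Planar K (fc K (p ^ k) (p ^ ℓ) c)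
  X²⇒planar equiv = C.nonAdditive⇒planar (E.linEquiv⇒nonAdditive equiv E.nonAdditive-X²)
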